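{- Let $W$ be an irreducible $T$-module with endpoint $r$ and diameter $d=D-2r$. Then the following hold for $0\le i,j\le d$. (i) For a nonzero $u\in E_rW$, $$\langle E^*_{r+i}u,E^*_{r+j}u\rangle=\delta_{ij}\binom{d}{i}2^{ -d}\|u\|^2,\qquad \langle E^{\varepsilon}_{r+i}u,E^{\varepsilon}_{r+j}u\rangle=\delta_{ij}\binom{d}{i}2^{ -d}\|u\|^2.$$ (ii) For a nonzero $u^*\in E^*_rW$, $$\langle E^{\varepsilon}_{r+i}u^*,E^{\varepsilon}_{r+j}u^*\rangle=\delta_{ij}\binom{d}{i}2^{ -d}\|u^*\|^2,\qquad \langle E_{r+i}u^*,E_{r+j}u^*\rangle=\delta_{ij}\binom{d}{i}2^{ -d}\|u^*\|^2.$$ (iii) For a nonzero $u^{\varepsilon}\in E^{\varepsilon}_rW$, $$\langle E_{r+i}u^{\varepsilon},E_{r+j}u^{\varepsilon}\rangle=\delta_{ij}\binom{d}{i}2^{ -d}\|u^{\varepsilon}\|^2,\qquad \langle E^*_{r+i}u^{\varepsilon},E^*_{r+j}u^{\varepsilon}\rangle=\delta_{ij}\binom{d}{i}2^{ -d}\|u^{\varepsilon}\|^2.$$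
   Context: Let $D$ be a positive integer and let $Q_D$ be the $D$-cube: the graph with vertex set $X=\{0,1\}^D$, two vertices being adjacent iff they differ in exactly one coordinate; $\partial$ denotes path-length distance. $\mathrm{Mat}_X(\mathbb{C})$ is the algebra of complex matrices with rows and columns indexed by $X$, acting on $V=\mathbb{C}^X$ (column vectors) by left multiplication. $V$ carries the Hermitian inner product $\langle v,w\rangle=v^t\overline{w}$ (linear in the first argument), with $\|v\|^2=\langle v,v\rangle$. Write $\mathbf{i}^2=-1$. Let $A$ be the adjacency matrix of $Q_D$. Fix $x=(0,0,\ldots,0)\in X$. Let $A^*$ be the diagonal matrix in $\mathrm{Mat}_X(\mathbb{C})$ with $(y,y)$-entry $D-2\partial(x,y)$ for $y\in X$, and let $A^{\varepsilon}=-\mathbf{i}(AA^*-A^*A)/2$. Let $T$ be the subalgebra of $\mathrm{Mat}_X(\mathbb{C})$ generated by $A$ and $A^*$. The eigenvalues of $A$ are $\theta_i=D-2i$ $(0\le i\le D)$. For $0\le i\le D$: $E_i=\prod_{0\le j\le D,\,j\ne i}\frac{A-\theta_jI}{\theta_i-\theta_j}$ is the primitive idempotent of $A$ for $\theta_i$ (the orthogonal projection onto the $\theta_i$-eigenspace of $A$); $E_i^*$ is the diagonal matrix with $(y,y)$-entry $1$ if $\partial(x,y)=i$ and $0$ otherwise; and $E_i^{\varepsilon}=P^{ -1}E_iP$, where $P=P_1^{\otimes D}$ (Kronecker power, $P_{yz}=\prod_{k=1}^D(P_1)_{y_kz_k}$, invertible) with $P_1=\begin{pmatrix}1&1\\-\mathbf{i}&\mathbf{i}\end{pmatrix}$,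 rows and columns indexed by $0,1$ in that order. ($E_i^*$ and $E_i^{\varepsilon}$ are the primitive idempotents of $A^*$ and $A^{\varepsilon}$ for the eigenvalue $D-2i$.) A $T$-module is a subspace $W\subseteq V$ with $BW\subseteq W$ for all $B\in T$; it is irreducible if $W\ne0$ and it contains no $T$-modules other than $0$ and $W$. The endpoint of an irreducible $T$-module $W$ is $r=\min\{i\mid 0\le i\le D,\ E_i^*W\neq0\}$ (it is known that also $r=\min\{i\mid E_iW\ne0\}$), and its diameter is $d=|\{i\mid 0\le i\le D,\ E_i^*W\ne0\}|-1$; it is known that $d=D-2r$ and $0\le r\le D/2$. -}

module Defs where

open import Algebra.Bundles using (CommutativeRing)
open import Algebra.Structures using (IsCommutativeRing)
open import Data.Fin as Fin using (Fin; zero; suc; toℕ)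
import Data.Fin.Properties as Fin
open import Data.Fin.Subset using (Subset; _∈_; ∣_∣)
open import Data.Integer as ℤ using (+_)
open import Data.List as List using (upTo; filter)
open import Data.Nat as ℕ using (ℕ; zero; suc; _≤_; z≤n; s≤s)
open import Data.Nat.Combinatorics using () renaming (_C_ to _choose_)
import Data.Nat.Properties as ℕ
open import Data.Product using (Σ-syntax; ∃-syntax; _×_; _,_; proj₁; proj₂)
open import Data.Rational as ℚ using (ℚ; 0ℚ; 1ℚ; ½)
import Data.Rational.Properties as ℚ
open import Data.Vec as Vec using (Vec; []; _∷_; zip; zipWith; replicate; count)
import Data.Vec.Properties as Vec
open import Function using (_⇔_)
open import Level using (Level; 0ℓ)
open import Relation.Binary.PropositionalEquality as ≡ using (_≡_; refl; cong)
open import Relation.Binary.Structures using (IsEquivalence)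
open import Relation.Nullary using (¬_; yes; no; ¬?; contradiction)
open import Relation.Nullary.Decidable using (does; dec⇒maybe)
open import Relation.Unary using (Pred; _⊆_)
open import Data.Bool using (if_then_else_)
open import Tactic.RingSolver using (solve-∀)
open import Tactic.RingSolver.Core.AlmostCommutativeRing using (AlmostCommutativeRing; fromCommutativeRing)

private
  ℚ-ring : AlmostCommutativeRing 0ℓ 0ℓ
  ℚ-ring = fromCommutativeRing ℚ.+-*-commutativeRing (λ q → dec⇒maybe (0ℚ ℚ.≟ q))

module NullSequences
  {I : Set} (late : ℕ → I → Set)
  (late-mono : ∀ {M N i} → M ≤ N → late N i → late M i) where

  Null : (I → ℚ) → Set
  Null s = ∀ ε → 0ℚ ℚ.< ε → ∃[ N ] ∀ i → late N i → ℚ.∣ s i ∣ ℚ.< ε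

  Bounded : (I → ℚ) → Set
  Bounded s = ∃[ B ] 0ℚ ℚ.< B × ∃[ N ] ∀ i → late N i → ℚ.∣ s i ∣ ℚ.< B

  null-resp : ∀ {s t} → (∀ i → s i ≡ t i) → Null s → Null t
  null-resp s≡t s→0 ε ε>0 = let N , p = s→0 ε ε>0 in
    N , λ i l → ≡.subst (λ q → ℚ.∣ q ∣ ℚ.< ε) (s≡t i) (p i l)

  null-neg : ∀ s → Null s → Null (λ i → ℚ.- s i)
  null-neg s s→0 ε ε>0 = let N , p = s→0 ε ε>0 in
    N , λ i l → ≡.subst (ℚ._< ε) (≡.sym (ℚ.∣-p∣≡∣p∣ (s i))) (p i l)

  null-+ : ∀ s t → Null s → Null t → Null (λ i → s i ℚ.+ t i)
  null-+ s t s→0 t→0 ε ε>0 =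
    let M , p = s→0 (½ ℚ.* ε) ½ε>0
        N , q = t→0 (½ ℚ.* ε) ½ε>0
    in M ℕ.⊔ N , λ i l → ℚ.≤-<-trans (ℚ.∣p+q∣≤∣p∣+∣q∣ (s i) (t i))
      (≡.subst (ℚ.∣ s i ∣ ℚ.+ ℚ.∣ t i ∣ ℚ.<_) halves
        (ℚ.+-mono-< (p i (late-mono (ℕ.m≤m⊔n M N) l)) (q i (late-mono (ℕ.m≤n⊔m M N) l))))
    where
    ½ε>0 : 0ℚ ℚ.< ½ ℚ.* ε
    ½ε>0 = ℚ.*-monoʳ-<-pos ½ ε>0
    halves : ½ ℚ.* ε ℚ.+ ½ ℚ.* ε ≡ ε
    halves = ≡.trans (≡.sym (ℚ.*-distribʳ-+ ε ½ ½)) (ℚ.*-identityˡ ε)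

  null-* : ∀ b s → Bounded b → Null s → Null (λ i → b i ℚ.* s i)
  null-* b s (B , B>0 , M , p) s→0 ε ε>0 =
    let N , q = s→0 δ δ>0
    in M ℕ.⊔ N , λ i l →
      ≡.subst (ℚ._< ε) (≡.sym (ℚ.∣p*q∣≡∣p∣*∣q∣ (b i) (s i)))
        (ℚ.≤-<-trans
          (ℚ.*-monoʳ-≤-nonNeg ℚ.∣ s i ∣ {{ℚ.∣-∣-nonNeg (s i)}}
            (ℚ.<⇒≤ (p i (late-mono (ℕ.m≤m⊔n M N) l))))
          (≡.subst (B ℚ.* ℚ.∣ s i ∣ ℚ.<_) Bδ≡ε
            (ℚ.*-monoʳ-<-pos B (q i (late-mono (ℕ.m≤n⊔m M N) l)))))
    where
    instance
      B-pos : ℚ.Positive B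
      B-pos = ℚ.positive B>0
      B-nonZero : ℚ.NonZero B
      B-nonZero = ℚ.pos⇒nonZero B
      1/B-pos : ℚ.Positive (ℚ.1/ B)
      1/B-pos = ℚ.1/pos⇒pos B
    δ : ℚ
    δ = ℚ.1/ B ℚ.* ε
    δ>0 : 0ℚ ℚ.< δ
    δ>0 = ≡.subst (ℚ._< δ) (ℚ.*-zeroʳ (ℚ.1/ B)) (ℚ.*-monoʳ-<-pos (ℚ.1/ B) ε>0)
    Bδ≡ε : B ℚ.* δ ≡ ε
    Bδ≡ε = ≡.trans (≡.sym (ℚ.*-assoc B (ℚ.1/ B) ε))
             (≡.trans (cong (ℚ._* ε) (ℚ.*-inverseʳ B)) (ℚ.*-identityˡ ε))

private
  module Seq = NullSequences (λ N n → N ≤ n) ℕ.≤-trans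

  BothLate : ℕ → ℕ × ℕ → Set
  BothLate N (m , n) = N ≤ m × N ≤ n

  bothLate-mono : ∀ {M N p} → M ≤ N → BothLate N p → BothLate M p
  bothLate-mono M≤N (N≤m , N≤n) = ℕ.≤-trans M≤N N≤m , ℕ.≤-trans M≤N N≤n

  module DoubleSeq = NullSequences BothLate (λ {M} {N} {p} → bothLate-mono {M} {N} {p})

-- Reals are Cauchy sequences of rationals; the quotient is replaced by the
-- setoid equality _≈ℝ_ (the difference tends to zero).
IsCauchy : (ℕ → ℚ) → Set
IsCauchy x = ∀ ε → 0ℚ ℚ.< ε →
  ∃[ N ] (∀ m n → N ≤ m → N ≤ n → ℚ.∣ x m ℚ.- x n ∣ ℚ.< ε)

record ℝ : Set where
  no-eta-equality
  constructor mkℝ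
  field
    term   : ℕ → ℚ
    cauchy : IsCauchy term
open ℝ public

infix 4 _≈ℝ_
record _≈ℝ_ (x y : ℝ) : Set where
  constructor mk≈ℝ
  field
    close : ∀ ε → 0ℚ ℚ.< ε →
      ∃[ N ] (∀ n → N ≤ n → ℚ.∣ term x n ℚ.- term y n ∣ ℚ.< ε)
open _≈ℝ_ public

≡⇒≈ℝ : ∀ {x y} → (∀ n → term x n ≡ term y n) → x ≈ℝ y
≡⇒≈ℝ {x} {y} x≡y = mk≈ℝ λ ε ε>0 → 0 , λ n _ →
  ≡.subst (λ q → ℚ.∣ q ∣ ℚ.< ε)
    (≡.sym (≡.trans (cong (ℚ._- term y n) (x≡y n)) (ℚ.+-inverseʳ (term y n)))) ε>0

bounded : ∀ x → ∃[ B ] (0ℚ ℚ.< B × ∃[ N ] (∀ n → N ≤ n → ℚ.∣ term x n ∣ ℚ.< B))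
bounded x = let N , p = cauchy x 1ℚ (ℚ.positive⁻¹ 1ℚ) in
  1ℚ ℚ.+ ℚ.∣ term x N ∣ ,
  ℚ.+-mono-<-≤ (ℚ.positive⁻¹ 1ℚ) (ℚ.0≤∣p∣ (term x N)) ,
  N , λ n N≤n → ≡.subst (λ q → ℚ.∣ q ∣ ℚ.< 1ℚ ℚ.+ ℚ.∣ term x N ∣)
    (cancel (term x n) (term x N))
    (ℚ.≤-<-trans (ℚ.∣p+q∣≤∣p∣+∣q∣ (term x n ℚ.- term x N) (term x N))
      (ℚ.+-monoˡ-< ℚ.∣ term x N ∣ (p n N N≤n ℕ.≤-refl)))
  where
  cancel : ∀ a b → (a ℚ.- b) ℚ.+ b ≡ a
  cancel = solve-∀ ℚ-ring

private
  Δ₂ : (ℕ → ℚ) → ℕ × ℕ → ℚ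
  Δ₂ x (m , n) = x m ℚ.- x n

  Δ : ℝ → ℝ → ℕ → ℚ
  Δ x y n = term x n ℚ.- term y n

  fst snd : ℝ → ℕ × ℕ → ℚ
  fst x (m , n) = term x m
  snd x (m , n) = term x n

  toNull : ∀ x → DoubleSeq.Null (Δ₂ (term x))
  toNull x ε ε>0 = let N , p = cauchy x ε ε>0 in
    N , λ (m , n) (N≤m , N≤n) → p m n N≤m N≤n

  fromNull : ∀ x → DoubleSeq.Null (Δ₂ x) → IsCauchy x
  fromNull x c ε ε>0 = let N , p = c ε ε>0 in
    N , λ m n N≤m N≤n → p (m , n) (N≤m , N≤n)

  bounded₁ : ∀ x → DoubleSeq.Bounded (fst x)
  bounded₁ x = let B , B>0 , N , p = bounded x in B , B>0 , N , λ (m , n) (l , _) → p m l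

  bounded₂ : ∀ x → DoubleSeq.Bounded (snd x)
  bounded₂ x = let B , B>0 , N , p = bounded x in B , B>0 , N , λ (m , n) (_ , l) → p n l

  diff-+ : ∀ a b c d → (a ℚ.- b) ℚ.+ (c ℚ.- d) ≡ (a ℚ.+ c) ℚ.- (b ℚ.+ d)
  diff-+ = solve-∀ ℚ-ring

  diff-neg : ∀ a b → ℚ.- (a ℚ.- b) ≡ ℚ.- a ℚ.- ℚ.- b
  diff-neg = solve-∀ ℚ-ring

  diff-* : ∀ a b c d → a ℚ.* (c ℚ.- d) ℚ.+ d ℚ.* (a ℚ.- b) ≡ a ℚ.* c ℚ.- b ℚ.* d
  diff-* = solve-∀ ℚ-ring

  diff-sym : ∀ a b → ℚ.- (a ℚ.- b) ≡ b ℚ.- a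
  diff-sym = solve-∀ ℚ-ring

  diff-trans : ∀ a b c → (a ℚ.- b) ℚ.+ (b ℚ.- c) ≡ a ℚ.- c
  diff-trans = solve-∀ ℚ-ring

fromℚ : ℚ → ℝ
term (fromℚ q) n = q
cauchy (fromℚ q) ε ε>0 = 0 , λ m n _ _ →
  ≡.subst (λ p → ℚ.∣ p ∣ ℚ.< ε) (≡.sym (ℚ.+-inverseʳ q)) ε>0

infixl 6 _+ℝ_
infixl 7 _*ℝ_
infix 8 -ℝ_

_+ℝ_ : ℝ → ℝ → ℝ
term (x +ℝ y) n = term x n ℚ.+ term y n
cauchy (x +ℝ y) = fromNull (λ n → term x n ℚ.+ term y n)
  (DoubleSeq.null-resp (λ (m , n) → diff-+ (term x m) (term x n) (term y m) (term y n))
    (DoubleSeq.null-+ (Δ₂ (term x)) (Δ₂ (term y)) (toNull x) (toNull y)))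

-ℝ_ : ℝ → ℝ
term (-ℝ x) n = ℚ.- term x n
cauchy (-ℝ x) = fromNull (λ n → ℚ.- term x n)
  (DoubleSeq.null-resp (λ (m , n) → diff-neg (term x m) (term x n))
    (DoubleSeq.null-neg (Δ₂ (term x)) (toNull x)))

_*ℝ_ : ℝ → ℝ → ℝ
term (x *ℝ y) n = term x n ℚ.* term y n
cauchy (x *ℝ y) = fromNull (λ n → term x n ℚ.* term y n)
  (DoubleSeq.null-resp (λ (m , n) → diff-* (term x m) (term x n) (term y m) (term y n))
    (DoubleSeq.null-+ _ _
      (DoubleSeq.null-* (fst x) (Δ₂ (term y)) (bounded₁ x) (toNull y))
      (DoubleSeq.null-* (snd y) (Δ₂ (term x)) (bounded₂ y) (toNull x))))

ℝ-isCommutativeRing : IsCommutativeRing _≈ℝ_ _+ℝ_ _*ℝ_ -ℝ_ (fromℚ 0ℚ) (fromℚ 1ℚ)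
ℝ-isCommutativeRing = record
  { isRing = record
    { +-isAbelianGroup = record
      { isGroup = record
        { isMonoid = record
          { isSemigroup = record
            { isMagma = record { isEquivalence = equivalence ; ∙-cong = +-cong }
            ; assoc = +-assoc
            }
          ; identity = +-identityˡ , +-identityʳ
          }
        ; inverse = -‿inverseˡ , -‿inverseʳ
        ; ⁻¹-cong = -‿cong
        }
      ; comm = +-comm
      }
    ; *-cong = *-cong
    ; *-assoc = *-assoc
    ; *-identity = *-identityˡ , *-identityʳ
    ; distrib = distribˡ , distribʳ
    }
  ; *-comm = *-comm
  }
  where
  equivalence : IsEquivalence _≈ℝ_
  equivalence = record
    { refl  = ≡⇒≈ℝ λ _ → refl
    ; sym   = λ {x} {y} p → mk≈ℝ
        (Seq.null-resp (λ n → diff-sym (term x n) (term y n))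
          (Seq.null-neg (Δ x y) (close p)))
    ; trans = λ {x} {y} {z} p q → mk≈ℝ
        (Seq.null-resp (λ n → diff-trans (term x n) (term y n) (term z n))
          (Seq.null-+ (Δ x y) (Δ y z) (close p) (close q)))
    }
  +-cong : ∀ {x x′ y y′} → x ≈ℝ x′ → y ≈ℝ y′ → x +ℝ y ≈ℝ x′ +ℝ y′
  +-cong {x} {x′} {y} {y′} p q = mk≈ℝ
    (Seq.null-resp (λ n → diff-+ (term x n) (term x′ n) (term y n) (term y′ n))
      (Seq.null-+ (Δ x x′) (Δ y y′) (close p) (close q)))
  -‿cong : ∀ {x x′} → x ≈ℝ x′ → -ℝ x ≈ℝ -ℝ x′
  -‿cong {x} {x′} p = mk≈ℝ
    (Seq.null-resp (λ n → diff-neg (term x n) (term x′ n)) (Seq.null-neg (Δ x x′) (close p)))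
  *-cong : ∀ {x x′ y y′} → x ≈ℝ x′ → y ≈ℝ y′ → x *ℝ y ≈ℝ x′ *ℝ y′
  *-cong {x} {x′} {y} {y′} p q = mk≈ℝ
    (Seq.null-resp (λ n → diff-* (term x n) (term x′ n) (term y n) (term y′ n))
      (Seq.null-+ _ _ (Seq.null-* (term x) (Δ y y′) (bounded x) (close q))
                      (Seq.null-* (term y′) (Δ x x′) (bounded y′) (close p))))
  +-assoc : ∀ x y z → (x +ℝ y) +ℝ z ≈ℝ x +ℝ (y +ℝ z)
  +-assoc x y z = ≡⇒≈ℝ λ n → ℚ.+-assoc (term x n) (term y n) (term z n)
  +-comm : ∀ x y → x +ℝ y ≈ℝ y +ℝ x
  +-comm x y = ≡⇒≈ℝ λ n → ℚ.+-comm (term x n) (term y n)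
  +-identityˡ : ∀ x → fromℚ 0ℚ +ℝ x ≈ℝ x
  +-identityˡ x = ≡⇒≈ℝ λ n → ℚ.+-identityˡ (term x n)
  +-identityʳ : ∀ x → x +ℝ fromℚ 0ℚ ≈ℝ x
  +-identityʳ x = ≡⇒≈ℝ λ n → ℚ.+-identityʳ (term x n)
  -‿inverseˡ : ∀ x → -ℝ x +ℝ x ≈ℝ fromℚ 0ℚ
  -‿inverseˡ x = ≡⇒≈ℝ λ n → ℚ.+-inverseˡ (term x n)
  -‿inverseʳ : ∀ x → x +ℝ -ℝ x ≈ℝ fromℚ 0ℚ
  -‿inverseʳ x = ≡⇒≈ℝ λ n → ℚ.+-inverseʳ (term x n)
  *-assoc : ∀ x y z → (x *ℝ y) *ℝ z ≈ℝ x *ℝ (y *ℝ z)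
  *-assoc x y z = ≡⇒≈ℝ λ n → ℚ.*-assoc (term x n) (term y n) (term z n)
  *-comm : ∀ x y → x *ℝ y ≈ℝ y *ℝ x
  *-comm x y = ≡⇒≈ℝ λ n → ℚ.*-comm (term x n) (term y n)
  *-identityˡ : ∀ x → fromℚ 1ℚ *ℝ x ≈ℝ x
  *-identityˡ x = ≡⇒≈ℝ λ n → ℚ.*-identityˡ (term x n)
  *-identityʳ : ∀ x → x *ℝ fromℚ 1ℚ ≈ℝ x
  *-identityʳ x = ≡⇒≈ℝ λ n → ℚ.*-identityʳ (term x n)
  distribˡ : ∀ x y z → x *ℝ (y +ℝ z) ≈ℝ x *ℝ y +ℝ x *ℝ z
  distribˡ x y z = ≡⇒≈ℝ λ n → ℚ.*-distribˡ-+ (term x n) (term y n) (term z n)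
  distribʳ : ∀ x y z → (y +ℝ z) *ℝ x ≈ℝ y *ℝ x +ℝ z *ℝ x
  distribʳ x y z = ≡⇒≈ℝ λ n → ℚ.*-distribʳ-+ (term x n) (term y n) (term z n)

ℝ-commutativeRing : CommutativeRing 0ℓ 0ℓ
ℝ-commutativeRing = record { isCommutativeRing = ℝ-isCommutativeRing }

record ℂ : Set where
  no-eta-equality
  constructor mkℂ
  field
    re im : ℝ
open ℂ public

infix 4 _≈ℂ_
record _≈ℂ_ (z w : ℂ) : Set where
  constructor mk≈ℂ
  field
    re≈ : re z ≈ℝ re w
    im≈ : im z ≈ℝ im w
open _≈ℂ_ public

infixl 6 _+ℂ_
infixl 7 _*ℂ_
infix 8 -ℂ_

_+ℂ_ _*ℂ_ : ℂ → ℂ → ℂ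
re (z +ℂ w) = re z +ℝ re w
im (z +ℂ w) = im z +ℝ im w
re (z *ℂ w) = re z *ℝ re w +ℝ -ℝ (im z *ℝ im w)
im (z *ℂ w) = re z *ℝ im w +ℝ im z *ℝ re w

-ℂ_ : ℂ → ℂ
re (-ℂ z) = -ℝ re z
im (-ℂ z) = -ℝ im z

conj : ℂ → ℂ
re (conj z) = re z
im (conj z) = -ℝ im z

rational : ℚ → ℂ
re (rational q) = fromℚ q
im (rational q) = fromℚ 0ℚ

0ℂ 1ℂ 𝐢 : ℂ
0ℂ = rational 0ℚ
1ℂ = rational 1ℚ
re 𝐢 = fromℚ 0ℚ
im 𝐢 = fromℚ 1ℚ

≡⇒≈ℂ : ∀ {z w} → (∀ n → term (re z) n ≡ term (re w) n) →
       (∀ n → term (im z) n ≡ term (im w) n) → z ≈ℂ w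
≡⇒≈ℂ p q = mk≈ℂ (≡⇒≈ℝ p) (≡⇒≈ℝ q)

private
  re-assoc : ∀ a b c d e f →
    (a ℚ.* c ℚ.+ ℚ.- (b ℚ.* d)) ℚ.* e ℚ.+ ℚ.- ((a ℚ.* d ℚ.+ b ℚ.* c) ℚ.* f) ≡
    a ℚ.* (c ℚ.* e ℚ.+ ℚ.- (d ℚ.* f)) ℚ.+ ℚ.- (b ℚ.* (c ℚ.* f ℚ.+ d ℚ.* e))
  re-assoc = solve-∀ ℚ-ring

  im-assoc : ∀ a b c d e f →
    (a ℚ.* c ℚ.+ ℚ.- (b ℚ.* d)) ℚ.* f ℚ.+ (a ℚ.* d ℚ.+ b ℚ.* c) ℚ.* e ≡
    a ℚ.* (c ℚ.* f ℚ.+ d ℚ.* e) ℚ.+ b ℚ.* (c ℚ.* e ℚ.+ ℚ.- (d ℚ.* f))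
  im-assoc = solve-∀ ℚ-ring

  re-distribˡ : ∀ a b c d e f →
    a ℚ.* (c ℚ.+ e) ℚ.+ ℚ.- (b ℚ.* (d ℚ.+ f)) ≡
    (a ℚ.* c ℚ.+ ℚ.- (b ℚ.* d)) ℚ.+ (a ℚ.* e ℚ.+ ℚ.- (b ℚ.* f))
  re-distribˡ = solve-∀ ℚ-ring

  im-distribˡ : ∀ a b c d e f →
    a ℚ.* (d ℚ.+ f) ℚ.+ b ℚ.* (c ℚ.+ e) ≡
    (a ℚ.* d ℚ.+ b ℚ.* c) ℚ.+ (a ℚ.* f ℚ.+ b ℚ.* e)
  im-distribˡ = solve-∀ ℚ-ring

  re-comm : ∀ a b c d →
    a ℚ.* c ℚ.+ ℚ.- (b ℚ.* d) ≡ c ℚ.* a ℚ.+ ℚ.- (d ℚ.* b)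
  re-comm = solve-∀ ℚ-ring

  im-comm : ∀ a b c d → a ℚ.* d ℚ.+ b ℚ.* c ≡ c ℚ.* b ℚ.+ d ℚ.* a
  im-comm = solve-∀ ℚ-ring

  re-identity : ∀ a b → 1ℚ ℚ.* a ℚ.+ ℚ.- (0ℚ ℚ.* b) ≡ a
  re-identity = solve-∀ ℚ-ring

  im-identity : ∀ a b → 1ℚ ℚ.* b ℚ.+ 0ℚ ℚ.* a ≡ b
  im-identity = solve-∀ ℚ-ring

ℂ-isCommutativeRing : IsCommutativeRing _≈ℂ_ _+ℂ_ _*ℂ_ -ℂ_ 0ℂ 1ℂ
ℂ-isCommutativeRing = record
  { isRing = record
    { +-isAbelianGroup = record
      { isGroup = record
        { isMonoid = record
          { isSemigroup = record
            { isMagma = record { isEquivalence = equivalence ; ∙-cong = +-cong }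
            ; assoc = +-assoc
            }
          ; identity = +-identityˡ , +-identityʳ
          }
        ; inverse = -‿inverseˡ , -‿inverseʳ
        ; ⁻¹-cong = -‿cong
        }
      ; comm = +-comm
      }
    ; *-cong = *-cong
    ; *-assoc = *-assoc
    ; *-identity = *-identityˡ , *-identityʳ
    ; distrib = distribˡ , distribʳ
    }
  ; *-comm = *-comm
  }
  where
  module R = CommutativeRing ℝ-commutativeRing
  equivalence : IsEquivalence _≈ℂ_
  equivalence = record
    { refl  = mk≈ℂ R.refl R.refl
    ; sym   = λ p → mk≈ℂ (R.sym (re≈ p)) (R.sym (im≈ p))
    ; trans = λ p q → mk≈ℂ (R.trans (re≈ p) (re≈ q)) (R.trans (im≈ p) (im≈ q))
    }
  open IsEquivalence equivalence using (trans)
  *-cong : ∀ {x x′ y y′} → x ≈ℂ x′ → y ≈ℂ y′ → x *ℂ y ≈ℂ x′ *ℂ y′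
  *-cong p q = mk≈ℂ
    (R.+-cong (R.*-cong (re≈ p) (re≈ q)) (R.-‿cong (R.*-cong (im≈ p) (im≈ q))))
    (R.+-cong (R.*-cong (re≈ p) (im≈ q)) (R.*-cong (im≈ p) (re≈ q)))
  *-assoc : ∀ x y z → (x *ℂ y) *ℂ z ≈ℂ x *ℂ (y *ℂ z)
  *-assoc x y z = ≡⇒≈ℂ
    (λ n → re-assoc (term (re x) n) (term (im x) n) (term (re y) n) (term (im y) n)
                    (term (re z) n) (term (im z) n))
    (λ n → im-assoc (term (re x) n) (term (im x) n) (term (re y) n) (term (im y) n)
                    (term (re z) n) (term (im z) n))
  *-identityˡ : ∀ z → 1ℂ *ℂ z ≈ℂ z
  *-identityˡ z = ≡⇒≈ℂ (λ n → re-identity (term (re z) n) (term (im z) n))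
                       (λ n → im-identity (term (re z) n) (term (im z) n))
  *-comm : ∀ x y → x *ℂ y ≈ℂ y *ℂ x
  *-comm x y = ≡⇒≈ℂ
    (λ n → re-comm (term (re x) n) (term (im x) n) (term (re y) n) (term (im y) n))
    (λ n → im-comm (term (re x) n) (term (im x) n) (term (re y) n) (term (im y) n))
  distribˡ : ∀ x y z → x *ℂ (y +ℂ z) ≈ℂ x *ℂ y +ℂ x *ℂ z
  distribˡ x y z = ≡⇒≈ℂ
    (λ n → re-distribˡ (term (re x) n) (term (im x) n) (term (re y) n) (term (im y) n)
                       (term (re z) n) (term (im z) n))
    (λ n → im-distribˡ (term (re x) n) (term (im x) n) (term (re y) n) (term (im y) n)
                       (term (re z) n) (term (im z) n))
  +-cong : ∀ {x x′ y y′} → x ≈ℂ x′ → y ≈ℂ y′ → x +ℂ y ≈ℂ x′ +ℂ y′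
  +-cong p q = mk≈ℂ (R.+-cong (re≈ p) (re≈ q)) (R.+-cong (im≈ p) (im≈ q))
  -‿cong : ∀ {x x′} → x ≈ℂ x′ → -ℂ x ≈ℂ -ℂ x′
  -‿cong p = mk≈ℂ (R.-‿cong (re≈ p)) (R.-‿cong (im≈ p))
  +-assoc : ∀ x y z → (x +ℂ y) +ℂ z ≈ℂ x +ℂ (y +ℂ z)
  +-assoc x y z = mk≈ℂ (R.+-assoc (re x) (re y) (re z)) (R.+-assoc (im x) (im y) (im z))
  +-comm : ∀ x y → x +ℂ y ≈ℂ y +ℂ x
  +-comm x y = mk≈ℂ (R.+-comm (re x) (re y)) (R.+-comm (im x) (im y))
  +-identityˡ : ∀ x → 0ℂ +ℂ x ≈ℂ x
  +-identityˡ x = mk≈ℂ (R.+-identityˡ (re x)) (R.+-identityˡ (im x))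
  +-identityʳ : ∀ x → x +ℂ 0ℂ ≈ℂ x
  +-identityʳ x = mk≈ℂ (R.+-identityʳ (re x)) (R.+-identityʳ (im x))
  -‿inverseˡ : ∀ x → -ℂ x +ℂ x ≈ℂ 0ℂ
  -‿inverseˡ x = mk≈ℂ (R.-‿inverseˡ (re x)) (R.-‿inverseˡ (im x))
  -‿inverseʳ : ∀ x → x +ℂ -ℂ x ≈ℂ 0ℂ
  -‿inverseʳ x = mk≈ℂ (R.-‿inverseʳ (re x)) (R.-‿inverseʳ (im x))
  *-identityʳ : ∀ z → z *ℂ 1ℂ ≈ℂ z
  *-identityʳ z = trans (*-comm z 1ℂ) (*-identityˡ z)
  distribʳ : ∀ x y z → (y +ℂ z) *ℂ x ≈ℂ y *ℂ x +ℂ z *ℂ x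
  distribʳ x y z = trans (*-comm (y +ℂ z) x)
    (trans (distribˡ x y z) (+-cong (*-comm x y) (*-comm x z)))

ℂ-commutativeRing : CommutativeRing 0ℓ 0ℓ
ℂ-commutativeRing = record { isCommutativeRing = ℂ-isCommutativeRing }

X : ℕ → Set
X D = Vec (Fin 2) D

V : ℕ → Set
V D = X D → ℂ

Mat : ℕ → Set
Mat D = X D → X D → ℂ

infix 4 _≈ⱽ_ _≈ᴹ_

_≈ⱽ_ : ∀ {D} → V D → V D → Set
v ≈ⱽ w = ∀ y → v y ≈ℂ w y

_≈ᴹ_ : ∀ {D} → Mat D → Mat D → Set
B ≈ᴹ C = ∀ y z → B y z ≈ℂ C y z

sumX : ∀ {D} → (X D → ℂ) → ℂ
sumX {zero}  f = f []
sumX {suc D} f = sumX (λ y → f (zero ∷ y)) +ℂ sumX (λ y → f (suc zero ∷ y))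

infixl 6 _+ⱽ_ _+ᴹ_
infixr 7 _•ⱽ_ _•ᴹ_ _·ⱽ_
infixl 7 _·ᴹ_

0ⱽ : ∀ {D} → V D
0ⱽ y = 0ℂ

_+ⱽ_ : ∀ {D} → V D → V D → V D
(v +ⱽ w) y = v y +ℂ w y

_•ⱽ_ : ∀ {D} → ℂ → V D → V D
(c •ⱽ v) y = c *ℂ v y

1ᴹ : ∀ {D} → Mat D
1ᴹ y z = if does (Vec.≡-dec Fin._≟_ y z) then 1ℂ else 0ℂ

_+ᴹ_ : ∀ {D} → Mat D → Mat D → Mat D
(B +ᴹ C) y z = B y z +ℂ C y z

_•ᴹ_ : ∀ {D} → ℂ → Mat D → Mat D
(c •ᴹ B) y z = c *ℂ B y z

_·ᴹ_ : ∀ {D} → Mat D → Mat D → Mat D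
(B ·ᴹ C) y z = sumX λ w → B y w *ℂ C w z

_·ⱽ_ : ∀ {D} → Mat D → V D → V D
(B ·ⱽ v) y = sumX λ z → B y z *ℂ v z

⟨_,_⟩ : ∀ {D} → V D → V D → ℂ
⟨ v , w ⟩ = sumX λ y → v y *ℂ conj (w y)

‖_‖² : ∀ {D} → V D → ℂ
‖ v ‖² = ⟨ v , v ⟩

-- The number of coordinates in which two vertices differ.
differences : ∀ {D} → X D → X D → ℕ
differences y z = count (λ (a , b) → ¬? (a Fin.≟ b)) (zip y z)

Adjacent : ∀ {D} → X D → X D → Set
Adjacent y z = differences y z ≡ 1

data Walk {D : ℕ} : ℕ → X D → X D → Set where
  stop : ∀ {y} → Walk 0 y y
  step : ∀ {n y z w} → Adjacent y z → Walk n z w → Walk (suc n) y w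

IsDistance : ∀ {D} → X D → X D → ℕ → Set
IsDistance y z n = Walk n y z × (∀ m → Walk m y z → n ≤ m)

differences-refl : ∀ {D} (y : X D) → differences y y ≡ 0
differences-refl []       = refl
differences-refl (a ∷ y) with a Fin.≟ a
... | yes _  = differences-refl y
... | no a≢a = contradiction refl a≢a

differences-triangle : ∀ {D} (y z w : X D) →
  differences y w ≤ differences y z ℕ.+ differences z w
differences-triangle [] [] [] = z≤n
differences-triangle (a ∷ y) (b ∷ z) (c ∷ w)
  with ih ← differences-triangle y z w | a Fin.≟ c | a Fin.≟ b | b Fin.≟ c
... | yes _   | yes _    | yes _    = ih
... | yes _   | yes _    | no _     = ℕ.≤-trans ih (ℕ.+-monoʳ-≤ (differences y z) (ℕ.n≤1+n _))
... | yes _   | no _     | yes _    = ℕ.≤-trans ih (ℕ.n≤1+n _)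
... | yes _   | no _     | no _     =
  ℕ.≤-trans ih (ℕ.≤-trans (ℕ.n≤1+n _) (s≤s (ℕ.+-monoʳ-≤ (differences y z) (ℕ.n≤1+n _))))
... | no a≢c  | yes refl | yes refl = contradiction refl a≢c
... | no _    | yes _    | no _     =
  ℕ.≤-trans (s≤s ih) (ℕ.≤-reflexive (≡.sym (ℕ.+-suc (differences y z) (differences z w))))
... | no _    | no _     | yes _    = s≤s ih
... | no _    | no _     | no _     =
  s≤s (ℕ.≤-trans ih (ℕ.+-monoʳ-≤ (differences y z) (ℕ.n≤1+n _)))

differences-minimal : ∀ {D m} {y z : X D} → Walk m y z → differences y z ≤ m
differences-minimal {y = y} stop = ℕ.≤-reflexive (differences-refl y)
differences-minimal {y = y} {z} (step {z = w} adj p) =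
  ℕ.≤-trans (differences-triangle y w z)
    (ℕ.+-mono-≤ (ℕ.≤-reflexive adj) (differences-minimal p))

extend : ∀ {D n} {y z : X D} a → Walk n y z → Walk n (a ∷ y) (a ∷ z)
extend a stop = stop
extend a (step {y = y} {z} adj p) = step (lift a y z adj) (extend a p)
  where
  lift : ∀ {D} a (y z : X D) → Adjacent y z → Adjacent (a ∷ y) (a ∷ z)
  lift a y z adj with a Fin.≟ a
  ... | yes _  = adj
  ... | no a≢a = contradiction refl a≢a

geodesic : ∀ {D} (y z : X D) → Walk (differences y z) y z
geodesic [] [] = stop
geodesic (a ∷ y) (b ∷ z) with a Fin.≟ b
... | yes refl = extend a (geodesic y z)
... | no a≢b   = step flip (extend b (geodesic y z))
  where
  flip : Adjacent (a ∷ y) (b ∷ y)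
  flip with a Fin.≟ b
  ... | yes a≡b = contradiction a≡b a≢b
  ... | no _    = cong suc (differences-refl y)

distance : ∀ {D} (y z : X D) → ∃[ n ] IsDistance y z n
distance y z = differences y z , geodesic y z , λ _ → differences-minimal

-- Path-length distance in the cube.
∂ : ∀ {D} → X D → X D → ℕ
∂ y z = proj₁ (distance y z)

origin : ∀ {D} → X D
origin {D} = replicate D zero

θ : ℕ → ℕ → ℚ
θ D i = (+ D ℤ.- + (2 ℕ.* i)) ℚ./ 1

A : ∀ {D} → Mat D
A y z = if does (differences y z ℕ.≟ 1) then 1ℂ else 0ℂ

A* : ∀ {D} → Mat D
A* {D} y z = if does (Vec.≡-dec Fin._≟_ y z) then rational (θ D (∂ origin y)) else 0ℂ

-- With the convention that the reciprocal of zero is zero.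
reciprocal : ℚ → ℚ
reciprocal p with p ℚ.≟ 0ℚ
... | yes _  = 0ℚ
... | no p≢0 = (ℚ.1/ p) {{ℚ.≢-nonZero p≢0}}

factor : ∀ {D} → ℕ → ℕ → Mat D
factor {D} i j =
  rational (reciprocal (θ D i ℚ.- θ D j)) •ᴹ (A +ᴹ rational (ℚ.- θ D j) •ᴹ 1ᴹ)

-- The Lagrange product over 0 ≤ j ≤ D, j ≠ i; meaningful for i ≤ D.
E : ∀ {D} → ℕ → Mat D
E {D} i =
  List.foldr _·ᴹ_ 1ᴹ (List.map (factor i) (filter (λ j → ¬? (j ℕ.≟ i)) (upTo (suc D))))

E* : ∀ {D} → ℕ → Mat D
E* i y z = if does (Vec.≡-dec Fin._≟_ y z)
  then (if does (∂ origin y ℕ.≟ i) then 1ℂ else 0ℂ)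
  else 0ℂ

∏ : ∀ {n} → Vec ℂ n → ℂ
∏ = Vec.foldr _ _*ℂ_ 1ℂ

_^⊗ : (Fin 2 → Fin 2 → ℂ) → ∀ {D} → Mat D
(B ^⊗) y z = ∏ (zipWith B y z)

-- P⁻¹ is shown to be the two-sided inverse of P in P⁻¹P≈1 and PP⁻¹≈1.
P₁ P₁⁻¹ : Fin 2 → Fin 2 → ℂ
P₁ zero       zero       = 1ℂ
P₁ zero       (suc zero) = 1ℂ
P₁ (suc zero) zero       = -ℂ 𝐢
P₁ (suc zero) (suc zero) = 𝐢

P₁⁻¹ zero       zero       = rational ½
P₁⁻¹ zero       (suc zero) = rational ½ *ℂ 𝐢
P₁⁻¹ (suc zero) zero       = rational ½
P₁⁻¹ (suc zero) (suc zero) = rational ½ *ℂ -ℂ 𝐢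

P P⁻¹ : ∀ {D} → Mat D
P   = P₁ ^⊗
P⁻¹ = P₁⁻¹ ^⊗

private
  module ℂ-ring = CommutativeRing ℂ-commutativeRing
  open import Algebra.Properties.CommutativeSemigroup ℂ-ring.*-commutativeSemigroup
    using (interchange)

sumX-cong : ∀ {D} {f g : X D → ℂ} → (∀ y → f y ≈ℂ g y) → sumX f ≈ℂ sumX g
sumX-cong {zero}  p = p []
sumX-cong {suc D} p = ℂ-ring.+-cong (sumX-cong λ y → p (zero ∷ y))
                                    (sumX-cong λ y → p (suc zero ∷ y))

sumX-*ˡ : ∀ {D} c (f : X D → ℂ) → sumX (λ y → c *ℂ f y) ≈ℂ c *ℂ sumX f
sumX-*ˡ {zero}  c f = ℂ-ring.refl
sumX-*ˡ {suc D} c f = ℂ-ring.trans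
  (ℂ-ring.+-cong (sumX-*ˡ c (λ y → f (zero ∷ y))) (sumX-*ˡ c (λ y → f (suc zero ∷ y))))
  (ℂ-ring.sym (ℂ-ring.distribˡ c _ _))

private
  kronecker-inverse : (B C : Fin 2 → Fin 2 → ℂ) →
    (∀ a b → B a zero *ℂ C zero b +ℂ B a (suc zero) *ℂ C (suc zero) b
             ≈ℂ (if does (a Fin.≟ b) then 1ℂ else 0ℂ)) →
    ∀ {D} → (B ^⊗) ·ᴹ (C ^⊗) ≈ᴹ 1ᴹ {D}
  kronecker-inverse B C BC≈1 [] [] = ℂ-ring.*-identityˡ 1ℂ
  kronecker-inverse B C BC≈1 (a ∷ y) (b ∷ z) = begin
    sumX (λ w → (B a 0F *ℂ β w) *ℂ (C 0F b *ℂ γ w)) +ℂ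
    sumX (λ w → (B a 1F *ℂ β w) *ℂ (C 1F b *ℂ γ w))
      ≈⟨ ℂ-ring.+-cong (factorOut 0F) (factorOut 1F) ⟩
    (B a 0F *ℂ C 0F b) *ℂ sumX (λ w → β w *ℂ γ w) +ℂ
    (B a 1F *ℂ C 1F b) *ℂ sumX (λ w → β w *ℂ γ w)
      ≈⟨ ℂ-ring.distribʳ _ _ _ ⟨
    (B a 0F *ℂ C 0F b +ℂ B a 1F *ℂ C 1F b) *ℂ sumX (λ w → β w *ℂ γ w)
      ≈⟨ ℂ-ring.*-cong (BC≈1 a b) (kronecker-inverse B C BC≈1 y z) ⟩
    (if does (a Fin.≟ b) then 1ℂ else 0ℂ) *ℂ 1ᴹ y z
      ≈⟨ entry ⟩
    1ᴹ (a ∷ y) (b ∷ z) ∎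
    where
    open import Relation.Binary.Reasoning.Setoid ℂ-ring.setoid
    0F 1F : Fin 2
    0F = zero
    1F = suc zero
    β γ : X _ → ℂ
    β w = (B ^⊗) y w
    γ w = (C ^⊗) w z
    factorOut : ∀ k → sumX (λ w → (B a k *ℂ β w) *ℂ (C k b *ℂ γ w)) ≈ℂ
                      (B a k *ℂ C k b) *ℂ sumX (λ w → β w *ℂ γ w)
    factorOut k = ℂ-ring.trans
      (sumX-cong λ w → interchange (B a k) (β w) (C k b) (γ w))
      (sumX-*ˡ (B a k *ℂ C k b) (λ w → β w *ℂ γ w))
    entry : (if does (a Fin.≟ b) then 1ℂ else 0ℂ) *ℂ 1ᴹ y z ≈ℂ 1ᴹ (a ∷ y) (b ∷ z)
    entry with a Fin.≟ b | Vec.≡-dec Fin._≟_ y z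
    ... | yes _ | yes _ = ℂ-ring.*-identityˡ 1ℂ
    ... | yes _ | no _  = ℂ-ring.*-identityˡ 0ℂ
    ... | no _  | yes _ = ℂ-ring.zeroˡ 1ℂ
    ... | no _  | no _  = ℂ-ring.zeroˡ 0ℂ

P⁻¹P≈1 : ∀ {D} → P⁻¹ ·ᴹ P ≈ᴹ 1ᴹ {D}
P⁻¹P≈1 = kronecker-inverse P₁⁻¹ P₁ λ where
  zero       zero       → ≡⇒≈ℂ (λ _ → refl) (λ _ → refl)
  zero       (suc zero) → ≡⇒≈ℂ (λ _ → refl) (λ _ → refl)
  (suc zero) zero       → ≡⇒≈ℂ (λ _ → refl) (λ _ → refl)
  (suc zero) (suc zero) → ≡⇒≈ℂ (λ _ → refl) (λ _ → refl)

PP⁻¹≈1 : ∀ {D} → P ·ᴹ P⁻¹ ≈ᴹ 1ᴹ {D}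
PP⁻¹≈1 = kronecker-inverse P₁ P₁⁻¹ λ where
  zero       zero       → ≡⇒≈ℂ (λ _ → refl) (λ _ → refl)
  zero       (suc zero) → ≡⇒≈ℂ (λ _ → refl) (λ _ → refl)
  (suc zero) zero       → ≡⇒≈ℂ (λ _ → refl) (λ _ → refl)
  (suc zero) (suc zero) → ≡⇒≈ℂ (λ _ → refl) (λ _ → refl)

-- Idempotents of Aᵋ = P⁻¹AP = -𝐢(AA* - A*A)/2.
Eᵋ : ∀ {D} → ℕ → Mat D
Eᵋ i = P⁻¹ ·ᴹ E i ·ᴹ P

data T {D : ℕ} : Pred (Mat D) 0ℓ where
  A∈T  : T A
  A*∈T : T A*
  1∈T  : T 1ᴹ
  +∈T  : ∀ {B C} → T B → T C → T (B +ᴹ C)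
  •∈T  : ∀ c {B} → T B → T (c •ᴹ B)
  ·∈T  : ∀ {B C} → T B → T C → T (B ·ᴹ C)
  ≈∈T  : ∀ {B C} → B ≈ᴹ C → T B → T C

private
  variable
    ℓ : Level
    D : ℕ

record IsSubspace (W : Pred (V D) ℓ) : Set ℓ where
  field
    respects : ∀ {v w} → v ≈ⱽ w → W v → W w
    0-closed : W 0ⱽ
    +-closed : ∀ {v w} → W v → W w → W (v +ⱽ w)
    •-closed : ∀ c {v} → W v → W (c •ⱽ v)

record IsTModule (W : Pred (V D) ℓ) : Set ℓ where
  field
    isSubspace : IsSubspace W
    T-closed   : ∀ {B v} → T B → W v → W (B ·ⱽ v)
  open IsSubspace isSubspace public

IsZero : Pred (V D) ℓ → Set ℓ
IsZero W = ∀ v → W v → v ≈ⱽ 0ⱽ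

-- "No T-modules other than 0 and W" is stated negatively: the positive
-- dichotomy U = 0 ⊎ U = W would constructively be a stronger demand on W.
record IsIrreducible {D : ℕ} {ℓ : Level} (W : Pred (V D) ℓ) : Set (Level.suc ℓ) where
  field
    isTModule : IsTModule W
    nonzero   : ¬ IsZero W
    minimal   : (U : Pred (V D) ℓ) → IsTModule U → U ⊆ W → ¬ (¬ IsZero U × ¬ (W ⊆ U))

-- The image BW.
infix 25 _⟪_⟫
_⟪_⟫ : Mat D → Pred (V D) ℓ → Pred (V D) ℓ
(B ⟪ W ⟫) u = ∃[ w ] (W w × u ≈ⱽ B ·ⱽ w)

-- E*_i W ≠ 0.
InSupport : Pred (V D) ℓ → ℕ → Set ℓ
InSupport {D} W i = i ≤ D × ¬ IsZero (E* i ⟪ W ⟫)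

IsEndpoint : Pred (V D) ℓ → ℕ → Set ℓ
IsEndpoint W r = InSupport W r × (∀ i → InSupport W i → r ≤ i)

-- d + 1 is the number of i in {0,…,D} with E*_i W ≠ 0.
IsDiameter : Pred (V D) ℓ → ℕ → Set ℓ
IsDiameter {D} W d = Σ[ S ∈ Subset (suc D) ]
  ((∀ i → i ∈ S ⇔ InSupport W (toℕ i)) × ∣ S ∣ ≡ suc d)

δ : ℕ → ℕ → ℂ
δ i j = if does (i ℕ.≟ j) then 1ℂ else 0ℂ

-- The rational number (d choose i) 2^(-d).
binomial·2⁻ : ℕ → ℕ → ℂ
binomial·2⁻ d i = rational ((+ (d choose i) ℚ./ 2 ℕ.^ d) {{ℕ.m^n≢0 2 d}})

{-# OPTIONS --safe #-}

-- V is the D-th tensor power of ℂ², so gl₂ acts on it by B ↦ dΓ B; the image of sl₂ is spanned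
-- by A, A* and Aᵋ, and conjugation by P permutes these three cyclically. If r is the
-- endpoint of W, every vector of E*_rW, E_rW or Eᵋ_rW is extremal of weight D - 2r for the
-- corresponding Cartan element, because the (r-1)-st component of W vanishes in all three gradings.
-- Rotating by P, all six norms become norms of E*-components of a vector v extremal for
-- A or Aᵋ. With e raising and f = e† lowering the weight, each up to a phase, extremality reads
-- e vₖ₋₁ = (k - r) vₖ and f vₖ₊₁ = (D - r - k) vₖ, whence (i+1) N_{i+1} = (d - i) N_i for
-- N_i = ‖v_{r+i}‖², so N_i = (d choose i) N_0, and summation over i gives N_0 = 2⁻ᵈ ‖v‖². Finally
-- d = D - 2r because the sl₂-strings show that the support of W is {r, …, D - r}.

module Submission where

open import Algebra.Bundles using (AbelianGroup; CommutativeRing)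
import Algebra.Properties.Group as Group
import Algebra.Solver.Ring
import Algebra.Solver.Ring.AlmostCommutativeRing as ACR
open import Data.Bool using (true; false; if_then_else_)
open import Data.Fin as Fin using (Fin; zero; suc; toℕ)
import Data.Fin.Properties as Fin
open import Data.Fin.Patterns using (0F; 1F)
open import Data.Fin.Subset using (Subset; ∣_∣) renaming (_∈_ to _∈ˢ_)
open import Data.Fin.Subset.Properties using (drop-there)
open import Data.Integer as ℤ using (ℤ; +_)
import Data.Integer.Properties as ℤ
open import Data.List as List using (List; []; _∷_)
open import Data.List.Membership.Propositional using () renaming (_∈_ to _∈ˡ_)
open import Data.List.Membership.Propositional.Properties using (∈-filter⁺; ∈-upTo⁺)
open import Data.List.Relation.Unary.All as All using (All; []; _∷_)
import Data.List.Relation.Unary.All.Properties as All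
open import Data.List.Relation.Unary.Any using (here; there)
import Data.Maybe as Maybe
open import Data.Nat as ℕ using (ℕ; zero; suc; _+_; _≤_; _<_; z≤n; s≤s; NonZero)
open import Data.Nat.Combinatorics using () renaming (_C_ to _choose_)
import Data.Nat.Combinatorics as Comb
import Data.Nat.Properties as ℕ
import Data.Nat.Tactic.RingSolver as ℕ-solver
open import Data.Product using (∃-syntax; _×_; _,_; proj₁; proj₂)
open import Data.Rational as ℚ using (ℚ; 0ℚ; 1ℚ; ½)
import Data.Rational.Properties as ℚ
open import Data.Rational.Unnormalised as ℚᵘ using (mkℚᵘ; *≡*)
import Data.Rational.Unnormalised.Properties as ℚᵘ
open import Data.Vec as Vec using ([]; _∷_)
import Data.Vec.Properties as Vec
open import Function using (_∘_; _⟨_⟩_)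
open import Function.Bundles using (Equivalence)
open import Level using (0ℓ)
open import Relation.Binary.PropositionalEquality as ≡ using (_≡_; _≢_; cong; cong₂; subst; subst₂)
open import Relation.Nullary using (¬_; ¬?; Dec; yes; no; contradiction)
open import Relation.Nullary.Decidable using (does; dec⇒maybe; dec-true; dec-false)
open import Relation.Unary using (Pred; _∈_)
open import Tactic.RingSolver using (solve-∀)
open import Tactic.RingSolver.Core.AlmostCommutativeRing using (AlmostCommutativeRing; fromCommutativeRing)
open import Defs

open CommutativeRing ℂ-commutativeRing
  using (refl; sym; trans; reflexive; setoid; +-cong; +-congˡ; +-congʳ; *-cong; *-congˡ; *-congʳ; -‿cong; zeroˡ; zeroʳ;
         *-identityˡ; *-assoc; *-comm; +-identityˡ; +-identityʳ; distribˡ; distribʳ)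
open import Relation.Binary.Reasoning.Setoid setoid

-- Why P permutes the three kinds of extremal vector: each kind belongs to a line in ℂ², spanned by
-- (1,0) for A*, by (1,1) for A and by (1,-𝐢) for Aᵋ, and P₁ permutes these lines. The idempotents
-- of trace one whose kernel is a given line form an affine line of 2 by 2 matrices. Extremality
-- says that dΓ of two of them, hence of all of them, acts on v as r. Rotation therefore reduces to
-- identities between 2 by 2 matrices and affine combinations of eigenvalue equations. The endpoint
-- is defined through E* alone, so the vanishing of lower components in the other two gradings has
-- to be derived. By induction on k < r, a k-th component of W in such a grading is extremal, and it
-- is zero as soon as its E*-component of weight k is zero. Membership in the support is a negation,
-- so minimality of r gives vanishing only up to double negation. Stability of equality on Cauchy
-- reals removes it.

ℚ-ring : AlmostCommutativeRing 0ℓ 0ℓ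
ℚ-ring = fromCommutativeRing ℚ.+-*-commutativeRing (λ q → dec⇒maybe (0ℚ ℚ.≟ q))

-- Rational coefficients and the ring solver over ℂ

rational-* : ∀ p q → rational (p ℚ.* q) ≈ℂ rational p *ℂ rational q
rational-* p q = ≡⇒≈ℂ (λ _ → re-* p q) (λ _ → im-* p q)
  where
  re-* : ∀ a b → a ℚ.* b ≡ a ℚ.* b ℚ.+ ℚ.- (0ℚ ℚ.* 0ℚ)
  re-* = solve-∀ ℚ-ring
  im-* : ∀ a b → 0ℚ ≡ a ℚ.* 0ℚ ℚ.+ 0ℚ ℚ.* b
  im-* = solve-∀ ℚ-ring

-- Equality on ℂ is undecidable, so the solver normalises with coefficients in ℚ. A numeral
-- `con (int (+ n))` then denotes `ι n` definitionally.
rational-morphism : CommutativeRing.rawRing ℚ.+-*-commutativeRing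
                    ACR.-Raw-AlmostCommutative⟶ ACR.fromCommutativeRing ℂ-commutativeRing
rational-morphism = record
  { ⟦_⟧    = rational
  ; +-homo = λ _ _ → ≡⇒≈ℂ (λ _ → ≡.refl) (λ _ → ≡.refl)
  ; *-homo = rational-*
  ; -‿homo = λ _ → ≡⇒≈ℂ (λ _ → ≡.refl) (λ _ → ≡.refl)
  ; 0-homo = refl
  ; 1-homo = refl
  }

open Algebra.Solver.Ring
  (CommutativeRing.rawRing ℚ.+-*-commutativeRing) (ACR.fromCommutativeRing ℂ-commutativeRing)
  rational-morphism
  (λ p q → Maybe.map (λ p≡q → reflexive (cong rational p≡q)) (dec⇒maybe (p ℚ.≟ q)))
  using (solve; _:=_; _:+_; _:*_; :-_; con)

-- A Cauchy sequence is null as soon as it is not apart from zero: given ε, one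
-- late term decides, by the trichotomy of ℚ, on which side of ½ε the tail lies.
null-stable : (s : ℕ → ℚ) → IsCauchy s → ∀ ε → 0ℚ ℚ.< ε →
  ¬ ¬ (∃[ N ] (∀ n → N ≤ n → ℚ.∣ s n ∣ ℚ.< ½ ℚ.* (½ ℚ.* ε))) →
  ∃[ N ] (∀ n → N ≤ n → ℚ.∣ s n ∣ ℚ.< ε)
null-stable s s-cauchy ε ε>0 ¬¬small = decide (s-cauchy η η>0)
  where
  η : ℚ
  η = ½ ℚ.* (½ ℚ.* ε)
  ½ε>0 : 0ℚ ℚ.< ½ ℚ.* ε
  ½ε>0 = ℚ.*-monoʳ-<-pos ½ ε>0
  η>0 : 0ℚ ℚ.< η
  η>0 = ℚ.*-monoʳ-<-pos ½ ½ε>0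
  recombine : ∀ a b → b ℚ.+ (a ℚ.- b) ≡ a
  recombine = solve-∀ ℚ-ring
  halves : ∀ a → ½ ℚ.* a ℚ.+ ½ ℚ.* a ≡ a
  halves a = ≡.trans (≡.sym (ℚ.*-distribʳ-+ a ½ ½)) (ℚ.*-identityˡ a)
  η≤½ε : η ℚ.≤ ½ ℚ.* ε
  η≤½ε = subst₂ ℚ._≤_ (ℚ.+-identityʳ η) (halves (½ ℚ.* ε)) (ℚ.+-monoʳ-≤ η (ℚ.<⇒≤ η>0))
  add : ∀ m n {p q} → ℚ.∣ s m ∣ ℚ.< p → ℚ.∣ s n ℚ.- s m ∣ ℚ.< q → ℚ.∣ s n ∣ ℚ.< p ℚ.+ q
  add m n p q = subst (λ t → ℚ.∣ t ∣ ℚ.< _) (recombine (s n) (s m))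
    (ℚ.≤-<-trans (ℚ.∣p+q∣≤∣p∣+∣q∣ (s m) (s n ℚ.- s m)) (ℚ.+-mono-< p q))
  decide : ∃[ N ] (∀ m n → N ≤ m → N ≤ n → ℚ.∣ s m ℚ.- s n ∣ ℚ.< η) →
           ∃[ N ] (∀ n → N ≤ n → ℚ.∣ s n ∣ ℚ.< ε)
  decide (N , near) with ℚ.∣ s N ∣ ℚ.<? ½ ℚ.* ε
  ... | yes small = N , λ n N≤n → subst (ℚ.∣ s n ∣ ℚ.<_) (halves ε)
    (add N n small (ℚ.<-≤-trans (near n N N≤n ℕ.≤-refl) η≤½ε))
  ... | no large = contradiction
    -- A tail bounded by η and an oscillation below η bound the term at N by 2η = ½ε; this is why
    -- the hypothesis asks for a quarter of ε.
    (λ (M , p) → large (subst (ℚ.∣ s N ∣ ℚ.<_) (halves (½ ℚ.* ε))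
      (add (N ℕ.⊔ M) N (p (N ℕ.⊔ M) (ℕ.m≤n⊔m N M))
        (near N (N ℕ.⊔ M) ℕ.≤-refl (ℕ.m≤m⊔n N M)))))
    ¬¬small

≈ℝ-stable : ∀ {x y} → ¬ ¬ (x ≈ℝ y) → x ≈ℝ y
≈ℝ-stable {x} {y} ¬x≉y = mk≈ℝ λ ε ε>0 →
  null-stable (term (x +ℝ -ℝ y)) (cauchy (x +ℝ -ℝ y)) ε ε>0
    λ ¬small → ¬x≉y λ x≈y → ¬small
      (close x≈y (½ ℚ.* (½ ℚ.* ε)) (ℚ.*-monoʳ-<-pos ½ (ℚ.*-monoʳ-<-pos ½ ε>0)))

-- Minimality of the endpoint only refutes that a lower component of W is nonzero; with stability
-- this refutation becomes vanishing.
≈ⱽ-stable : ∀ {D} {v w : V D} → ¬ ¬ (v ≈ⱽ w) → v ≈ⱽ w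
≈ⱽ-stable ¬v≉w y = mk≈ℂ
  (≈ℝ-stable λ ≉ → ¬v≉w λ v≈w → ≉ (re≈ (v≈w y)))
  (≈ℝ-stable λ ≉ → ¬v≉w λ v≈w → ≉ (im≈ (v≈w y)))

-- Integers as complex scalars, and cancellation

int : ℤ → ℚ
int z = z ℚ./ 1

-- Normalisation by a gcd blocks reduction for variable integers, hence the detour through
-- unnormalised fractions.
int-+ : ∀ a b → int (a ℤ.+ b) ≡ int a ℚ.+ int b
int-+ a b = ℚ.toℚᵘ-injective (ℚᵘ.≃-trans (ℚ.toℚᵘ-fromℚᵘ (mkℚᵘ (a ℤ.+ b) 0))
  (ℚᵘ.≃-trans (*≡* (cong (ℤ._* + 1) (≡.sym (cong₂ ℤ._+_ (ℤ.*-identityʳ a) (ℤ.*-identityʳ b)))))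
  (ℚᵘ.≃-trans (ℚᵘ.+-cong (ℚᵘ.≃-sym (ℚ.toℚᵘ-fromℚᵘ (mkℚᵘ a 0))) (ℚᵘ.≃-sym (ℚ.toℚᵘ-fromℚᵘ (mkℚᵘ b 0))))
    (ℚᵘ.≃-sym (ℚ.toℚᵘ-homo-+ (int a) (int b))))))

int-* : ∀ a b → int (a ℤ.* b) ≡ int a ℚ.* int b
int-* a b = ℚ.toℚᵘ-injective (ℚᵘ.≃-trans (ℚ.toℚᵘ-fromℚᵘ (mkℚᵘ (a ℤ.* b) 0))
  (ℚᵘ.≃-trans (ℚᵘ.*-cong (ℚᵘ.≃-sym (ℚ.toℚᵘ-fromℚᵘ (mkℚᵘ a 0))) (ℚᵘ.≃-sym (ℚ.toℚᵘ-fromℚᵘ (mkℚᵘ b 0))))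
    (ℚᵘ.≃-sym (ℚ.toℚᵘ-homo-* (int a) (int b)))))

ι : ℕ → ℂ
ι n = rational (int (+ n))

ι-+ : ∀ m n → ι (m + n) ≈ℂ ι m +ℂ ι n
ι-+ m n = ≡⇒≈ℂ (λ _ → int-+ (+ m) (+ n)) (λ _ → ≡.refl)

ι-suc : ∀ n → ι (suc n) ≈ℂ 1ℂ +ℂ ι n
ι-suc = ι-+ 1

ι-* : ∀ m n → ι (m ℕ.* n) ≈ℂ ι m *ℂ ι n
ι-* m n = trans (reflexive (cong rational (≡.trans (cong int (ℤ.pos-* m n)) (int-* (+ m) (+ n)))))
                (rational-* (int (+ m)) (int (+ n)))

θ-ι : ∀ D k → rational (θ D k) ≈ℂ ι D +ℂ -ℂ (ι 2 *ℂ ι k)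
θ-ι D k = begin
  rational (int (+ D ℤ.- + (2 ℕ.* k)))            ≡⟨ cong rational (int-+ (+ D) (ℤ.- + (2 ℕ.* k))) ⟩
  rational (int (+ D) ℚ.+ int (ℤ.- + (2 ℕ.* k)))  ≡⟨ cong (λ q → rational (int (+ D) ℚ.+ q)) (neg (+ (2 ℕ.* k))) ⟩
  rational (int (+ D) ℚ.+ ℚ.- int (+ (2 ℕ.* k)))  ≈⟨ ≡⇒≈ℂ (λ _ → ≡.refl) (λ _ → ≡.refl) ⟩
  ι D +ℂ -ℂ ι (2 ℕ.* k)                           ≈⟨ +-congˡ (-‿cong (ι-* 2 k)) ⟩
  ι D +ℂ -ℂ (ι 2 *ℂ ι k)                          ∎
  where
  neg : ∀ a → int (ℤ.- a) ≡ ℚ.- int a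
  neg (+ 0)       = ≡.refl
  neg (+ (suc n)) = ≡.refl
  neg ℤ.-[1+ n ]  = neg-neg (int (+ suc n))
    where
    neg-neg : ∀ a → a ≡ ℚ.- (ℚ.- a)
    neg-neg = solve-∀ ℚ-ring

-- Only nonzero rationals are ever divided out, so no inverse on ℂ has to be constructed.
rational-cancel : ∀ q {z w} → q ≢ 0ℚ → rational q *ℂ z ≈ℂ rational q *ℂ w → z ≈ℂ w
rational-cancel q {z} {w} q≢0 qz≈qw = begin
  z                                  ≈⟨ unscale z ⟨
  rational 1/q *ℂ (rational q *ℂ z)  ≈⟨ *-congˡ qz≈qw ⟩
  rational 1/q *ℂ (rational q *ℂ w)  ≈⟨ unscale w ⟩
  w                                  ∎
  where
  1/q : ℚ
  1/q = (ℚ.1/ q) {{ℚ.≢-nonZero q≢0}}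
  unscale : ∀ u → rational 1/q *ℂ (rational q *ℂ u) ≈ℂ u
  unscale u = begin
    rational 1/q *ℂ (rational q *ℂ u)
      ≈⟨ solve 3 (λ a b c → a :* (b :* c) := (a :* b) :* c) refl _ _ _ ⟩
    rational 1/q *ℂ rational q *ℂ u
      ≈⟨ *-congʳ (rational-* 1/q q) ⟨
    rational (1/q ℚ.* q) *ℂ u
      ≡⟨ cong (λ p → rational p *ℂ u) (ℚ.*-inverseˡ q {{ℚ.≢-nonZero q≢0}}) ⟩
    1ℂ *ℂ u
      ≈⟨ *-identityˡ u ⟩
    u ∎

int≢0 : ∀ n → int (+ suc n) ≢ 0ℚ
int≢0 n p = ℚ.<-irrefl (≡.sym p) (ℚ.positive⁻¹ (int (+ suc n)) {{ℚ.normalize-pos (suc n) 1}})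

ι-cancel : ∀ n {z w} → ι (suc n) *ℂ z ≈ℂ ι (suc n) *ℂ w → z ≈ℂ w
ι-cancel n = rational-cancel (int (+ suc n)) (int≢0 n)

ι-cancel₀ : ∀ n {z} → ι (suc n) *ℂ z ≈ℂ 0ℂ → z ≈ℂ 0ℂ
ι-cancel₀ n p = ι-cancel n (trans p (sym (zeroʳ _)))

-- Operators dΓ B on the tensor power

𝕄₂ : Set
𝕄₂ = Fin 2 → Fin 2 → ℂ

infix 4 _≈²_
_≈²_ : 𝕄₂ → 𝕄₂ → Set
B ≈² C = ∀ a b → B a b ≈ℂ C a b

infixl 7 _·²_
_·²_ : 𝕄₂ → 𝕄₂ → 𝕄₂
(B ·² C) a b = B a 0F *ℂ C 0F b +ℂ B a 1F *ℂ C 1F b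

≈²-entries : ∀ {B C : 𝕄₂} → B 0F 0F ≈ℂ C 0F 0F → B 0F 1F ≈ℂ C 0F 1F →
             B 1F 0F ≈ℂ C 1F 0F → B 1F 1F ≈ℂ C 1F 1F → B ≈² C
≈²-entries p q r s 0F 0F = p
≈²-entries p q r s 0F 1F = q
≈²-entries p q r s 1F 0F = r
≈²-entries p q r s 1F 1F = s

mat₂ : ℂ → ℂ → ℂ → ℂ → 𝕄₂
mat₂ a b c d 0F 0F = a
mat₂ a b c d 0F 1F = b
mat₂ a b c d 1F 0F = c
mat₂ a b c d 1F 1F = d

sumX-+ : ∀ {D} (f g : X D → ℂ) → sumX (λ y → f y +ℂ g y) ≈ℂ sumX f +ℂ sumX g
sumX-+ {zero}  f g = refl
sumX-+ {suc D} f g = trans (+-cong (sumX-+ (f ∘ (0F ∷_)) (g ∘ (0F ∷_))) (sumX-+ (f ∘ (1F ∷_)) (g ∘ (1F ∷_))))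
  (solve 4 (λ a b c d → (a :+ b) :+ (c :+ d) := (a :+ c) :+ (b :+ d)) refl _ _ _ _)

sumX-0 : ∀ {D} (f : X D → ℂ) → (∀ y → f y ≈ℂ 0ℂ) → sumX f ≈ℂ 0ℂ
sumX-0 {zero}  f f≈0 = f≈0 []
sumX-0 {suc D} f f≈0 = trans (+-cong (sumX-0 (f ∘ (0F ∷_)) (f≈0 ∘ (0F ∷_))) (sumX-0 (f ∘ (1F ∷_)) (f≈0 ∘ (1F ∷_)))) (+-identityˡ 0ℂ)

·ⱽ-cong : ∀ {D} (B : Mat D) {v w} → v ≈ⱽ w → B ·ⱽ v ≈ⱽ B ·ⱽ w
·ⱽ-cong B p y = sumX-cong λ z → *-congˡ (p z)

·ⱽ-congᴮ : ∀ {D} {B C : Mat D} v → B ≈ᴹ C → B ·ⱽ v ≈ⱽ C ·ⱽ v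
·ⱽ-congᴮ v p y = sumX-cong λ z → *-congʳ (p y z)

·ⱽ-+ : ∀ {D} (B : Mat D) v w → B ·ⱽ (v +ⱽ w) ≈ⱽ B ·ⱽ v +ⱽ B ·ⱽ w
·ⱽ-+ {D} B v w y = trans (sumX-cong λ z → distribˡ (B y z) (v z) (w z)) (sumX-+ {D} _ _)

·ⱽ-• : ∀ {D} (B : Mat D) c v → B ·ⱽ (c •ⱽ v) ≈ⱽ c •ⱽ B ·ⱽ v
·ⱽ-• {D} B c v y = trans
  (sumX-cong λ z → solve 3 (λ a b c → a :* (b :* c) := b :* (a :* c)) refl (B y z) c (v z))
  (sumX-*ˡ {D} c _)

·ⱽ-0 : ∀ {D} (B : Mat D) {v} → v ≈ⱽ 0ⱽ → B ·ⱽ v ≈ⱽ 0ⱽ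
·ⱽ-0 {D} B v≈0 y = sumX-0 {D} _ λ z → trans (*-congˡ (v≈0 z)) (zeroʳ _)

sumX-swap : ∀ {D D′} (f : X D → X D′ → ℂ) →
  sumX (λ y → sumX (λ z → f y z)) ≈ℂ sumX (λ z → sumX (λ y → f y z))
sumX-swap {zero}  f = refl
sumX-swap {suc D} {D′} f = trans (+-cong (sumX-swap (f ∘ (0F ∷_))) (sumX-swap (f ∘ (1F ∷_)))) (sym (sumX-+ {D′} _ _))

·ᴹ-·ⱽ : ∀ {D} (B C : Mat D) v → (B ·ᴹ C) ·ⱽ v ≈ⱽ B ·ⱽ (C ·ⱽ v)
·ᴹ-·ⱽ {D} B C v y = begin
  sumX (λ z → sumX (λ w → B y w *ℂ C w z) *ℂ v z)
    ≈⟨ sumX-cong (λ z → trans (*-comm _ _) (sym (sumX-*ˡ {D} (v z) _))) ⟩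
  sumX (λ z → sumX (λ w → v z *ℂ (B y w *ℂ C w z)))
    ≈⟨ sumX-swap {D} {D} _ ⟩
  sumX (λ w → sumX (λ z → v z *ℂ (B y w *ℂ C w z)))
    ≈⟨ sumX-cong (λ w → trans
         (sumX-cong λ z → solve 3 (λ a b c → a :* (b :* c) := b :* (c :* a)) refl (v z) (B y w) (C w z))
         (sumX-*ˡ {D} (B y w) _)) ⟩
  sumX (λ w → B y w *ℂ sumX (λ z → C w z *ℂ v z)) ∎

-- With the row y fixed, the diagonal entry is a mere constant c; this one form serves `1ᴹ`, `A*`
-- and `E*`.
diagonal-·ⱽ : ∀ {D} (c : ℂ) (y : X D) (v : V D) →
  sumX (λ z → (if does (Vec.≡-dec Fin._≟_ y z) then c else 0ℂ) *ℂ v z) ≈ℂ c *ℂ v y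
diagonal-·ⱽ c []       v = refl
diagonal-·ⱽ {suc D} c (0F ∷ y) v = trans
  (+-cong (diagonal-·ⱽ c y (v ∘ (0F ∷_))) (sumX-0 {D} _ λ z → zeroˡ (v _))) (+-identityʳ _)
diagonal-·ⱽ {suc D} c (1F ∷ y) v = trans
  (+-cong (sumX-0 {D} _ λ z → zeroˡ (v _)) (diagonal-·ⱽ c y (v ∘ (1F ∷_)))) (+-identityˡ _)

1ᴹ-·ⱽ : ∀ {D} (v : V D) → 1ᴹ ·ⱽ v ≈ⱽ v
1ᴹ-·ⱽ v y = trans (diagonal-·ⱽ 1ℂ y v) (*-identityˡ (v y))

-- dΓ B = Σₖ 1 ⊗ ⋯ ⊗ B ⊗ ⋯ ⊗ 1, with B in the k-th tensor factor.
dΓ : 𝕄₂ → ∀ {D} → V D → V D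
dΓ B {zero}  v y       = 0ℂ
dΓ B {suc D} v (a ∷ y) =
  dΓ B (λ z → v (a ∷ z)) y +ℂ (B a 0F *ℂ v (0F ∷ y) +ℂ B a 1F *ℂ v (1F ∷ y))

dΓ-cong : ∀ B {D} {v w : V D} → v ≈ⱽ w → dΓ B v ≈ⱽ dΓ B w
dΓ-cong B {zero}  p y       = refl
dΓ-cong B {suc D} p (a ∷ y) = +-cong (dΓ-cong B (p ∘ (a ∷_)) y)
  (+-cong (*-congˡ (p (0F ∷ y))) (*-congˡ (p (1F ∷ y))))

dΓ-congᴮ : ∀ {B C} → B ≈² C → ∀ {D} (v : V D) → dΓ B v ≈ⱽ dΓ C v
dΓ-congᴮ p {zero}  v y       = refl
dΓ-congᴮ p {suc D} v (a ∷ y) = +-cong (dΓ-congᴮ p (v ∘ (a ∷_)) y)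
  (+-cong (*-congʳ (p a 0F)) (*-congʳ (p a 1F)))

dΓ-+ : ∀ B {D} (v w : V D) → dΓ B (v +ⱽ w) ≈ⱽ dΓ B v +ⱽ dΓ B w
dΓ-+ B {zero}  v w y       = sym (+-identityˡ 0ℂ)
dΓ-+ B {suc D} v w (a ∷ y) = trans (+-congʳ (dΓ-+ B (v ∘ (a ∷_)) (w ∘ (a ∷_)) y))
  (solve 8 (λ s t p q a b c d → (s :+ t) :+ (p :* (a :+ b) :+ q :* (c :+ d))
                             := (s :+ (p :* a :+ q :* c)) :+ (t :+ (p :* b :+ q :* d))) refl
   _ _ (B a 0F) (B a 1F) _ _ _ _)

dΓ-• : ∀ B {D} c (v : V D) → dΓ B (c •ⱽ v) ≈ⱽ c •ⱽ dΓ B v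
dΓ-• B {zero}  c v y       = sym (zeroʳ c)
dΓ-• B {suc D} c v (a ∷ y) = trans (+-congʳ (dΓ-• B c (v ∘ (a ∷_)) y))
  (solve 6 (λ c s p q a b → c :* s :+ (p :* (c :* a) :+ q :* (c :* b))
                         := c :* (s :+ (p :* a :+ q :* b))) refl c _ (B a 0F) (B a 1F) _ _)

dΓ-0 : ∀ B {D} {v : V D} → v ≈ⱽ 0ⱽ → dΓ B v ≈ⱽ 0ⱽ
dΓ-0 B {zero}  p y       = refl
dΓ-0 B {suc D} p (a ∷ y) = trans
  (+-cong (dΓ-0 B (p ∘ (a ∷_)) y) (+-cong (*-congˡ (p (0F ∷ y))) (*-congˡ (p (1F ∷ y)))))
  (solve 2 (λ p q → con 0ℚ :+ (p :* con 0ℚ :+ q :* con 0ℚ) := con 0ℚ) refl (B a 0F) (B a 1F))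

dΓ-combine : ∀ β B γ C {D} (v : V D) →
  dΓ (λ a b → β *ℂ B a b +ℂ γ *ℂ C a b) v ≈ⱽ β •ⱽ dΓ B v +ⱽ γ •ⱽ dΓ C v
dΓ-combine β B γ C {zero}  v y       =
  solve 2 (λ β γ → con 0ℚ := β :* con 0ℚ :+ γ :* con 0ℚ) refl β γ
dΓ-combine β B γ C {suc D} v (a ∷ y) = trans (+-congʳ (dΓ-combine β B γ C (v ∘ (a ∷_)) y))
  (solve 10 (λ β γ s t p q p′ q′ a b →
       (β :* s :+ γ :* t) :+ ((β :* p :+ γ :* p′) :* a :+ (β :* q :+ γ :* q′) :* b)
    := β :* (s :+ (p :* a :+ q :* b)) :+ γ :* (t :+ (p′ :* a :+ q′ :* b))) refl
   β γ _ _ (B a 0F) (B a 1F) (C a 0F) (C a 1F) _ _)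

dΓ-identity : ∀ {D} (v : V D) → dΓ (mat₂ 1ℂ 0ℂ 0ℂ 1ℂ) v ≈ⱽ ι D •ⱽ v
dΓ-identity {zero}  v y        = sym (zeroˡ _)
dΓ-identity {suc D} v (0F ∷ y) = begin
  dΓ (mat₂ 1ℂ 0ℂ 0ℂ 1ℂ) (v ∘ (0F ∷_)) y +ℂ (1ℂ *ℂ v (0F ∷ y) +ℂ 0ℂ *ℂ v (1F ∷ y))
    ≈⟨ +-congʳ (dΓ-identity (v ∘ (0F ∷_)) y) ⟩
  ι D *ℂ v (0F ∷ y) +ℂ (1ℂ *ℂ v (0F ∷ y) +ℂ 0ℂ *ℂ v (1F ∷ y))
    ≈⟨ solve 3 (λ n a b → n :* a :+ (con 1ℚ :* a :+ con 0ℚ :* b) := (con 1ℚ :+ n) :* a) refl (ι D) _ _ ⟩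
  (1ℂ +ℂ ι D) *ℂ v (0F ∷ y)
    ≈⟨ *-congʳ (ι-suc D) ⟨
  ι (suc D) *ℂ v (0F ∷ y) ∎
dΓ-identity {suc D} v (1F ∷ y) = begin
  dΓ (mat₂ 1ℂ 0ℂ 0ℂ 1ℂ) (v ∘ (1F ∷_)) y +ℂ (0ℂ *ℂ v (0F ∷ y) +ℂ 1ℂ *ℂ v (1F ∷ y))
    ≈⟨ +-congʳ (dΓ-identity (v ∘ (1F ∷_)) y) ⟩
  ι D *ℂ v (1F ∷ y) +ℂ (0ℂ *ℂ v (0F ∷ y) +ℂ 1ℂ *ℂ v (1F ∷ y))
    ≈⟨ solve 3 (λ n a b → n :* a :+ (con 0ℚ :* b :+ con 1ℚ :* a) := (con 1ℚ :+ n) :* a) refl (ι D) _ _ ⟩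
  (1ℂ +ℂ ι D) *ℂ v (1F ∷ y)
    ≈⟨ *-congʳ (ι-suc D) ⟨
  ι (suc D) *ℂ v (1F ∷ y) ∎

-- B ↦ dΓ B is a representation of the Lie algebra gl₂.
dΓ-commutator : ∀ {B C F} → (∀ a b → (B ·² C) a b ≈ℂ (C ·² B) a b +ℂ F a b) →
  ∀ {D} (v : V D) → dΓ B (dΓ C v) ≈ⱽ dΓ C (dΓ B v) +ⱽ dΓ F v
dΓ-commutator p {zero} v y = sym (+-identityˡ 0ℂ)
dΓ-commutator {B} {C} {F} p {suc D} v (a ∷ y) = begin
  dΓ B (λ z → dΓ C v (a ∷ z)) y +ℂ
  (B a 0F *ℂ dΓ C v (0F ∷ y) +ℂ B a 1F *ℂ dΓ C v (1F ∷ y))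
    ≈⟨ +-congʳ (tail B C) ⟩
  (dΓ B (dΓ C vₐ) y +ℂ (C a 0F *ℂ dΓ B v₀ y +ℂ C a 1F *ℂ dΓ B v₁ y)) +ℂ
  (B a 0F *ℂ (dΓ C v₀ y +ℂ (C 0F 0F *ℂ v₀ y +ℂ C 0F 1F *ℂ v₁ y)) +ℂ
   B a 1F *ℂ (dΓ C v₁ y +ℂ (C 1F 0F *ℂ v₀ y +ℂ C 1F 1F *ℂ v₁ y)))
    ≈⟨ +-congʳ (+-congʳ (dΓ-commutator p vₐ y)) ⟩
  ((dΓ C (dΓ B vₐ) y +ℂ dΓ F vₐ y) +ℂ (C a 0F *ℂ dΓ B v₀ y +ℂ C a 1F *ℂ dΓ B v₁ y)) +ℂ
  (B a 0F *ℂ (dΓ C v₀ y +ℂ (C 0F 0F *ℂ v₀ y +ℂ C 0F 1F *ℂ v₁ y)) +ℂ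
   B a 1F *ℂ (dΓ C v₁ y +ℂ (C 1F 0F *ℂ v₀ y +ℂ C 1F 1F *ℂ v₁ y)))
    -- Terms with one operator on the head factor and the other on the tail occur on both sides.
    -- What remains is the product on the head, collected into entries of `B ·² C` so that the
    -- hypothesis applies.
    ≈⟨ solve 16 (λ cb f c0 c1 b0 b1 Bv0 Bv1 Cv0 Cv1 c00 c01 c10 c11 x y →
         ((cb :+ f) :+ (c0 :* Bv0 :+ c1 :* Bv1)) :+
           (b0 :* (Cv0 :+ (c00 :* x :+ c01 :* y)) :+ b1 :* (Cv1 :+ (c10 :* x :+ c11 :* y)))
      := ((cb :+ f) :+ (c0 :* Bv0 :+ c1 :* Bv1) :+ (b0 :* Cv0 :+ b1 :* Cv1)) :+
         ((b0 :* c00 :+ b1 :* c10) :* x :+ (b0 :* c01 :+ b1 :* c11) :* y)) refl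
         _ _ (C a 0F) (C a 1F) (B a 0F) (B a 1F) _ _ _ _ (C 0F 0F) (C 0F 1F) (C 1F 0F) (C 1F 1F) (v₀ y) (v₁ y) ⟩
  rest +ℂ ((B ·² C) a 0F *ℂ v₀ y +ℂ (B ·² C) a 1F *ℂ v₁ y)
    ≈⟨ +-congˡ (+-cong (*-congʳ (p a 0F)) (*-congʳ (p a 1F))) ⟩
  rest +ℂ (((C ·² B) a 0F +ℂ F a 0F) *ℂ v₀ y +ℂ ((C ·² B) a 1F +ℂ F a 1F) *ℂ v₁ y)
    ≈⟨ solve 18 (λ cb f c0 c1 b0 b1 Bv0 Bv1 Cv0 Cv1 b00 b01 b10 b11 x y f0 f1 →
         ((cb :+ f) :+ (c0 :* Bv0 :+ c1 :* Bv1) :+ (b0 :* Cv0 :+ b1 :* Cv1)) :+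
         (((c0 :* b00 :+ c1 :* b10) :+ f0) :* x :+ ((c0 :* b01 :+ c1 :* b11) :+ f1) :* y)
      := ((cb :+ (b0 :* Cv0 :+ b1 :* Cv1)) :+
           (c0 :* (Bv0 :+ (b00 :* x :+ b01 :* y)) :+ c1 :* (Bv1 :+ (b10 :* x :+ b11 :* y)))) :+
         (f :+ (f0 :* x :+ f1 :* y))) refl
         _ _ (C a 0F) (C a 1F) (B a 0F) (B a 1F) _ _ _ _ (B 0F 0F) (B 0F 1F) (B 1F 0F) (B 1F 1F) (v₀ y) (v₁ y)
         (F a 0F) (F a 1F) ⟩
  ((dΓ C (dΓ B vₐ) y +ℂ (B a 0F *ℂ dΓ C v₀ y +ℂ B a 1F *ℂ dΓ C v₁ y)) +ℂ
    (C a 0F *ℂ dΓ B v (0F ∷ y) +ℂ C a 1F *ℂ dΓ B v (1F ∷ y))) +ℂ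
  (dΓ F vₐ y +ℂ (F a 0F *ℂ v₀ y +ℂ F a 1F *ℂ v₁ y))
    ≈⟨ +-congʳ (+-congʳ (tail C B)) ⟨
  dΓ C (dΓ B v) (a ∷ y) +ℂ dΓ F v (a ∷ y) ∎
  where
  v₀ v₁ vₐ : V D
  v₀ = v ∘ (0F ∷_)
  v₁ = v ∘ (1F ∷_)
  vₐ = v ∘ (a ∷_)
  rest : ℂ
  rest = (dΓ C (dΓ B vₐ) y +ℂ dΓ F vₐ y) +ℂ (C a 0F *ℂ dΓ B v₀ y +ℂ C a 1F *ℂ dΓ B v₁ y)
         +ℂ (B a 0F *ℂ dΓ C v₀ y +ℂ B a 1F *ℂ dΓ C v₁ y)
  tail : ∀ B C → dΓ B (λ z → dΓ C v (a ∷ z)) y ≈ℂ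
                 dΓ B (dΓ C vₐ) y +ℂ (C a 0F *ℂ dΓ B v₀ y +ℂ C a 1F *ℂ dΓ B v₁ y)
  tail B C = trans (dΓ-+ B (dΓ C vₐ) _ y) (+-congˡ
    (trans (dΓ-+ B _ _ y) (+-cong (dΓ-• B (C a 0F) v₀ y) (dΓ-• B (C a 1F) v₁ y))))

⊗-∷ : ∀ M {D} (v : V (suc D)) a y →
  ((M ^⊗) ·ⱽ v) (a ∷ y) ≈ℂ M a 0F *ℂ ((M ^⊗) ·ⱽ (v ∘ (0F ∷_))) y +ℂ M a 1F *ℂ ((M ^⊗) ·ⱽ (v ∘ (1F ∷_))) y
⊗-∷ M {D} v a y = +-cong (part 0F) (part 1F)
  where
  part : ∀ b → sumX (λ z → (M a b *ℂ (M ^⊗) y z) *ℂ v (b ∷ z)) ≈ℂ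
               M a b *ℂ ((M ^⊗) ·ⱽ (v ∘ (b ∷_))) y
  part b = trans
    (sumX-cong λ z → *-assoc (M a b) ((M ^⊗) y z) (v (b ∷ z)))
    (sumX-*ˡ {D} (M a b) _)

-- M acts on every tensor factor, so moving B past it in the k-th factor disturbs no other factor.
-- Every conjugation by P thereby becomes a 2 by 2 identity, checked by computation.
dΓ-⊗ : ∀ M {B B′} → B ·² M ≈² M ·² B′ →
  ∀ {D} (v : V D) → dΓ B ((M ^⊗) ·ⱽ v) ≈ⱽ (M ^⊗) ·ⱽ dΓ B′ v
dΓ-⊗ M p {zero} v [] = sym (zeroʳ _)
dΓ-⊗ M {B} {B′} p {suc D} v (a ∷ y) = begin
  dΓ B (λ z → ((M ^⊗) ·ⱽ v) (a ∷ z)) y +ℂ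
  (B a 0F *ℂ ((M ^⊗) ·ⱽ v) (0F ∷ y) +ℂ B a 1F *ℂ ((M ^⊗) ·ⱽ v) (1F ∷ y))
    ≈⟨ +-cong tail (+-cong (*-congˡ (⊗-∷ M v 0F y)) (*-congˡ (⊗-∷ M v 1F y))) ⟩
  (M a 0F *ℂ dv 0F +ℂ M a 1F *ℂ dv 1F) +ℂ
  (B a 0F *ℂ (M 0F 0F *ℂ mv 0F +ℂ M 0F 1F *ℂ mv 1F) +ℂ
   B a 1F *ℂ (M 1F 0F *ℂ mv 0F +ℂ M 1F 1F *ℂ mv 1F))
    ≈⟨ solve 9 (λ s b0 b1 m00 m01 m10 m11 x y →
         s :+ (b0 :* (m00 :* x :+ m01 :* y) :+ b1 :* (m10 :* x :+ m11 :* y))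
      := s :+ ((b0 :* m00 :+ b1 :* m10) :* x :+ (b0 :* m01 :+ b1 :* m11) :* y)) refl
         _ (B a 0F) (B a 1F) (M 0F 0F) (M 0F 1F) (M 1F 0F) (M 1F 1F) (mv 0F) (mv 1F) ⟩
  (M a 0F *ℂ dv 0F +ℂ M a 1F *ℂ dv 1F) +ℂ ((B ·² M) a 0F *ℂ mv 0F +ℂ (B ·² M) a 1F *ℂ mv 1F)
    ≈⟨ +-congˡ (+-cong (*-congʳ (p a 0F)) (*-congʳ (p a 1F))) ⟩
  (M a 0F *ℂ dv 0F +ℂ M a 1F *ℂ dv 1F) +ℂ ((M ·² B′) a 0F *ℂ mv 0F +ℂ (M ·² B′) a 1F *ℂ mv 1F)
    ≈⟨ solve 10 (λ m0 m1 d0 d1 b00 b01 b10 b11 x y →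
         (m0 :* d0 :+ m1 :* d1) :+ ((m0 :* b00 :+ m1 :* b10) :* x :+ (m0 :* b01 :+ m1 :* b11) :* y)
      := m0 :* (d0 :+ (b00 :* x :+ b01 :* y)) :+ m1 :* (d1 :+ (b10 :* x :+ b11 :* y))) refl
         (M a 0F) (M a 1F) _ _ (B′ 0F 0F) (B′ 0F 1F) (B′ 1F 0F) (B′ 1F 1F) (mv 0F) (mv 1F) ⟩
  M a 0F *ℂ (dv 0F +ℂ (B′ 0F 0F *ℂ mv 0F +ℂ B′ 0F 1F *ℂ mv 1F)) +ℂ
  M a 1F *ℂ (dv 1F +ℂ (B′ 1F 0F *ℂ mv 0F +ℂ B′ 1F 1F *ℂ mv 1F))
    ≈⟨ +-cong (*-congˡ (head 0F)) (*-congˡ (head 1F)) ⟨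
  M a 0F *ℂ ((M ^⊗) ·ⱽ (dΓ B′ v ∘ (0F ∷_))) y +ℂ M a 1F *ℂ ((M ^⊗) ·ⱽ (dΓ B′ v ∘ (1F ∷_))) y
    ≈⟨ ⊗-∷ M (dΓ B′ v) a y ⟨
  ((M ^⊗) ·ⱽ dΓ B′ v) (a ∷ y) ∎
  where
  mv dv : Fin 2 → ℂ
  mv b = ((M ^⊗) ·ⱽ (v ∘ (b ∷_))) y
  dv b = ((M ^⊗) ·ⱽ dΓ B′ (v ∘ (b ∷_))) y
  tail : dΓ B (λ z → ((M ^⊗) ·ⱽ v) (a ∷ z)) y ≈ℂ M a 0F *ℂ dv 0F +ℂ M a 1F *ℂ dv 1F
  tail = trans (dΓ-cong B (⊗-∷ M v a) y)
    (trans (dΓ-+ B _ _ y) (+-cong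
      (trans (dΓ-• B (M a 0F) _ y) (*-congˡ (dΓ-⊗ M p (v ∘ (0F ∷_)) y)))
      (trans (dΓ-• B (M a 1F) _ y) (*-congˡ (dΓ-⊗ M p (v ∘ (1F ∷_)) y)))))
  head : ∀ b → ((M ^⊗) ·ⱽ (dΓ B′ v ∘ (b ∷_))) y ≈ℂ
               dv b +ℂ (B′ b 0F *ℂ mv 0F +ℂ B′ b 1F *ℂ mv 1F)
  head b = trans (·ⱽ-+ (M ^⊗) (dΓ B′ (v ∘ (b ∷_))) _ y) (+-congˡ
    (trans (·ⱽ-+ (M ^⊗) _ _ y)
      (+-cong (·ⱽ-• (M ^⊗) (B′ b 0F) _ y) (·ⱽ-• (M ^⊗) (B′ b 1F) _ y))))

-- Weights and the inner product

-- Under dΓ, `Xₘ` and `Zₘ` give A and A*. `Yₘ` is -𝐢(XZ - ZX)/2, the negative of the usual Pauli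
-- matrix, and gives Aᵋ. `Nₘ` gives the number operator, which multiplies by the weight.
Xₘ Zₘ Yₘ Nₘ : 𝕄₂
Xₘ = mat₂ 0ℂ 1ℂ 1ℂ 0ℂ
Zₘ = mat₂ 1ℂ 0ℂ 0ℂ (-ℂ 1ℂ)
Yₘ = mat₂ 0ℂ 𝐢 (-ℂ 𝐢) 0ℂ
Nₘ = mat₂ 0ℂ 0ℂ 0ℂ 1ℂ

raise lower : ℂ → 𝕄₂
raise α = mat₂ 0ℂ 0ℂ α 0ℂ
lower β = mat₂ 0ℂ β 0ℂ 0ℂ

A-dΓ : ∀ {D} (v : V D) → A ·ⱽ v ≈ⱽ dΓ Xₘ v
A-dΓ v [] = zeroˡ (v [])
A-dΓ {suc D} v (a ∷ y) = at a
  where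
  does-≡ : ∀ {D} (y z : X D) → does (differences y z ℕ.≟ 0) ≡ does (Vec.≡-dec Fin._≟_ y z)
  does-≡ []       []       = ≡.refl
  does-≡ (0F ∷ y) (0F ∷ z) = does-≡ y z
  does-≡ (0F ∷ y) (1F ∷ z) = ≡.refl
  does-≡ (1F ∷ y) (0F ∷ z) = ≡.refl
  does-≡ (1F ∷ y) (1F ∷ z) = does-≡ y z
  -- Once the first coordinate differs, adjacency forces equal tails, so this block of A is the
  -- identity matrix.
  flipped : ∀ (w : V D) → sumX (λ z → (if does (differences y z ℕ.≟ 0) then 1ℂ else 0ℂ) *ℂ w z) ≈ℂ w y
  flipped w = trans
    (sumX-cong λ z → reflexive (cong (λ b → (if b then 1ℂ else 0ℂ) *ℂ w z) (does-≡ y z)))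
    (1ᴹ-·ⱽ w y)
  at : ∀ a → (A ·ⱽ v) (a ∷ y) ≈ℂ dΓ Xₘ v (a ∷ y)
  at 0F = trans (+-cong (A-dΓ (v ∘ (0F ∷_)) y) (flipped (v ∘ (1F ∷_))))
    (solve 3 (λ s a b → s :+ b := s :+ (con 0ℚ :* a :+ con 1ℚ :* b)) refl _ (v (0F ∷ y)) (v (1F ∷ y)))
  at 1F = trans (+-cong (flipped (v ∘ (0F ∷_))) (A-dΓ (v ∘ (1F ∷_)) y))
    (solve 3 (λ s a b → a :+ s := s :+ (con 1ℚ :* a :+ con 0ℚ :* b)) refl _ (v (0F ∷ y)) (v (1F ∷ y)))

wt : ∀ {D} → X D → ℕ
wt y = ∂ origin y

wt≤D : ∀ {D} (y : X D) → wt y ≤ D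
wt≤D []       = z≤n
wt≤D (0F ∷ y) = ℕ.m≤n⇒m≤1+n (wt≤D y)
wt≤D (1F ∷ y) = s≤s (wt≤D y)

-- Multiplication by a function of the weight: the common form of the projections `π`, the number
-- operator and A*.
mask : ∀ {D} → (ℕ → ℂ) → V D → V D
mask m v y = m (wt y) *ℂ v y

π : ∀ {D} → ℕ → V D → V D
π k = mask (λ n → δ n k)

E*-π : ∀ {D} k (v : V D) → E* k ·ⱽ v ≈ⱽ π k v
E*-π k v y = diagonal-·ⱽ (δ (wt y) k) y v

N-mask : ∀ {D} (v : V D) → dΓ Nₘ v ≈ⱽ mask ι v
N-mask v [] = sym (zeroˡ _)
N-mask v (0F ∷ y) = trans (+-congʳ (N-mask (v ∘ (0F ∷_)) y))
  (solve 3 (λ n a b → n :* a :+ (con 0ℚ :* a :+ con 0ℚ :* b) := n :* a) refl (ι (wt y)) _ (v (1F ∷ y)))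
N-mask v (1F ∷ y) = begin
  dΓ Nₘ (v ∘ (1F ∷_)) y +ℂ (0ℂ *ℂ v (0F ∷ y) +ℂ 1ℂ *ℂ v (1F ∷ y))
    ≈⟨ +-congʳ (N-mask (v ∘ (1F ∷_)) y) ⟩
  ι (wt y) *ℂ v (1F ∷ y) +ℂ (0ℂ *ℂ v (0F ∷ y) +ℂ 1ℂ *ℂ v (1F ∷ y))
    ≈⟨ solve 3 (λ n a b → n :* b :+ (con 0ℚ :* a :+ con 1ℚ :* b) := (con 1ℚ :+ n) :* b) refl
       (ι (wt y)) (v (0F ∷ y)) (v (1F ∷ y)) ⟩
  (1ℂ +ℂ ι (wt y)) *ℂ v (1F ∷ y)
    ≈⟨ *-congʳ (ι-suc (wt y)) ⟨
  ι (suc (wt y)) *ℂ v (1F ∷ y) ∎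

A*-dΓ : ∀ {D} (v : V D) → A* ·ⱽ v ≈ⱽ dΓ Zₘ v
A*-dΓ {D} v y = begin
  (A* ·ⱽ v) y
    ≈⟨ diagonal-·ⱽ (rational (θ D (wt y))) y v ⟩
  rational (θ D (wt y)) *ℂ v y
    ≈⟨ *-congʳ (θ-ι D (wt y)) ⟩
  (ι D +ℂ -ℂ (ι 2 *ℂ ι (wt y))) *ℂ v y
    ≈⟨ solve 3 (λ d w a → (d :+ :- (con (int (+ 2)) :* w)) :* a
                       := con 1ℚ :* (d :* a) :+ con (ℚ.- int (+ 2)) :* (w :* a)) refl (ι D) (ι (wt y)) (v y) ⟩
  1ℂ *ℂ (ι D *ℂ v y) +ℂ rational (ℚ.- int (+ 2)) *ℂ (ι (wt y) *ℂ v y)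
    ≈⟨ +-cong (*-congˡ (dΓ-identity v y)) (*-congˡ (N-mask v y)) ⟨
  1ℂ *ℂ dΓ (mat₂ 1ℂ 0ℂ 0ℂ 1ℂ) v y +ℂ rational (ℚ.- int (+ 2)) *ℂ dΓ Nₘ v y
    ≈⟨ dΓ-combine _ _ _ _ v y ⟨
  dΓ (λ a b → 1ℂ *ℂ mat₂ 1ℂ 0ℂ 0ℂ 1ℂ a b +ℂ rational (ℚ.- int (+ 2)) *ℂ Nₘ a b) v y
    ≈⟨ dΓ-congᴮ (≈²-entries
         (≡⇒≈ℂ (λ _ → ≡.refl) (λ _ → ≡.refl)) (≡⇒≈ℂ (λ _ → ≡.refl) (λ _ → ≡.refl))
         (≡⇒≈ℂ (λ _ → ≡.refl) (λ _ → ≡.refl)) (≡⇒≈ℂ (λ _ → ≡.refl) (λ _ → ≡.refl))) v y ⟩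
  dΓ Zₘ v y ∎

-- Raising moves weight n to n + 1, so a multiplier m afterwards is `m ∘ suc` beforehand. An
-- arbitrary m is needed because a leading 1 shifts it in the induction. For projections the shift
-- costs nothing, as `δ (suc n) (suc k)` reduces to `δ n k`.
raise-mask : ∀ α m {D} (v : V D) → dΓ (raise α) (mask (m ∘ suc) v) ≈ⱽ mask m (dΓ (raise α) v)
raise-mask α m v [] = sym (zeroʳ _)
raise-mask α m v (0F ∷ y) = trans (+-congʳ (raise-mask α m (v ∘ (0F ∷_)) y))
  (solve 6 (λ m s m₁ m₂ a b → m :* s :+ (con 0ℚ :* (m₁ :* a) :+ con 0ℚ :* (m₂ :* b))
                            := m :* (s :+ (con 0ℚ :* a :+ con 0ℚ :* b))) refl (m (wt y)) _ _ _ _ _)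
raise-mask α m v (1F ∷ y) = trans (+-congʳ (raise-mask α (m ∘ suc) (v ∘ (1F ∷_)) y))
  (solve 6 (λ α m s m₂ a b → m :* s :+ (α :* (m :* a) :+ con 0ℚ :* (m₂ :* b))
                            := m :* (s :+ (α :* a :+ con 0ℚ :* b))) refl α (m (suc (wt y))) _ _ _ _)

lower-mask : ∀ β m {D} (v : V D) → dΓ (lower β) (mask m v) ≈ⱽ mask (m ∘ suc) (dΓ (lower β) v)
lower-mask β m v [] = sym (zeroʳ _)
lower-mask β m v (0F ∷ y) = trans (+-congʳ (lower-mask β m (v ∘ (0F ∷_)) y))
  (solve 6 (λ β m s m₁ a b → m :* s :+ (con 0ℚ :* (m₁ :* a) :+ β :* (m :* b))
                            := m :* (s :+ (con 0ℚ :* a :+ β :* b))) refl β (m (suc (wt y))) _ _ _ _)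
lower-mask β m v (1F ∷ y) = trans (+-congʳ (lower-mask β (m ∘ suc) (v ∘ (1F ∷_)) y))
  (solve 6 (λ m s m₁ m₂ a b → m :* s :+ (con 0ℚ :* (m₁ :* a) :+ con 0ℚ :* (m₂ :* b))
                            := m :* (s :+ (con 0ℚ :* a :+ con 0ℚ :* b))) refl (m (suc (suc (wt y)))) _ _ _ _ _)

raise-π : ∀ α k {D} (v : V D) → π (suc k) (dΓ (raise α) v) ≈ⱽ dΓ (raise α) (π k v)
raise-π α k v y = sym (raise-mask α (λ n → δ n (suc k)) v y)

raise-π₀ : ∀ α {D} (v : V D) → π 0 (dΓ (raise α) v) ≈ⱽ 0ⱽ
raise-π₀ α v y = trans (sym (raise-mask α (λ n → δ n 0) v y)) (dΓ-0 (raise α) (λ z → zeroˡ (v z)) y)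

lower-π : ∀ β k {D} (v : V D) → π k (dΓ (lower β) v) ≈ⱽ dΓ (lower β) (π (suc k) v)
lower-π β k v y = sym (lower-mask β (λ n → δ n (suc k)) v y)

lower-π₀ : ∀ β {D} (v : V D) → dΓ (lower β) (π 0 v) ≈ⱽ 0ⱽ
lower-π₀ β v y = trans (lower-mask β (λ n → δ n 0) v y) (zeroˡ _)

mask-cong : ∀ m {D} {v w : V D} → v ≈ⱽ w → mask m v ≈ⱽ mask m w
mask-cong m p y = *-congˡ (p y)

δ-≡ : ∀ n → δ n n ≡ 1ℂ
δ-≡ n = cong (λ b → if b then 1ℂ else 0ℂ) (dec-true (n ℕ.≟ n) ≡.refl)

δ-≢ : ∀ {m n} → m ≢ n → δ m n ≡ 0ℂ
δ-≢ {m} {n} m≢n = cong (λ b → if b then 1ℂ else 0ℂ) (dec-false (m ℕ.≟ n) m≢n)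

π-off : ∀ {D} k (v : V D) y → wt y ≢ k → π k v y ≈ℂ 0ℂ
π-off k v y y≢k = trans (*-congʳ (reflexive (δ-≢ y≢k))) (zeroˡ (v y))

mask-π : ∀ m k {D} (v : V D) → mask m (π k v) ≈ⱽ m k •ⱽ π k v
mask-π m k v y with wt y ℕ.≟ k
... | yes y≡k = *-congʳ (reflexive (cong m y≡k))
... | no y≢k  = trans (*-congˡ (π-off k v y y≢k))
  (trans (zeroʳ _) (sym (trans (*-congˡ (π-off k v y y≢k)) (zeroʳ _))))

N-π : ∀ k {D} (v : V D) → dΓ Nₘ (π k v) ≈ⱽ ι k •ⱽ π k v
N-π k v y = trans (N-mask (π k v) y) (mask-π ι k v y)

π-N : ∀ k {D} (v : V D) → π k (dΓ Nₘ v) ≈ⱽ ι k •ⱽ π k v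
π-N k v y = begin
  δ (wt y) k *ℂ dΓ Nₘ v y             ≈⟨ *-congˡ (N-mask v y) ⟩
  δ (wt y) k *ℂ (ι (wt y) *ℂ v y)     ≈⟨ solve 3 (λ a b c → a :* (b :* c) := b :* (a :* c)) refl _ _ _ ⟩
  ι (wt y) *ℂ (δ (wt y) k *ℂ v y)     ≈⟨ mask-π ι k v y ⟩
  ι k *ℂ (δ (wt y) k *ℂ v y)          ∎

π-above : ∀ {D} k → D < k → (v : V D) → π k v ≈ⱽ 0ⱽ
π-above k D<k v y = π-off k v y λ y≡k → ℕ.<⇒≱ D<k (subst (_≤ _) y≡k (wt≤D y))

conj-cong : ∀ {z w} → z ≈ℂ w → conj z ≈ℂ conj w
conj-cong p = mk≈ℂ (re≈ p) (ℝ-ring.-‿cong (im≈ p))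
  where module ℝ-ring = CommutativeRing ℝ-commutativeRing

conj-+ : ∀ z w → conj (z +ℂ w) ≈ℂ conj z +ℂ conj w
conj-+ z w = ≡⇒≈ℂ (λ _ → ≡.refl) (λ n → neg-+ (term (im z) n) (term (im w) n))
  where
  neg-+ : ∀ a b → ℚ.- (a ℚ.+ b) ≡ ℚ.- a ℚ.+ ℚ.- b
  neg-+ = solve-∀ ℚ-ring

conj-* : ∀ z w → conj (z *ℂ w) ≈ℂ conj z *ℂ conj w
conj-* z w = ≡⇒≈ℂ
  (λ n → re-* (term (re z) n) (term (im z) n) (term (re w) n) (term (im w) n))
  (λ n → im-* (term (re z) n) (term (im z) n) (term (re w) n) (term (im w) n))
  where
  re-* : ∀ a b c d → a ℚ.* c ℚ.+ ℚ.- (b ℚ.* d) ≡ a ℚ.* c ℚ.+ ℚ.- (ℚ.- b ℚ.* ℚ.- d)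
  re-* = solve-∀ ℚ-ring
  im-* : ∀ a b c d → ℚ.- (a ℚ.* d ℚ.+ b ℚ.* c) ≡ a ℚ.* ℚ.- d ℚ.+ ℚ.- b ℚ.* c
  im-* = solve-∀ ℚ-ring

conj-rational : ∀ q → conj (rational q) ≈ℂ rational q
conj-rational q = ≡⇒≈ℂ (λ _ → ≡.refl) (λ _ → ≡.refl)

⟨⟩-cong : ∀ {D} {v v′ w w′ : V D} → v ≈ⱽ v′ → w ≈ⱽ w′ → ⟨ v , w ⟩ ≈ℂ ⟨ v′ , w′ ⟩
⟨⟩-cong p q = sumX-cong λ y → *-cong (p y) (conj-cong (q y))

⟨⟩-+ˡ : ∀ {D} (u v w : V D) → ⟨ u +ⱽ v , w ⟩ ≈ℂ ⟨ u , w ⟩ +ℂ ⟨ v , w ⟩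
⟨⟩-+ˡ {D} u v w = trans (sumX-cong λ y → distribʳ (conj (w y)) (u y) (v y)) (sumX-+ {D} _ _)

⟨⟩-•ˡ : ∀ {D} c (v w : V D) → ⟨ c •ⱽ v , w ⟩ ≈ℂ c *ℂ ⟨ v , w ⟩
⟨⟩-•ˡ {D} c v w = trans (sumX-cong λ y → *-assoc c (v y) (conj (w y))) (sumX-*ˡ {D} c _)

⟨⟩-+ʳ : ∀ {D} (u v w : V D) → ⟨ u , v +ⱽ w ⟩ ≈ℂ ⟨ u , v ⟩ +ℂ ⟨ u , w ⟩
⟨⟩-+ʳ {D} u v w = trans
  (sumX-cong λ y → trans (*-congˡ (conj-+ (v y) (w y))) (distribˡ (u y) (conj (v y)) (conj (w y))))
  (sumX-+ {D} _ _)

⟨⟩-•ʳ : ∀ {D} c (v w : V D) → ⟨ v , c •ⱽ w ⟩ ≈ℂ conj c *ℂ ⟨ v , w ⟩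
⟨⟩-•ʳ {D} c v w = trans
  (sumX-cong λ y → trans (*-congˡ (conj-* c (w y)))
    (solve 3 (λ a b c → a :* (b :* c) := b :* (a :* c)) refl (v y) (conj c) (conj (w y))))
  (sumX-*ˡ {D} (conj c) _)

dΓ-adjoint : ∀ {B C} → (∀ a b → conj (C b a) ≈ℂ B a b) →
  ∀ {D} (v w : V D) → ⟨ dΓ B v , w ⟩ ≈ℂ ⟨ v , dΓ C w ⟩
dΓ-adjoint p {zero}  v w = trans (zeroˡ _) (sym (trans (*-congˡ (conj-rational 0ℚ)) (zeroʳ _)))
dΓ-adjoint {B} {C} p {suc D} v w = begin
  ⟨ dΓ B v ∘ (0F ∷_) , w₀ ⟩ +ℂ ⟨ dΓ B v ∘ (1F ∷_) , w₁ ⟩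
    ≈⟨ +-cong (left 0F) (left 1F) ⟩
  (⟨ v₀ , dΓ C w₀ ⟩ +ℂ (B 0F 0F *ℂ ⟨ v₀ , w₀ ⟩ +ℂ B 0F 1F *ℂ ⟨ v₁ , w₀ ⟩)) +ℂ
  (⟨ v₁ , dΓ C w₁ ⟩ +ℂ (B 1F 0F *ℂ ⟨ v₀ , w₁ ⟩ +ℂ B 1F 1F *ℂ ⟨ v₁ , w₁ ⟩))
    ≈⟨ solve 10 (λ s t a b c d p q x y →
         (s :+ (a :* p :+ b :* q)) :+ (t :+ (c :* x :+ d :* y))
      := (s :+ (a :* p :+ c :* x)) :+ (t :+ (b :* q :+ d :* y))) refl
         _ _ (B 0F 0F) (B 0F 1F) (B 1F 0F) (B 1F 1F) _ _ _ _ ⟩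
  (⟨ v₀ , dΓ C w₀ ⟩ +ℂ (B 0F 0F *ℂ ⟨ v₀ , w₀ ⟩ +ℂ B 1F 0F *ℂ ⟨ v₀ , w₁ ⟩)) +ℂ
  (⟨ v₁ , dΓ C w₁ ⟩ +ℂ (B 0F 1F *ℂ ⟨ v₁ , w₀ ⟩ +ℂ B 1F 1F *ℂ ⟨ v₁ , w₁ ⟩))
    ≈⟨ +-cong (right 0F) (right 1F) ⟨
  ⟨ v₀ , dΓ C w ∘ (0F ∷_) ⟩ +ℂ ⟨ v₁ , dΓ C w ∘ (1F ∷_) ⟩ ∎
  where
  v₀ v₁ w₀ w₁ : V D
  v₀ = v ∘ (0F ∷_)
  v₁ = v ∘ (1F ∷_)
  w₀ = w ∘ (0F ∷_)
  w₁ = w ∘ (1F ∷_)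
  left : ∀ a → ⟨ dΓ B v ∘ (a ∷_) , w ∘ (a ∷_) ⟩ ≈ℂ
    ⟨ v ∘ (a ∷_) , dΓ C (w ∘ (a ∷_)) ⟩ +ℂ (B a 0F *ℂ ⟨ v₀ , w ∘ (a ∷_) ⟩ +ℂ B a 1F *ℂ ⟨ v₁ , w ∘ (a ∷_) ⟩)
  left a = trans (⟨⟩-+ˡ (dΓ B (v ∘ (a ∷_))) (B a 0F •ⱽ v₀ +ⱽ B a 1F •ⱽ v₁) (w ∘ (a ∷_))) (+-cong (dΓ-adjoint p (v ∘ (a ∷_)) (w ∘ (a ∷_)))
    (trans (⟨⟩-+ˡ (B a 0F •ⱽ v₀) (B a 1F •ⱽ v₁) (w ∘ (a ∷_)))
      (+-cong (⟨⟩-•ˡ (B a 0F) v₀ (w ∘ (a ∷_))) (⟨⟩-•ˡ (B a 1F) v₁ (w ∘ (a ∷_))))))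
  right : ∀ a → ⟨ v ∘ (a ∷_) , dΓ C w ∘ (a ∷_) ⟩ ≈ℂ
    ⟨ v ∘ (a ∷_) , dΓ C (w ∘ (a ∷_)) ⟩ +ℂ (B 0F a *ℂ ⟨ v ∘ (a ∷_) , w₀ ⟩ +ℂ B 1F a *ℂ ⟨ v ∘ (a ∷_) , w₁ ⟩)
  right a = trans (⟨⟩-+ʳ (v ∘ (a ∷_)) (dΓ C (w ∘ (a ∷_))) (C a 0F •ⱽ w₀ +ⱽ C a 1F •ⱽ w₁)) (+-congˡ
    (trans (⟨⟩-+ʳ (v ∘ (a ∷_)) (C a 0F •ⱽ w₀) (C a 1F •ⱽ w₁)) (+-cong
      (trans (⟨⟩-•ʳ (C a 0F) (v ∘ (a ∷_)) w₀) (*-congʳ (p 0F a)))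
      (trans (⟨⟩-•ʳ (C a 1F) (v ∘ (a ∷_)) w₁) (*-congʳ (p 1F a))))))

-- P₁ is √2 times a unitary matrix, so each coordinate contributes a factor 2. Leaving P
-- unnormalised keeps the square root out of the argument.
P-scaling : ∀ {D} (v w : V D) → ⟨ P ·ⱽ v , P ·ⱽ w ⟩ ≈ℂ ι (2 ℕ.^ D) *ℂ ⟨ v , w ⟩
P-scaling {zero}  v w = trans (*-cong (*-identityˡ _) (conj-cong (*-identityˡ _))) (sym (*-identityˡ _))
P-scaling {suc D} v w = begin
  ⟨ P ·ⱽ v , P ·ⱽ w ⟩
    ≈⟨ +-cong (rows 0F) (rows 1F) ⟩
  ⟨ row 0F v , row 0F w ⟩ +ℂ ⟨ row 1F v , row 1F w ⟩
    ≈⟨ sumX-+ {D} _ _ ⟨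
  sumX (λ y → row 0F v y *ℂ conj (row 0F w y) +ℂ row 1F v y *ℂ conj (row 1F w y))
    ≈⟨ sumX-cong (λ y → parallelogram (Pv 0F y) (Pv 1F y) (Pw 0F y) (Pw 1F y)) ⟩
  sumX (λ y → ι 2 *ℂ (Pv 0F y *ℂ conj (Pw 0F y) +ℂ Pv 1F y *ℂ conj (Pw 1F y)))
    ≈⟨ trans (sumX-*ˡ {D} _ _) (*-congˡ (sumX-+ {D} _ _)) ⟩
  ι 2 *ℂ (⟨ Pv 0F , Pw 0F ⟩ +ℂ ⟨ Pv 1F , Pw 1F ⟩)
    ≈⟨ *-congˡ (+-cong (P-scaling (v ∘ (0F ∷_)) (w ∘ (0F ∷_))) (P-scaling (v ∘ (1F ∷_)) (w ∘ (1F ∷_)))) ⟩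
  ι 2 *ℂ (ι (2 ℕ.^ D) *ℂ ⟨ v ∘ (0F ∷_) , w ∘ (0F ∷_) ⟩ +ℂ ι (2 ℕ.^ D) *ℂ ⟨ v ∘ (1F ∷_) , w ∘ (1F ∷_) ⟩)
    ≈⟨ solve 4 (λ a b c d → a :* (b :* c :+ b :* d) := a :* b :* (c :+ d)) refl (ι 2) _ _ _ ⟩
  ι 2 *ℂ ι (2 ℕ.^ D) *ℂ ⟨ v , w ⟩
    ≈⟨ *-congʳ (ι-* 2 (2 ℕ.^ D)) ⟨
  ι (2 ℕ.^ suc D) *ℂ ⟨ v , w ⟩ ∎
  where
  row : Fin 2 → V (suc D) → V D
  row a u y = P₁ a 0F *ℂ (P ·ⱽ (u ∘ (0F ∷_))) y +ℂ P₁ a 1F *ℂ (P ·ⱽ (u ∘ (1F ∷_))) y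
  Pv Pw : Fin 2 → V D
  Pv b = P ·ⱽ (v ∘ (b ∷_))
  Pw b = P ·ⱽ (w ∘ (b ∷_))
  rows : ∀ a → ⟨ (P ·ⱽ v) ∘ (a ∷_) , (P ·ⱽ w) ∘ (a ∷_) ⟩ ≈ℂ ⟨ row a v , row a w ⟩
  rows a = ⟨⟩-cong {v = (P ·ⱽ v) ∘ (a ∷_)} {row a v} {(P ·ⱽ w) ∘ (a ∷_)} {row a w} (⊗-∷ P₁ v a) (⊗-∷ P₁ w a)
  conj-row : ∀ α β s t → conj (α *ℂ s +ℂ β *ℂ t) ≈ℂ conj α *ℂ conj s +ℂ conj β *ℂ conj t
  conj-row α β s t = trans (conj-+ _ _) (+-cong (conj-* α s) (conj-* β t))
  parallelogram : ∀ s t s′ t′ →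
    (1ℂ *ℂ s +ℂ 1ℂ *ℂ t) *ℂ conj (1ℂ *ℂ s′ +ℂ 1ℂ *ℂ t′) +ℂ
    (-ℂ 𝐢 *ℂ s +ℂ 𝐢 *ℂ t) *ℂ conj (-ℂ 𝐢 *ℂ s′ +ℂ 𝐢 *ℂ t′)
    ≈ℂ ι 2 *ℂ (s *ℂ conj s′ +ℂ t *ℂ conj t′)
  parallelogram s t s′ t′ = begin
    (1ℂ *ℂ s +ℂ 1ℂ *ℂ t) *ℂ conj (1ℂ *ℂ s′ +ℂ 1ℂ *ℂ t′) +ℂ
    (-ℂ 𝐢 *ℂ s +ℂ 𝐢 *ℂ t) *ℂ conj (-ℂ 𝐢 *ℂ s′ +ℂ 𝐢 *ℂ t′)
      ≈⟨ +-cong (*-congˡ (conj-row 1ℂ 1ℂ s′ t′)) (*-congˡ (conj-row (-ℂ 𝐢) 𝐢 s′ t′)) ⟩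
    (1ℂ *ℂ s +ℂ 1ℂ *ℂ t) *ℂ (conj 1ℂ *ℂ conj s′ +ℂ conj 1ℂ *ℂ conj t′) +ℂ
    (-ℂ 𝐢 *ℂ s +ℂ 𝐢 *ℂ t) *ℂ (conj (-ℂ 𝐢) *ℂ conj s′ +ℂ conj 𝐢 *ℂ conj t′)
      ≈⟨ +-cong (*-congˡ (+-cong (*-congʳ (conj-rational 1ℚ)) (*-congʳ (conj-rational 1ℚ))))
                (*-congˡ (+-cong (*-congʳ conj-𝐢) refl)) ⟩
    (1ℂ *ℂ s +ℂ 1ℂ *ℂ t) *ℂ (1ℂ *ℂ conj s′ +ℂ 1ℂ *ℂ conj t′) +ℂ
    (-ℂ 𝐢 *ℂ s +ℂ 𝐢 *ℂ t) *ℂ (-ℂ conj 𝐢 *ℂ conj s′ +ℂ conj 𝐢 *ℂ conj t′)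
      -- `conj 𝐢` is an indeterminate here, since the solver knows only rational constants; 𝐢 times
      -- its conjugate is replaced by 1 in the next step.
      ≈⟨ solve 6 (λ i p s t s′ t′ →
           (con 1ℚ :* s :+ con 1ℚ :* t) :* (con 1ℚ :* s′ :+ con 1ℚ :* t′) :+
           (:- i :* s :+ i :* t) :* (:- p :* s′ :+ p :* t′)
        := (s :+ t) :* (s′ :+ t′) :+ i :* p :* ((t :+ :- s) :* (t′ :+ :- s′))) refl
           𝐢 (conj 𝐢) s t (conj s′) (conj t′) ⟩
    (s +ℂ t) *ℂ (conj s′ +ℂ conj t′) +ℂ 𝐢 *ℂ conj 𝐢 *ℂ ((t +ℂ -ℂ s) *ℂ (conj t′ +ℂ -ℂ conj s′))
      ≈⟨ +-congˡ (*-congʳ norm-𝐢) ⟩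
    (s +ℂ t) *ℂ (conj s′ +ℂ conj t′) +ℂ 1ℂ *ℂ ((t +ℂ -ℂ s) *ℂ (conj t′ +ℂ -ℂ conj s′))
      ≈⟨ solve 4 (λ s t s′ t′ →
           (s :+ t) :* (s′ :+ t′) :+ con 1ℚ :* ((t :+ :- s) :* (t′ :+ :- s′))
        := con (int (+ 2)) :* (s :* s′ :+ t :* t′)) refl s t (conj s′) (conj t′) ⟩
    ι 2 *ℂ (s *ℂ conj s′ +ℂ t *ℂ conj t′) ∎
    where
    conj-𝐢 : conj (-ℂ 𝐢) ≈ℂ -ℂ conj 𝐢
    conj-𝐢 = ≡⇒≈ℂ (λ _ → ≡.refl) (λ _ → ≡.refl)
    norm-𝐢 : 𝐢 *ℂ conj 𝐢 ≈ℂ 1ℂ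
    norm-𝐢 = ≡⇒≈ℂ (λ _ → ≡.refl) (λ _ → ≡.refl)

-- Extremal vectors

-- `up α` is N - raise α and `down β` is 1 - N - lower β. Both are idempotents of trace one, with
-- kernels spanned by (1,α) and (β,1); for αβ = 1 these are the same line.
up down : ℂ → 𝕄₂
up α   = mat₂ 0ℂ 0ℂ (-ℂ α) 1ℂ
down β = mat₂ 1ℂ (-ℂ β) 0ℂ 0ℂ

-- Extremal (up α) (down β) r v, with αβ = 1, says that v is an extremal weight vector of
-- weight D - 2r for the sl₂-triple with Cartan element raise α + lower β: each equation is
-- the eigenvalue equation corrected by a multiple of the annihilation condition, such that
-- raise α v = (N - r) v and lower β v = (D - r - N) v for the number operator N.
Extremal : ∀ {D} → 𝕄₂ → 𝕄₂ → ℕ → V D → Set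
Extremal B C r v = dΓ B v ≈ⱽ ι r •ⱽ v × dΓ C v ≈ⱽ ι r •ⱽ v

module Strings {D : ℕ} (α β : ℂ) (r : ℕ) (v : V D) (ext : Extremal (up α) (down β) r v) where

  raise-N : ∀ y → dΓ (raise α) v y +ℂ ι r *ℂ v y ≈ℂ dΓ Nₘ v y
  raise-N y = begin
    dΓ (raise α) v y +ℂ ι r *ℂ v y
      ≈⟨ +-congˡ (proj₁ ext y) ⟨
    dΓ (raise α) v y +ℂ dΓ (up α) v y
      ≈⟨ +-congˡ (trans (dΓ-congᴮ up≈ v y) (dΓ-combine 1ℂ Nₘ (-ℂ 1ℂ) (raise α) v y)) ⟩
    dΓ (raise α) v y +ℂ (1ℂ *ℂ dΓ Nₘ v y +ℂ -ℂ 1ℂ *ℂ dΓ (raise α) v y)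
      ≈⟨ solve 2 (λ e n → e :+ (con 1ℚ :* n :+ :- con 1ℚ :* e) := n) refl _ _ ⟩
    dΓ Nₘ v y ∎
    where
    up≈ : up α ≈² (λ a b → 1ℂ *ℂ Nₘ a b +ℂ -ℂ 1ℂ *ℂ raise α a b)
    up≈ = ≈²-entries
      (solve 0 (con 0ℚ := con 1ℚ :* con 0ℚ :+ :- con 1ℚ :* con 0ℚ) refl)
      (solve 0 (con 0ℚ := con 1ℚ :* con 0ℚ :+ :- con 1ℚ :* con 0ℚ) refl)
      (solve 1 (λ α → :- α := con 1ℚ :* con 0ℚ :+ :- con 1ℚ :* α) refl α)
      (solve 0 (con 1ℚ := con 1ℚ :* con 1ℚ :+ :- con 1ℚ :* con 0ℚ) refl)

  lower-N : ∀ y → dΓ (lower β) v y +ℂ dΓ Nₘ v y +ℂ ι r *ℂ v y ≈ℂ ι D *ℂ v y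
  lower-N y = begin
    dΓ (lower β) v y +ℂ dΓ Nₘ v y +ℂ ι r *ℂ v y
      ≈⟨ +-congˡ (proj₂ ext y) ⟨
    dΓ (lower β) v y +ℂ dΓ Nₘ v y +ℂ dΓ (down β) v y
      ≈⟨ solve 3 (λ f n d → f :+ n :+ d := con 1ℚ :* (con 1ℚ :* f :+ con 1ℚ :* n) :+ con 1ℚ :* d) refl _ _ _ ⟩
    1ℂ *ℂ (1ℂ *ℂ dΓ (lower β) v y +ℂ 1ℂ *ℂ dΓ Nₘ v y) +ℂ 1ℂ *ℂ dΓ (down β) v y
      ≈⟨ +-congʳ (*-congˡ (dΓ-combine 1ℂ (lower β) 1ℂ Nₘ v y)) ⟨
    1ℂ *ℂ dΓ (λ a b → 1ℂ *ℂ lower β a b +ℂ 1ℂ *ℂ Nₘ a b) v y +ℂ 1ℂ *ℂ dΓ (down β) v y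
      ≈⟨ dΓ-combine 1ℂ _ 1ℂ (down β) v y ⟨
    dΓ (λ a b → 1ℂ *ℂ (1ℂ *ℂ lower β a b +ℂ 1ℂ *ℂ Nₘ a b) +ℂ 1ℂ *ℂ down β a b) v y
      ≈⟨ dΓ-congᴮ sum≈1 v y ⟩
    dΓ (mat₂ 1ℂ 0ℂ 0ℂ 1ℂ) v y
      ≈⟨ dΓ-identity v y ⟩
    ι D *ℂ v y ∎
    where
    sum≈1 : (λ a b → 1ℂ *ℂ (1ℂ *ℂ lower β a b +ℂ 1ℂ *ℂ Nₘ a b) +ℂ 1ℂ *ℂ down β a b) ≈² mat₂ 1ℂ 0ℂ 0ℂ 1ℂ
    sum≈1 = ≈²-entries
      (solve 0 (con 1ℚ :* (con 1ℚ :* con 0ℚ :+ con 1ℚ :* con 0ℚ) :+ con 1ℚ :* con 1ℚ := con 1ℚ) refl)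
      (solve 1 (λ β → con 1ℚ :* (con 1ℚ :* β :+ con 1ℚ :* con 0ℚ) :+ con 1ℚ :* :- β := con 0ℚ) refl β)
      (solve 0 (con 1ℚ :* (con 1ℚ :* con 0ℚ :+ con 1ℚ :* con 0ℚ) :+ con 1ℚ :* con 0ℚ := con 0ℚ) refl)
      (solve 0 (con 1ℚ :* (con 1ℚ :* con 0ℚ :+ con 1ℚ :* con 1ℚ) :+ con 1ℚ :* con 0ℚ := con 1ℚ) refl)

  π-raise-N : ∀ k y → π k (dΓ (raise α) v) y +ℂ ι r *ℂ π k v y ≈ℂ ι k *ℂ π k v y
  π-raise-N k y = begin
    δ (wt y) k *ℂ dΓ (raise α) v y +ℂ ι r *ℂ (δ (wt y) k *ℂ v y)
      ≈⟨ solve 4 (λ t e r v → t :* e :+ r :* (t :* v) := t :* (e :+ r :* v)) refl _ _ _ _ ⟩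
    δ (wt y) k *ℂ (dΓ (raise α) v y +ℂ ι r *ℂ v y)
      ≈⟨ *-congˡ (raise-N y) ⟩
    π k (dΓ Nₘ v) y
      ≈⟨ π-N k v y ⟩
    ι k *ℂ π k v y ∎

  raise-step : ∀ k y → dΓ (raise α) (π k v) y +ℂ ι r *ℂ π (suc k) v y ≈ℂ ι (suc k) *ℂ π (suc k) v y
  raise-step k y = trans (+-congʳ (sym (raise-π α k v y))) (π-raise-N (suc k) y)

  lower-step : ∀ k y → dΓ (lower β) (π (suc k) v) y +ℂ ι k *ℂ π k v y +ℂ ι r *ℂ π k v y ≈ℂ ι D *ℂ π k v y
  lower-step k y = begin
    dΓ (lower β) (π (suc k) v) y +ℂ ι k *ℂ π k v y +ℂ ι r *ℂ π k v y
      ≈⟨ +-congʳ (+-cong (lower-π β k v y) (π-N k v y)) ⟨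
    δ (wt y) k *ℂ dΓ (lower β) v y +ℂ δ (wt y) k *ℂ dΓ Nₘ v y +ℂ ι r *ℂ (δ (wt y) k *ℂ v y)
      ≈⟨ solve 5 (λ t f n r v → t :* f :+ t :* n :+ r :* (t :* v) := t :* (f :+ n :+ r :* v)) refl _ _ _ _ _ ⟩
    δ (wt y) k *ℂ (dΓ (lower β) v y +ℂ dΓ Nₘ v y +ℂ ι r *ℂ v y)
      ≈⟨ *-congˡ (lower-N y) ⟩
    δ (wt y) k *ℂ (ι D *ℂ v y)
      ≈⟨ solve 3 (λ t d v → t :* (d :* v) := d :* (t :* v)) refl _ _ _ ⟩
    ι D *ℂ π k v y ∎

  raise-zero : ∀ k → π k v ≈ⱽ 0ⱽ → ∀ y → ι r *ℂ π (suc k) v y ≈ℂ ι (suc k) *ℂ π (suc k) v y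
  raise-zero k z y = trans (sym (+-identityˡ _)) (trans (+-congʳ (sym (dΓ-0 (raise α) z y))) (raise-step k y))

  -- Write vₖ for `π k v` and e for the raising operator. Extremality gives e vₖ₋₁ = (k - r) vₖ, and
  -- nothing is raised into weight 0. Hence zero propagates upward from there as long as k - r is
  -- nonzero.
  below : ∀ k → k < r → π k v ≈ⱽ 0ⱽ
  below k k<r = go k k<r
    where
    gap : ∀ k m {z} → r ≡ k + suc m → ι r *ℂ z ≈ℂ ι k *ℂ z → z ≈ℂ 0ℂ
    gap k m {z} ≡.refl p = ι-cancel₀ m (begin
      ι (suc m) *ℂ z
        ≈⟨ solve 3 (λ k m z → m :* z := (k :+ m) :* z :+ :- (k :* z)) refl (ι k) (ι (suc m)) z ⟩
      (ι k +ℂ ι (suc m)) *ℂ z +ℂ -ℂ (ι k *ℂ z)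
        ≈⟨ +-congʳ (trans (*-congʳ (sym (ι-+ k (suc m)))) p) ⟩
      ι k *ℂ z +ℂ -ℂ (ι k *ℂ z)
        ≈⟨ solve 1 (λ z → z :+ :- z := con 0ℚ) refl _ ⟩
      0ℂ ∎)
    split : ∀ {k} → k < r → r ≡ k + suc (r ℕ.∸ suc k)
    split {k} k<r = ≡.sym (≡.trans (ℕ.+-suc k _) (ℕ.m+[n∸m]≡n k<r))
    go : ∀ k → k < r → π k v ≈ⱽ 0ⱽ
    go zero    k<r y = gap 0 _ (split k<r)
      (trans (sym (+-identityˡ _)) (trans (+-congʳ (sym (raise-π₀ α v y))) (π-raise-N 0 y)))
    go (suc k) k<r y = gap (suc k) _ (split k<r) (raise-zero k (go k (ℕ.<⇒≤ k<r)) y)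

  -- The same relation propagates zero past r once the component at r itself is gone. This is how
  -- vanishing in the grading by E* forces vanishing in the other gradings.
  vanishing : π r v ≈ⱽ 0ⱽ → v ≈ⱽ 0ⱽ
  vanishing z y = trans (sym at-weight) (all (wt y) y)
    where
    at-weight : π (wt y) v y ≈ℂ v y
    at-weight = trans (*-congʳ (reflexive (δ-≡ (wt y)))) (*-identityˡ (v y))
    above : ∀ i → π (i + r) v ≈ⱽ 0ⱽ
    above zero    = z
    above (suc i) y = ι-cancel₀ i (begin
      ι (suc i) *ℂ p
        ≈⟨ solve 3 (λ i r p → i :* p := (i :+ r) :* p :+ :- (r :* p)) refl (ι (suc i)) (ι r) p ⟩
      (ι (suc i) +ℂ ι r) *ℂ p +ℂ -ℂ (ι r *ℂ p)
        ≈⟨ +-cong (*-congʳ (sym (ι-+ (suc i) r))) (-‿cong (raise-zero (i + r) (above i) y)) ⟩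
      ι (suc i + r) *ℂ p +ℂ -ℂ (ι (suc i + r) *ℂ p)
        ≈⟨ solve 1 (λ z → z :+ :- z := con 0ℚ) refl _ ⟩
      0ℂ ∎)
      where
      p : ℂ
      p = π (suc i + r) v y
    all : ∀ k → π k v ≈ⱽ 0ⱽ
    all k with k ℕ.<? r
    ... | yes k<r = below k k<r
    ... | no k≮r  = subst (λ k → π k v ≈ⱽ 0ⱽ) (ℕ.m∸n+n≡m (ℕ.≮⇒≥ k≮r)) (above (k ℕ.∸ r))

  module _ (conj-α : conj α ≈ℂ β) (conj-β : conj β ≈ℂ α) (d : ℕ) (D≡ : D ≡ r + (r + d)) where

    N : ℕ → ℂ
    N k = ⟨ π k v , π k v ⟩

    -- A mixed inner product evaluated twice: by raising in the left argument, which gives (k + 1 -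
    -- r) Nₖ₊₁, and by moving the raising operator across as its adjoint, which gives (D - r - k)
    -- Nₖ.
    G : ℕ → ℂ
    G k = ⟨ dΓ (raise α) (π k v) , π (suc k) v ⟩

    G-raise : ∀ k → G k +ℂ ι r *ℂ N (suc k) ≈ℂ ι (suc k) *ℂ N (suc k)
    G-raise k = begin
      G k +ℂ ι r *ℂ N (suc k)
        ≈⟨ +-congˡ (⟨⟩-•ˡ (ι r) (π (suc k) v) (π (suc k) v)) ⟨
      G k +ℂ ⟨ ι r •ⱽ π (suc k) v , π (suc k) v ⟩
        ≈⟨ ⟨⟩-+ˡ (dΓ (raise α) (π k v)) (ι r •ⱽ π (suc k) v) (π (suc k) v) ⟨
      ⟨ dΓ (raise α) (π k v) +ⱽ ι r •ⱽ π (suc k) v , π (suc k) v ⟩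
        ≈⟨ ⟨⟩-cong {w = π (suc k) v} (raise-step k) (λ _ → refl) ⟩
      ⟨ ι (suc k) •ⱽ π (suc k) v , π (suc k) v ⟩
        ≈⟨ ⟨⟩-•ˡ (ι (suc k)) (π (suc k) v) (π (suc k) v) ⟩
      ι (suc k) *ℂ N (suc k) ∎

    ⟨⟩-ιʳ : ∀ n (u w : V D) → ⟨ u , ι n •ⱽ w ⟩ ≈ℂ ι n *ℂ ⟨ u , w ⟩
    ⟨⟩-ιʳ n u w = trans (⟨⟩-•ʳ (ι n) u w) (*-congʳ (conj-rational _))

    G-lower : ∀ k → G k +ℂ ι k *ℂ N k +ℂ ι r *ℂ N k ≈ℂ ι D *ℂ N k
    G-lower k = begin
      G k +ℂ ι k *ℂ N k +ℂ ι r *ℂ N k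
        ≈⟨ +-cong (+-cong (dΓ-adjoint adjoint (π k v) (π (suc k) v))
                          (sym (⟨⟩-ιʳ k (π k v) (π k v)))) (sym (⟨⟩-ιʳ r (π k v) (π k v))) ⟩
      ⟨ π k v , f ⟩ +ℂ ⟨ π k v , ι k •ⱽ π k v ⟩ +ℂ ⟨ π k v , ι r •ⱽ π k v ⟩
        ≈⟨ +-congʳ (⟨⟩-+ʳ (π k v) f (ι k •ⱽ π k v)) ⟨
      ⟨ π k v , f +ⱽ ι k •ⱽ π k v ⟩ +ℂ ⟨ π k v , ι r •ⱽ π k v ⟩
        ≈⟨ ⟨⟩-+ʳ (π k v) (f +ⱽ ι k •ⱽ π k v) (ι r •ⱽ π k v) ⟨
      ⟨ π k v , f +ⱽ ι k •ⱽ π k v +ⱽ ι r •ⱽ π k v ⟩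
        ≈⟨ ⟨⟩-cong {v = π k v} (λ _ → refl) (lower-step k) ⟩
      ⟨ π k v , ι D •ⱽ π k v ⟩
        ≈⟨ ⟨⟩-ιʳ D (π k v) (π k v) ⟩
      ι D *ℂ N k ∎
      where
      f : V D
      f = dΓ (lower β) (π (suc k) v)
      adjoint : ∀ a b → conj (lower β b a) ≈ℂ raise α a b
      adjoint 0F 0F = conj-rational 0ℚ
      adjoint 0F 1F = conj-rational 0ℚ
      adjoint 1F 0F = conj-β
      adjoint 1F 1F = conj-rational 0ℚ

    -- Both evaluations of `G` at k = r + i are equated, and D = 2r + d turns D - r - k into d - i.
    -- The additive shape is that of `choose-absorb`.
    recurrence : ∀ i → ι (suc i) *ℂ N (r + suc i) +ℂ ι i *ℂ N (r + i) ≈ℂ ι d *ℂ N (r + i)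
    recurrence i = begin
      ι (suc i) *ℂ N (r + suc i) +ℂ ι i *ℂ N (r + i)
        ≡⟨ cong (λ k → ι (suc i) *ℂ N k +ℂ ι i *ℂ N (r + i)) (ℕ.+-suc r i) ⟩
      ι (suc i) *ℂ N′ +ℂ ι i *ℂ N₀
        ≈⟨ solve 5 (λ i s r n m → s :* n :+ i :* m := (r :+ s) :* n :+ :- (r :* n) :+ i :* m) refl
           (ι i) (ι (suc i)) (ι r) N′ N₀ ⟩
      (ι r +ℂ ι (suc i)) *ℂ N′ +ℂ -ℂ (ι r *ℂ N′) +ℂ ι i *ℂ N₀
        ≈⟨ +-congʳ (+-congʳ (*-congʳ (trans (sym (ι-+ r (suc i))) (reflexive (cong ι (ℕ.+-suc r i)))))) ⟩
      ι (suc (r + i)) *ℂ N′ +ℂ -ℂ (ι r *ℂ N′) +ℂ ι i *ℂ N₀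
        ≈⟨ +-congʳ (+-congʳ (G-raise (r + i))) ⟨
      g +ℂ ι r *ℂ N′ +ℂ -ℂ (ι r *ℂ N′) +ℂ ι i *ℂ N₀
        ≈⟨ solve 5 (λ g i r n m → g :+ r :* n :+ :- (r :* n) :+ i :* m
                                 := g :+ (r :+ i) :* m :+ r :* m :+ :- ((r :+ r) :* m)) refl
           g (ι i) (ι r) N′ N₀ ⟩
      g +ℂ (ι r +ℂ ι i) *ℂ N₀ +ℂ ι r *ℂ N₀ +ℂ -ℂ ((ι r +ℂ ι r) *ℂ N₀)
        ≈⟨ +-congʳ (+-congʳ (+-congˡ (*-congʳ (ι-+ r i)))) ⟨
      g +ℂ ι (r + i) *ℂ N₀ +ℂ ι r *ℂ N₀ +ℂ -ℂ ((ι r +ℂ ι r) *ℂ N₀)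
        ≈⟨ +-congʳ (G-lower (r + i)) ⟩
      ι D *ℂ N₀ +ℂ -ℂ ((ι r +ℂ ι r) *ℂ N₀)
        ≈⟨ +-congʳ (*-congʳ (trans (reflexive (cong ι D≡)) (trans (ι-+ r (r + d)) (+-congˡ (ι-+ r d))))) ⟩
      (ι r +ℂ (ι r +ℂ ι d)) *ℂ N₀ +ℂ -ℂ ((ι r +ℂ ι r) *ℂ N₀)
        ≈⟨ solve 3 (λ r d n → (r :+ (r :+ d)) :* n :+ :- ((r :+ r) :* n) := d :* n) refl (ι r) (ι d) N₀ ⟩
      ι d *ℂ N₀ ∎
      where
      N′ N₀ g : ℂ
      N′ = N (suc (r + i))
      N₀ = N (r + i)
      g  = G (r + i)

-- Binomial norms

-- The recurrence of the norms with binomial coefficients in their place, written without the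
-- truncated difference of d and i. It follows from Pascal's rule by induction on d.
choose-absorb : ∀ d i → suc i ℕ.* (d choose suc i) + i ℕ.* (d choose i) ≡ d ℕ.* (d choose i)
choose-absorb zero    zero    = ≡.refl
choose-absorb zero    (suc i) = cong₂ (λ a b → suc (suc i) ℕ.* a + suc i ℕ.* b)
  (Comb.k>n⇒nCk≡0 {0} {suc (suc i)} (s≤s z≤n)) (Comb.k>n⇒nCk≡0 {0} {suc i} (s≤s z≤n)) ⟨ ≡.trans ⟩ zeros i
  where
  zeros : ∀ i → suc (suc i) ℕ.* 0 + suc i ℕ.* 0 ≡ 0
  zeros = ℕ-solver.solve-∀
choose-absorb (suc d) zero    = ≡.trans (cong (λ c → 1 ℕ.* c + 0) (Comb.nC1≡n (suc d))) (one d)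
  where
  one : ∀ d → 1 ℕ.* suc d + 0 ≡ suc d ℕ.* 1
  one = ℕ-solver.solve-∀
choose-absorb (suc d) (suc i) = pascal (d choose i) (d choose suc i) (d choose suc (suc i))
  (≡.sym (Comb.nCk+nC[k+1]≡[n+1]C[k+1] d i)) (≡.sym (Comb.nCk+nC[k+1]≡[n+1]C[k+1] d (suc i)))
  (choose-absorb d i) (choose-absorb d (suc i))
  where
  expand : ∀ i a b c → suc (suc i) ℕ.* (b + c) + suc i ℕ.* (a + b) ≡
    (suc (suc i) ℕ.* c + suc i ℕ.* b) + (suc i ℕ.* b + i ℕ.* a) + (a + b)
  expand = ℕ-solver.solve-∀
  collect : ∀ d a b → d ℕ.* b + d ℕ.* a + (a + b) ≡ suc d ℕ.* (a + b)
  collect = ℕ-solver.solve-∀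
  pascal : ∀ a b c {p q} → p ≡ a + b → q ≡ b + c →
    suc i ℕ.* b + i ℕ.* a ≡ d ℕ.* a → suc (suc i) ℕ.* c + suc i ℕ.* b ≡ d ℕ.* b →
    suc (suc i) ℕ.* q + suc i ℕ.* p ≡ suc d ℕ.* p
  pascal a b c ≡.refl ≡.refl e₀ e₁ = ≡.trans (expand i a b c)
    (≡.trans (cong₂ (λ s t → s + t + (a + b)) e₁ e₀) (collect d a b))

Σ : ℕ → (ℕ → ℂ) → ℂ
Σ zero    f = 0ℂ
Σ (suc n) f = f 0 +ℂ Σ n (f ∘ suc)

Σ-cong : ∀ n {f g} → (∀ k → f k ≈ℂ g k) → Σ n f ≈ℂ Σ n g
Σ-cong zero    p = refl
Σ-cong (suc n) p = +-cong (p 0) (Σ-cong n (p ∘ suc))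

Σ-+ : ∀ n f g → Σ n (λ k → f k +ℂ g k) ≈ℂ Σ n f +ℂ Σ n g
Σ-+ zero    f g = sym (+-identityˡ 0ℂ)
Σ-+ (suc n) f g = trans (+-congˡ (Σ-+ n (f ∘ suc) (g ∘ suc)))
  (solve 4 (λ a b c d → a :+ b :+ (c :+ d) := a :+ c :+ (b :+ d)) refl _ _ _ _)

Σ-*ʳ : ∀ n f c → Σ n (λ k → f k *ℂ c) ≈ℂ Σ n f *ℂ c
Σ-*ʳ zero    f c = sym (zeroˡ c)
Σ-*ʳ (suc n) f c = trans (+-congˡ (Σ-*ʳ n (f ∘ suc) c)) (sym (distribʳ c _ _))

Σ-0 : ∀ n {f} → (∀ k → k < n → f k ≈ℂ 0ℂ) → Σ n f ≈ℂ 0ℂ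
Σ-0 zero    p = refl
Σ-0 (suc n) p = trans (+-cong (p 0 (s≤s z≤n)) (Σ-0 n λ k k<n → p (suc k) (s≤s k<n))) (+-identityˡ 0ℂ)

Σ-split : ∀ m n f → Σ (m + n) f ≈ℂ Σ m f +ℂ Σ n (λ k → f (m + k))
Σ-split zero    n f = sym (+-identityˡ _)
Σ-split (suc m) n f = trans (+-congˡ (Σ-split m n (f ∘ suc)))
  (solve 3 (λ a b c → a :+ (b :+ c) := a :+ b :+ c) refl _ _ _)

Σ-sumX : ∀ n {D} (f : ℕ → X D → ℂ) → Σ n (λ k → sumX (f k)) ≈ℂ sumX (λ y → Σ n (λ k → f k y))
Σ-sumX zero    {D} f = sym (sumX-0 {D} (λ _ → 0ℂ) λ _ → refl)
Σ-sumX (suc n) {D} f = trans (+-congˡ (Σ-sumX n (f ∘ suc))) (sym (sumX-+ {D} _ _))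

Σ-δ : ∀ n m c → m < n → Σ n (λ k → δ m k *ℂ c) ≈ℂ c
Σ-δ (suc n) zero    c m<n       = trans (+-cong (*-identityˡ c) (Σ-0 n λ _ _ → zeroˡ c)) (+-identityʳ c)
Σ-δ (suc n) (suc m) c (s≤s m<n) = trans (+-cong (zeroˡ c) (Σ-δ n m c m<n)) (+-identityˡ c)

-- Terms beyond d are zero, so any range longer than d may be summed. The freedom in n is used in
-- the induction, where Pascal's rule produces ranges of two lengths, and for the range that occurs
-- in `mass`.
Σ-choose : ∀ d n → d < n → Σ n (λ i → ι (d choose i)) ≈ℂ ι (2 ℕ.^ d)
Σ-choose zero    (suc n) _         = trans (+-congˡ (Σ-0 n λ k _ →
  reflexive (cong ι (Comb.k>n⇒nCk≡0 {0} {suc k} (s≤s z≤n))))) (+-identityʳ _)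
Σ-choose (suc d) (suc n) (s≤s d<n) = begin
  ι (suc d choose 0) +ℂ Σ n (λ i → ι (suc d choose suc i))
    ≈⟨ +-congˡ (Σ-cong n λ i → trans
         (reflexive (cong ι (≡.sym (Comb.nCk+nC[k+1]≡[n+1]C[k+1] d i)))) (ι-+ (d choose i) (d choose suc i))) ⟩
  ι 1 +ℂ Σ n (λ i → ι (d choose i) +ℂ ι (d choose suc i))
    ≈⟨ +-congˡ (Σ-+ n _ _) ⟩
  ι 1 +ℂ (Σ n (λ i → ι (d choose i)) +ℂ Σ n (λ i → ι (d choose suc i)))
    ≈⟨ solve 3 (λ a b c → a :+ (b :+ c) := b :+ (a :+ c)) refl _ _ _ ⟩
  Σ n (λ i → ι (d choose i)) +ℂ Σ (suc n) (λ i → ι (d choose i))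
    ≈⟨ +-cong (Σ-choose d n d<n) (Σ-choose d (suc n) (ℕ.m<n⇒m<1+n d<n)) ⟩
  ι (2 ℕ.^ d) +ℂ ι (2 ℕ.^ d)
    ≈⟨ solve 1 (λ a → a :+ a := con (int (+ 2)) :* a) refl _ ⟩
  ι 2 *ℂ ι (2 ℕ.^ d)
    ≈⟨ ι-* 2 (2 ℕ.^ d) ⟨
  ι (2 ℕ.^ suc d) ∎

/-int : ∀ a n .{{_ : NonZero n}} → (a ℚ./ n) ℚ.* int (+ n) ≡ int a
/-int a (suc n) = ℚ.toℚᵘ-injective (ℚᵘ.≃-trans (ℚ.toℚᵘ-homo-* (a ℚ./ suc n) (int (+ suc n)))
  (ℚᵘ.≃-trans (ℚᵘ.*-cong (ℚ.toℚᵘ-fromℚᵘ (mkℚᵘ a n)) (ℚ.toℚᵘ-fromℚᵘ (mkℚᵘ (+ suc n) 0)))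
  (ℚᵘ.≃-trans (*≡* (≡.trans (ℤ.*-identityʳ _) (cong (λ m → a ℤ.* + suc m) (≡.sym (ℕ.*-identityʳ n)))))
    (ℚᵘ.≃-sym (ℚ.toℚᵘ-fromℚᵘ (mkℚᵘ a 0))))))

binomial·2⁻-ι : ∀ d i → binomial·2⁻ d i *ℂ ι (2 ℕ.^ d) ≈ℂ ι (d choose i)
binomial·2⁻-ι d i = trans (sym (rational-* _ (int (+ (2 ℕ.^ d)))))
  (reflexive (cong rational (/-int (+ (d choose i)) (2 ℕ.^ d) {{ℕ.m^n≢0 2 d}})))

‖‖²-Σ : ∀ {D} (v : V D) → ‖ v ‖² ≈ℂ Σ (suc D) (λ k → ⟨ π k v , π k v ⟩)
‖‖²-Σ {D} v = sym (begin
  Σ (suc D) (λ k → ⟨ π k v , π k v ⟩)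
    ≈⟨ Σ-sumX (suc D) (λ k y → π k v y *ℂ conj (π k v y)) ⟩
  sumX (λ y → Σ (suc D) (λ k → π k v y *ℂ conj (π k v y)))
    ≈⟨ sumX-cong (λ y → Σ-cong (suc D) λ k → square (does (wt y ℕ.≟ k)) (v y)) ⟩
  sumX (λ y → Σ (suc D) (λ k → δ (wt y) k *ℂ (v y *ℂ conj (v y))))
    ≈⟨ sumX-cong (λ y → Σ-δ (suc D) (wt y) _ (s≤s (wt≤D y))) ⟩
  ‖ v ‖² ∎)
  where
  square : ∀ b z → let t = if b then 1ℂ else 0ℂ in (t *ℂ z) *ℂ conj (t *ℂ z) ≈ℂ t *ℂ (z *ℂ conj z)
  square true  z = trans (*-cong (*-identityˡ z) (conj-cong (*-identityˡ z))) (sym (*-identityˡ _))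
  square false z = trans (*-congʳ (zeroˡ z)) (trans (zeroˡ _) (sym (zeroˡ _)))

π-orthogonal : ∀ {D} i j (v w : V D) → i ≢ j → ⟨ π i v , π j w ⟩ ≈ℂ 0ℂ
π-orthogonal i j v w i≢j = sumX-0 _ λ y → case y (wt y ℕ.≟ i)
  where
  case : ∀ y → Dec (wt y ≡ i) → π i v y *ℂ conj (π j w y) ≈ℂ 0ℂ
  case y (yes y≡i) = trans
    (*-congˡ (trans (conj-cong (π-off j w y λ y≡j → i≢j (≡.trans (≡.sym y≡i) y≡j))) (conj-rational 0ℚ)))
    (zeroʳ _)
  case y (no y≢i) = trans (*-congʳ (π-off i v y y≢i)) (zeroˡ _)

-- The family Y is left open so that one formula covers `π`, `E*`, `E` and `Eᵋ` and can be carried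
-- from one to another by P.
NormFormula : ∀ {D} → (ℕ → V D → V D) → ℕ → ℕ → V D → Set
NormFormula Y r d v = ∀ i j → ⟨ Y (r + i) v , Y (r + j) v ⟩ ≈ℂ δ i j *ℂ binomial·2⁻ d i *ℂ ‖ v ‖²

π-norms : ∀ {D} α β → conj α ≈ℂ β → conj β ≈ℂ α → ∀ r d → D ≡ r + (r + d) →
  (v : V D) → Extremal (up α) (down β) r v → NormFormula π r d v
π-norms {D} α β conj-α conj-β r d D≡ v ext i j with i ℕ.≟ j
... | no i≢j = trans (π-orthogonal (r + i) (r + j) v v (i≢j ∘ ℕ.+-cancelˡ-≡ r i j))
  (sym (trans (*-congʳ (trans (*-congʳ (reflexive (δ-≢ i≢j))) (zeroˡ _))) (zeroˡ _)))
... | yes ≡.refl = begin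
  M i
    ≈⟨ binomial i ⟩
  ι (d choose i) *ℂ M 0
    ≈⟨ *-congʳ (binomial·2⁻-ι d i) ⟨
  binomial·2⁻ d i *ℂ ι (2 ℕ.^ d) *ℂ M 0
    ≈⟨ solve 3 (λ a b c → a :* b :* c := con 1ℚ :* a :* (b :* c)) refl _ _ _ ⟩
  1ℂ *ℂ binomial·2⁻ d i *ℂ (ι (2 ℕ.^ d) *ℂ M 0)
    ≈⟨ *-cong (*-congʳ (reflexive (≡.sym (δ-≡ i)))) (sym mass) ⟩
  δ i i *ℂ binomial·2⁻ d i *ℂ ‖ v ‖² ∎
  where
  open Strings α β r v ext
  M : ℕ → ℂ
  M i = N conj-α conj-β d D≡ (r + i)
  binomial : ∀ i → M i ≈ℂ ι (d choose i) *ℂ M 0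
  binomial zero    = sym (*-identityˡ (M 0))
  binomial (suc i) = ι-cancel i (begin
    ι (suc i) *ℂ M (suc i)
      ≈⟨ solve 3 (λ s a b → s :* a := s :* a :+ b :+ :- b) refl _ _ (ι i *ℂ M i) ⟩
    ι (suc i) *ℂ M (suc i) +ℂ ι i *ℂ M i +ℂ -ℂ (ι i *ℂ M i)
      ≈⟨ +-congʳ (recurrence conj-α conj-β d D≡ i) ⟩
    ι d *ℂ M i +ℂ -ℂ (ι i *ℂ M i)
      ≈⟨ +-cong (*-congˡ (binomial i)) (-‿cong (*-congˡ (binomial i))) ⟩
    ι d *ℂ (ι (d choose i) *ℂ M 0) +ℂ -ℂ (ι i *ℂ (ι (d choose i) *ℂ M 0))
      ≈⟨ solve 4 (λ d c m i → d :* (c :* m) :+ :- (i :* (c :* m)) := (d :* c) :* m :+ :- (i :* c :* m)) refl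
         (ι d) _ (M 0) (ι i) ⟩
    (ι d *ℂ ι (d choose i)) *ℂ M 0 +ℂ -ℂ (ι i *ℂ ι (d choose i) *ℂ M 0)
      ≈⟨ +-congʳ (*-congʳ absorb) ⟨
    (ι (suc i) *ℂ ι (d choose suc i) +ℂ ι i *ℂ ι (d choose i)) *ℂ M 0 +ℂ -ℂ (ι i *ℂ ι (d choose i) *ℂ M 0)
      ≈⟨ solve 4 (λ s c e m → (s :* c :+ e) :* m :+ :- (e :* m) := s :* (c :* m)) refl
         (ι (suc i)) _ (ι i *ℂ ι (d choose i)) (M 0) ⟩
    ι (suc i) *ℂ (ι (d choose suc i) *ℂ M 0) ∎)
    where
    absorb : ι (suc i) *ℂ ι (d choose suc i) +ℂ ι i *ℂ ι (d choose i) ≈ℂ ι d *ℂ ι (d choose i)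
    absorb = begin
      ι (suc i) *ℂ ι (d choose suc i) +ℂ ι i *ℂ ι (d choose i)
        ≈⟨ +-cong (ι-* (suc i) (d choose suc i)) (ι-* i (d choose i)) ⟨
      ι (suc i ℕ.* (d choose suc i)) +ℂ ι (i ℕ.* (d choose i))
        ≈⟨ ι-+ (suc i ℕ.* (d choose suc i)) (i ℕ.* (d choose i)) ⟨
      ι (suc i ℕ.* (d choose suc i) + i ℕ.* (d choose i))
        ≡⟨ cong ι (choose-absorb d i) ⟩
      ι (d ℕ.* (d choose i))
        ≈⟨ ι-* d (d choose i) ⟩
      ι d *ℂ ι (d choose i) ∎
  mass : ‖ v ‖² ≈ℂ ι (2 ℕ.^ d) *ℂ M 0
  mass = begin
    ‖ v ‖²
      ≈⟨ ‖‖²-Σ v ⟩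
    Σ (suc D) (λ k → ⟨ π k v , π k v ⟩)
      -- The D + 1 weights are cut at r: the first r components vanish, and the other r + d + 1
      -- carry the binomial coefficients, which are zero beyond index d.
      ≡⟨ cong (λ n → Σ n (λ k → ⟨ π k v , π k v ⟩)) (≡.trans (cong suc D≡) (≡.sym (ℕ.+-suc r (r + d)))) ⟩
    Σ (r + suc (r + d)) (λ k → ⟨ π k v , π k v ⟩)
      ≈⟨ Σ-split r (suc (r + d)) _ ⟩
    Σ r (λ k → ⟨ π k v , π k v ⟩) +ℂ Σ (suc (r + d)) M
      ≈⟨ +-cong (Σ-0 r λ k k<r → sumX-0 {D} _ λ y → trans (*-congʳ (below k k<r y)) (zeroˡ _))
                (Σ-cong (suc (r + d)) binomial) ⟩
    0ℂ +ℂ Σ (suc (r + d)) (λ i → ι (d choose i) *ℂ M 0)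
      ≈⟨ trans (+-identityˡ _) (Σ-*ʳ (suc (r + d)) (λ i → ι (d choose i)) (M 0)) ⟩
    Σ (suc (r + d)) (λ i → ι (d choose i)) *ℂ M 0
      ≈⟨ *-congʳ (Σ-choose d (suc (r + d)) (s≤s (ℕ.m≤n+m d r))) ⟩
    ι (2 ℕ.^ d) *ℂ M 0 ∎

-- The primitive idempotents

int-injective : ∀ a b → int a ≡ int b → a ≡ b
int-injective a b p with ℚ./-injective-≃ (mkℚᵘ a 0) (mkℚᵘ b 0) p
... | *≡* q = ≡.trans (≡.sym (ℤ.*-identityʳ a)) (≡.trans q (ℤ.*-identityʳ b))

θ-injective : ∀ D i j → θ D i ≡ θ D j → i ≡ j
θ-injective D i j p = ℕ.*-cancelˡ-≡ i j 2 (ℤ.+-injective (ℤ.neg-injective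
  (Group.∙-cancelˡ (AbelianGroup.group ℤ.+-0-abelianGroup) (+ D) _ _
    (int-injective (+ D ℤ.- + (2 ℕ.* i)) (+ D ℤ.- + (2 ℕ.* j)) p))))

reciprocal-inverse : ∀ q → q ≢ 0ℚ → reciprocal q ℚ.* q ≡ 1ℚ
reciprocal-inverse q q≢0 with q ℚ.≟ 0ℚ
... | yes q≡0 = contradiction q≡0 q≢0
... | no q≢0′ = ℚ.*-inverseˡ q {{ℚ.≢-nonZero q≢0′}}

nodes : ℕ → ℕ → List ℕ
nodes D i = List.filter (λ j → ¬? (j ℕ.≟ i)) (List.upTo (suc D))

Lagrange : ∀ {D} → ℕ → List ℕ → Mat D
Lagrange i l = List.foldr _·ᴹ_ 1ᴹ (List.map (factor i) l)

-- The polynomial that `Lagrange` evaluates at A, evaluated at the scalar θ_m instead.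
lagrange : ℕ → ℕ → List ℕ → ℕ → ℂ
lagrange D i []      m = 1ℂ
lagrange D i (j ∷ l) m =
  rational (reciprocal (θ D i ℚ.- θ D j)) *ℂ (rational (θ D m) +ℂ rational (ℚ.- θ D j)) *ℂ lagrange D i l m

lagrange-self : ∀ D i l → All (_≢ i) l → lagrange D i l i ≈ℂ 1ℂ
lagrange-self D i []      []        = refl
lagrange-self D i (j ∷ l) (j≢i ∷ p) = trans (*-cong unit (lagrange-self D i l p)) (*-identityˡ 1ℂ)
  where
  q : ℚ
  q = θ D i ℚ.- θ D j
  q≢0 : q ≢ 0ℚ
  q≢0 q≡0 = j≢i (≡.sym (θ-injective D i j (≡.trans (≡.sym (recombine (θ D i) (θ D j)))
    (≡.trans (cong (ℚ._+ θ D j) q≡0) (ℚ.+-identityˡ (θ D j))))))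
    where
    recombine : ∀ a b → (a ℚ.- b) ℚ.+ b ≡ a
    recombine = solve-∀ ℚ-ring
  unit : rational (reciprocal q) *ℂ (rational (θ D i) +ℂ rational (ℚ.- θ D j)) ≈ℂ 1ℂ
  unit = trans (*-congˡ (≡⇒≈ℂ (λ _ → ≡.refl) (λ _ → ≡.refl)))
    (trans (sym (rational-* (reciprocal q) q)) (reflexive (cong rational (reciprocal-inverse q q≢0))))

lagrange-root : ∀ D i l m → m ∈ˡ l → lagrange D i l m ≈ℂ 0ℂ
lagrange-root D i (j ∷ l) m (here ≡.refl) = trans (*-congʳ (trans (*-congˡ zero-factor) (zeroʳ _))) (zeroˡ _)
  where
  zero-factor : rational (θ D m) +ℂ rational (ℚ.- θ D m) ≈ℂ 0ℂ
  zero-factor = ≡⇒≈ℂ (λ _ → ℚ.+-inverseʳ (θ D m)) (λ _ → ≡.refl)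
lagrange-root D i (j ∷ l) m (there m∈l) = trans (*-congˡ (lagrange-root D i l m m∈l)) (zeroʳ _)

lagrange-δ : ∀ D i m → m ≤ D → lagrange D i (nodes D i) m ≈ℂ δ m i
lagrange-δ D i m m≤D with m ℕ.≟ i
... | yes ≡.refl = trans (lagrange-self D i (nodes D i) (All.all-filter (λ j → ¬? (j ℕ.≟ i)) (List.upTo (suc D))))
  (reflexive (≡.sym (δ-≡ i)))
... | no m≢i     = trans
  (lagrange-root D i (nodes D i) m (∈-filter⁺ (λ j → ¬? (j ℕ.≟ i)) (∈-upTo⁺ (s≤s m≤D)) m≢i))
  (reflexive (≡.sym (δ-≢ m≢i)))

factor-·ⱽ : ∀ {D} i j (v : V D) →
  factor i j ·ⱽ v ≈ⱽ rational (reciprocal (θ D i ℚ.- θ D j)) •ⱽ (A ·ⱽ v +ⱽ rational (ℚ.- θ D j) •ⱽ v)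
factor-·ⱽ {D} i j v y = begin
  sumX (λ z → c *ℂ (A y z +ℂ t *ℂ 1ᴹ y z) *ℂ v z)
    ≈⟨ sumX-cong (λ z → solve 5 (λ c a t o v → c :* (a :+ t :* o) :* v := c :* (a :* v :+ t :* (o :* v))) refl
         c (A y z) t (1ᴹ y z) (v z)) ⟩
  sumX (λ z → c *ℂ (A y z *ℂ v z +ℂ t *ℂ (1ᴹ y z *ℂ v z)))
    ≈⟨ trans (sumX-*ˡ {D} c _) (*-congˡ (sumX-+ {D} _ _)) ⟩
  c *ℂ ((A ·ⱽ v) y +ℂ sumX (λ z → t *ℂ (1ᴹ y z *ℂ v z)))
    ≈⟨ *-congˡ (+-congˡ (trans (sumX-*ˡ {D} t _) (*-congˡ (1ᴹ-·ⱽ v y)))) ⟩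
  c *ℂ ((A ·ⱽ v) y +ℂ t *ℂ v y) ∎
  where
  c t : ℂ
  c = rational (reciprocal (θ D i ℚ.- θ D j))
  t = rational (ℚ.- θ D j)

P-A : ∀ {D} (v : V D) → P ·ⱽ (A ·ⱽ v) ≈ⱽ mask (λ m → rational (θ D m)) (P ·ⱽ v)
P-A {D} v y = begin
  (P ·ⱽ (A ·ⱽ v)) y                    ≈⟨ ·ⱽ-cong P (A-dΓ v) y ⟩
  (P ·ⱽ dΓ Xₘ v) y                     ≈⟨ dΓ-⊗ P₁ ZP≈PX v y ⟨
  dΓ Zₘ (P ·ⱽ v) y                     ≈⟨ A*-dΓ (P ·ⱽ v) y ⟨
  (A* ·ⱽ (P ·ⱽ v)) y                   ≈⟨ diagonal-·ⱽ (rational (θ D (wt y))) y (P ·ⱽ v) ⟩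
  rational (θ D (wt y)) *ℂ (P ·ⱽ v) y  ∎
  where
  ZP≈PX : Zₘ ·² P₁ ≈² P₁ ·² Xₘ
  ZP≈PX = ≈²-entries
    (≡⇒≈ℂ (λ _ → ≡.refl) (λ _ → ≡.refl)) (≡⇒≈ℂ (λ _ → ≡.refl) (λ _ → ≡.refl))
    (≡⇒≈ℂ (λ _ → ≡.refl) (λ _ → ≡.refl)) (≡⇒≈ℂ (λ _ → ≡.refl) (λ _ → ≡.refl))

P-Lagrange : ∀ {D} i l (v : V D) → P ·ⱽ (Lagrange i l ·ⱽ v) ≈ⱽ mask (lagrange D i l) (P ·ⱽ v)
P-Lagrange     i []      v y = trans (·ⱽ-cong P (1ᴹ-·ⱽ v) y) (sym (*-identityˡ _))
P-Lagrange {D} i (j ∷ l) v y = begin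
  (P ·ⱽ (Lagrange i (j ∷ l) ·ⱽ v)) y
    ≈⟨ ·ⱽ-cong P (λ z → trans (·ᴹ-·ⱽ (factor i j) (Lagrange i l) v z) (factor-·ⱽ i j u z)) y ⟩
  (P ·ⱽ (c •ⱽ (A ·ⱽ u +ⱽ t •ⱽ u))) y
    ≈⟨ trans (·ⱽ-• P c (A ·ⱽ u +ⱽ t •ⱽ u) y) (*-congˡ (·ⱽ-+ P (A ·ⱽ u) (t •ⱽ u) y)) ⟩
  c *ℂ ((P ·ⱽ (A ·ⱽ u)) y +ℂ (P ·ⱽ (t •ⱽ u)) y)
    ≈⟨ *-congˡ (+-cong (P-A u y) (·ⱽ-• P t u y)) ⟩
  c *ℂ (rational (θ D (wt y)) *ℂ (P ·ⱽ u) y +ℂ t *ℂ (P ·ⱽ u) y)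
    ≈⟨ *-congˡ (distribʳ _ _ _) ⟨
  c *ℂ ((rational (θ D (wt y)) +ℂ t) *ℂ (P ·ⱽ u) y)
    ≈⟨ *-congˡ (*-congˡ (P-Lagrange i l v y)) ⟩
  c *ℂ ((rational (θ D (wt y)) +ℂ t) *ℂ (lagrange D i l (wt y) *ℂ (P ·ⱽ v) y))
    ≈⟨ solve 4 (λ c s l p → c :* (s :* (l :* p)) := c :* s :* l :* p) refl c _ _ _ ⟩
  c *ℂ (rational (θ D (wt y)) +ℂ t) *ℂ lagrange D i l (wt y) *ℂ (P ·ⱽ v) y ∎
  where
  c t : ℂ
  c = rational (reciprocal (θ D i ℚ.- θ D j))
  t = rational (ℚ.- θ D j)
  u : V D
  u = Lagrange i l ·ⱽ v

-- P intertwines A with the diagonal matrix A*. The Lagrange product in A becomes the same product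
-- in A*, whose entry at weight m is the polynomial at θ_m, that is 1 for m = k and 0 at the other
-- nodes.
P-E : ∀ {D} k (v : V D) → P ·ⱽ (E k ·ⱽ v) ≈ⱽ π k (P ·ⱽ v)
P-E {D} k v y = trans (P-Lagrange k (nodes D k) v y) (*-congʳ (lagrange-δ D k (wt y) (wt≤D y)))

P-P⁻¹ : ∀ {D} (v : V D) → P ·ⱽ (P⁻¹ ·ⱽ v) ≈ⱽ v
P-P⁻¹ v y = trans (sym (·ᴹ-·ⱽ P P⁻¹ v y)) (trans (·ⱽ-congᴮ v PP⁻¹≈1 y) (1ᴹ-·ⱽ v y))

P⁻¹-P : ∀ {D} (v : V D) → P⁻¹ ·ⱽ (P ·ⱽ v) ≈ⱽ v
P⁻¹-P v y = trans (sym (·ᴹ-·ⱽ P⁻¹ P v y)) (trans (·ⱽ-congᴮ v P⁻¹P≈1 y) (1ᴹ-·ⱽ v y))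

P-injective : ∀ {D} {v w : V D} → P ·ⱽ v ≈ⱽ P ·ⱽ w → v ≈ⱽ w
P-injective {v = v} {w} p y = trans (sym (P⁻¹-P v y)) (trans (·ⱽ-cong P⁻¹ p y) (P⁻¹-P w y))

Eᵋ-·ⱽ : ∀ {D} k (v : V D) → Eᵋ k ·ⱽ v ≈ⱽ P⁻¹ ·ⱽ (E k ·ⱽ (P ·ⱽ v))
Eᵋ-·ⱽ k v y = trans (·ᴹ-·ⱽ (P⁻¹ ·ᴹ E k) P v y) (·ᴹ-·ⱽ P⁻¹ (E k) (P ·ⱽ v) y)

P-Eᵋ : ∀ {D} k (v : V D) → P ·ⱽ (Eᵋ k ·ⱽ v) ≈ⱽ E k ·ⱽ (P ·ⱽ v)
P-Eᵋ k v y = trans (·ⱽ-cong P (Eᵋ-·ⱽ k v) y) (P-P⁻¹ (E k ·ⱽ (P ·ⱽ v)) y)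

E*-norms : ∀ {D} r d (v : V D) → NormFormula π r d v → NormFormula (λ k → E* k ·ⱽ_) r d v
E*-norms r d v p i j = trans (⟨⟩-cong (E*-π (r + i) v) (E*-π (r + j) v)) (p i j)

-- P multiplies both sides of the formula by the same 2^D, which is then cancelled.
rotate-norms : ∀ {D} {Y Y′ : ℕ → V D → V D} → (∀ k v → P ·ⱽ Y′ k v ≈ⱽ Y k (P ·ⱽ v)) →
  ∀ r d v → NormFormula Y r d (P ·ⱽ v) → NormFormula Y′ r d v
rotate-norms {D} {Y} {Y′} PY′≈YP r d v p i j = rational-cancel (int (+ (2 ℕ.^ D))) 2^D≢0 (begin
  ι (2 ℕ.^ D) *ℂ ⟨ Y′ (r + i) v , Y′ (r + j) v ⟩
    ≈⟨ P-scaling (Y′ (r + i) v) (Y′ (r + j) v) ⟨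
  ⟨ P ·ⱽ Y′ (r + i) v , P ·ⱽ Y′ (r + j) v ⟩
    ≈⟨ ⟨⟩-cong (PY′≈YP (r + i) v) (PY′≈YP (r + j) v) ⟩
  ⟨ Y (r + i) (P ·ⱽ v) , Y (r + j) (P ·ⱽ v) ⟩
    ≈⟨ p i j ⟩
  δ i j *ℂ binomial·2⁻ d i *ℂ ‖ P ·ⱽ v ‖²
    ≈⟨ *-congˡ (P-scaling v v) ⟩
  δ i j *ℂ binomial·2⁻ d i *ℂ (ι (2 ℕ.^ D) *ℂ ‖ v ‖²)
    ≈⟨ solve 3 (λ a s n → a :* (s :* n) := s :* (a :* n)) refl _ _ _ ⟩
  ι (2 ℕ.^ D) *ℂ (δ i j *ℂ binomial·2⁻ d i *ℂ ‖ v ‖²) ∎)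
  where
  2^D≢0 : int (+ (2 ℕ.^ D)) ≢ 0ℚ
  2^D≢0 q = ℕ.≢-nonZero⁻¹ (2 ℕ.^ D) {{ℕ.m^n≢0 2 D}} (ℤ.+-injective (int-injective (+ (2 ℕ.^ D)) (+ 0) q))

-- Rotation by P

-- Coefficients with sum one keep the eigenvalue r, so every point of the affine line through B and
-- C inherits the eigenvalue equation.
dΓ-eigen-combine : ∀ {β γ B C} → β +ℂ γ ≈ℂ 1ℂ → ∀ {D} r {v : V D} → Extremal B C r v →
  dΓ (λ a b → β *ℂ B a b +ℂ γ *ℂ C a b) v ≈ⱽ ι r •ⱽ v
dΓ-eigen-combine {β} {γ} {B} {C} β+γ≈1 r {v} (p , q) y = begin
  dΓ (λ a b → β *ℂ B a b +ℂ γ *ℂ C a b) v y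
    ≈⟨ dΓ-combine β B γ C v y ⟩
  β *ℂ dΓ B v y +ℂ γ *ℂ dΓ C v y
    ≈⟨ +-cong (*-congˡ (p y)) (*-congˡ (q y)) ⟩
  β *ℂ (ι r *ℂ v y) +ℂ γ *ℂ (ι r *ℂ v y)
    ≈⟨ distribʳ _ β γ ⟨
  (β +ℂ γ) *ℂ (ι r *ℂ v y)
    ≈⟨ trans (*-congʳ β+γ≈1) (*-identityˡ _) ⟩
  ι r *ℂ v y ∎

-- Conjugation by P₁ sends B′ to a point of the affine line through B and C, though not necessarily
-- to B or C; β and γ are its coordinates there.
pull-eigen : ∀ β γ {B C B′} → β +ℂ γ ≈ℂ 1ℂ →
  (λ a b → β *ℂ B a b +ℂ γ *ℂ C a b) ·² P₁ ≈² P₁ ·² B′ →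
  ∀ {D} r {v : V D} → Extremal B C r (P ·ⱽ v) → dΓ B′ v ≈ⱽ ι r •ⱽ v
pull-eigen β γ {B} {C} {B′} β+γ≈1 intertwine r {v} ext = P-injective λ y → begin
  (P ·ⱽ dΓ B′ v) y                                        ≈⟨ dΓ-⊗ P₁ intertwine v y ⟨
  dΓ (λ a b → β *ℂ B a b +ℂ γ *ℂ C a b) (P ·ⱽ v) y  ≈⟨ dΓ-eigen-combine β+γ≈1 r ext y ⟩
  ι r *ℂ (P ·ⱽ v) y                                        ≈⟨ ·ⱽ-• P (ι r) v y ⟨
  (P ·ⱽ (ι r •ⱽ v)) y                                      ∎

push-eigen : ∀ β γ {B C B′} → β +ℂ γ ≈ℂ 1ℂ →
  B′ ·² P₁ ≈² P₁ ·² (λ a b → β *ℂ B a b +ℂ γ *ℂ C a b) →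
  ∀ {D} r {v : V D} → Extremal B C r v → dΓ B′ (P ·ⱽ v) ≈ⱽ ι r •ⱽ P ·ⱽ v
push-eigen β γ {B} {C} {B′} β+γ≈1 intertwine r {v} ext y = begin
  dΓ B′ (P ·ⱽ v) y                                              ≈⟨ dΓ-⊗ P₁ intertwine v y ⟩
  (P ·ⱽ dΓ (λ a b → β *ℂ B a b +ℂ γ *ℂ C a b) v) y        ≈⟨ ·ⱽ-cong P (dΓ-eigen-combine β+γ≈1 r ext) y ⟩
  (P ·ⱽ (ι r •ⱽ v)) y                                            ≈⟨ ·ⱽ-• P (ι r) v y ⟩
  ι r *ℂ (P ·ⱽ v) y                                              ∎

-- Extremal vectors for A*, A and Aᵋ respectively; P permutes the three kinds cyclically.
Extremal* Extremal₀ Extremalᵋ : ∀ {D} → ℕ → V D → Set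
Extremal* = Extremal (mat₂ 0ℂ (-ℂ 1ℂ) 0ℂ 1ℂ) (mat₂ 0ℂ 1ℂ 0ℂ 1ℂ)
Extremal₀ = Extremal (up 1ℂ) (down 1ℂ)
Extremalᵋ = Extremal (up (-ℂ 𝐢)) (down 𝐢)

-- Fixed by ρ + ρ̄ = 1 and ρ - ρ̄ = 𝐢. For instance, P₁ conjugates `up 1ℂ` into N - 𝐢 lower, which
-- is ρ (N - lower) + ρ̄ (N + lower).
ρ ρ̄ : ℂ
ρ = rational ½ *ℂ (1ℂ +ℂ 𝐢)
ρ̄ = rational ½ *ℂ (1ℂ +ℂ -ℂ 𝐢)

ρ+ρ̄ : ρ +ℂ ρ̄ ≈ℂ 1ℂ
ρ+ρ̄ = ≡⇒≈ℂ (λ _ → ≡.refl) (λ _ → ≡.refl)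

ρ̄+ρ : ρ̄ +ℂ ρ ≈ℂ 1ℂ
ρ̄+ρ = ≡⇒≈ℂ (λ _ → ≡.refl) (λ _ → ≡.refl)

pull*₀ : ∀ {D} r (v : V D) → Extremal* r (P ·ⱽ v) → Extremal₀ r v
pull*₀ r v ext =
  pull-eigen ρ ρ̄ ρ+ρ̄ (≈²-entries (≡⇒≈ℂ (λ _ → ≡.refl) (λ _ → ≡.refl)) (≡⇒≈ℂ (λ _ → ≡.refl) (λ _ → ≡.refl))
    (≡⇒≈ℂ (λ _ → ≡.refl) (λ _ → ≡.refl)) (≡⇒≈ℂ (λ _ → ≡.refl) (λ _ → ≡.refl))) r ext ,
  pull-eigen ρ̄ ρ ρ̄+ρ (≈²-entries (≡⇒≈ℂ (λ _ → ≡.refl) (λ _ → ≡.refl)) (≡⇒≈ℂ (λ _ → ≡.refl) (λ _ → ≡.refl))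
    (≡⇒≈ℂ (λ _ → ≡.refl) (λ _ → ≡.refl)) (≡⇒≈ℂ (λ _ → ≡.refl) (λ _ → ≡.refl))) r ext

pull₀ᵋ : ∀ {D} r (v : V D) → Extremal₀ r (P ·ⱽ v) → Extremalᵋ r v
pull₀ᵋ r v ext =
  pull-eigen ρ̄ ρ ρ̄+ρ (≈²-entries (≡⇒≈ℂ (λ _ → ≡.refl) (λ _ → ≡.refl)) (≡⇒≈ℂ (λ _ → ≡.refl) (λ _ → ≡.refl))
    (≡⇒≈ℂ (λ _ → ≡.refl) (λ _ → ≡.refl)) (≡⇒≈ℂ (λ _ → ≡.refl) (λ _ → ≡.refl))) r ext ,
  pull-eigen ρ ρ̄ ρ+ρ̄ (≈²-entries (≡⇒≈ℂ (λ _ → ≡.refl) (λ _ → ≡.refl)) (≡⇒≈ℂ (λ _ → ≡.refl) (λ _ → ≡.refl))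
    (≡⇒≈ℂ (λ _ → ≡.refl) (λ _ → ≡.refl)) (≡⇒≈ℂ (λ _ → ≡.refl) (λ _ → ≡.refl))) r ext

push*ᵋ : ∀ {D} r (v : V D) → Extremal* r v → Extremalᵋ r (P ·ⱽ v)
push*ᵋ r v ext =
  -- P₁ takes the two idempotents chosen for A* exactly to those chosen for Aᵋ, so the coordinates
  -- are trivial.
  push-eigen 1ℂ 0ℂ (≡⇒≈ℂ (λ _ → ≡.refl) (λ _ → ≡.refl))
    (≈²-entries (≡⇒≈ℂ (λ _ → ≡.refl) (λ _ → ≡.refl)) (≡⇒≈ℂ (λ _ → ≡.refl) (λ _ → ≡.refl))
    (≡⇒≈ℂ (λ _ → ≡.refl) (λ _ → ≡.refl)) (≡⇒≈ℂ (λ _ → ≡.refl) (λ _ → ≡.refl))) r ext ,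
  push-eigen 0ℂ 1ℂ (≡⇒≈ℂ (λ _ → ≡.refl) (λ _ → ≡.refl))
    (≈²-entries (≡⇒≈ℂ (λ _ → ≡.refl) (λ _ → ≡.refl)) (≡⇒≈ℂ (λ _ → ≡.refl) (λ _ → ≡.refl))
    (≡⇒≈ℂ (λ _ → ≡.refl) (λ _ → ≡.refl)) (≡⇒≈ℂ (λ _ → ≡.refl) (λ _ → ≡.refl))) r ext

pushᵋ₀ : ∀ {D} r (v : V D) → Extremalᵋ r v → Extremal₀ r (P ·ⱽ v)
pushᵋ₀ r v ext =
  push-eigen ρ ρ̄ ρ+ρ̄ (≈²-entries (≡⇒≈ℂ (λ _ → ≡.refl) (λ _ → ≡.refl)) (≡⇒≈ℂ (λ _ → ≡.refl) (λ _ → ≡.refl))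
    (≡⇒≈ℂ (λ _ → ≡.refl) (λ _ → ≡.refl)) (≡⇒≈ℂ (λ _ → ≡.refl) (λ _ → ≡.refl))) r ext ,
  push-eigen ρ̄ ρ ρ̄+ρ (≈²-entries (≡⇒≈ℂ (λ _ → ≡.refl) (λ _ → ≡.refl)) (≡⇒≈ℂ (λ _ → ≡.refl) (λ _ → ≡.refl))
    (≡⇒≈ℂ (λ _ → ≡.refl) (λ _ → ≡.refl)) (≡⇒≈ℂ (λ _ → ≡.refl) (λ _ → ≡.refl))) r ext

E*-norms₀ : ∀ {D} r d → D ≡ r + (r + d) → (v : V D) → Extremal₀ r v → NormFormula (λ k → E* k ·ⱽ_) r d v
E*-norms₀ r d D≡ v ext = E*-norms r d v
  (π-norms 1ℂ 1ℂ (conj-rational 1ℚ) (conj-rational 1ℚ) r d D≡ v ext)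

E*-normsᵋ : ∀ {D} r d → D ≡ r + (r + d) → (v : V D) → Extremalᵋ r v → NormFormula (λ k → E* k ·ⱽ_) r d v
E*-normsᵋ r d D≡ v ext = E*-norms r d v (π-norms (-ℂ 𝐢) 𝐢
  (≡⇒≈ℂ (λ _ → ≡.refl) (λ _ → ≡.refl)) (≡⇒≈ℂ (λ _ → ≡.refl) (λ _ → ≡.refl)) r d D≡ v ext)

E-norms : ∀ {D} r d (v : V D) → NormFormula (λ k → E* k ·ⱽ_) r d (P ·ⱽ v) → NormFormula (λ k → E k ·ⱽ_) r d v
E-norms r d v = rotate-norms {Y = λ k → E* k ·ⱽ_} (λ k v y → trans (P-E k v y) (sym (E*-π k (P ·ⱽ v) y))) r d v

-- Two rotations: P takes Eᵋ-components to E-components, and P again takes these to E*-components.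
Eᵋ-norms : ∀ {D} r d (v : V D) → NormFormula (λ k → E* k ·ⱽ_) r d (P ·ⱽ (P ·ⱽ v)) → NormFormula (λ k → Eᵋ k ·ⱽ_) r d v
Eᵋ-norms r d v p = rotate-norms {Y = λ k → E k ·ⱽ_} P-Eᵋ r d v (E-norms r d (P ·ⱽ v) p)

-- Strings generated from a vector killed by y in an sl₂-triple

iterate : ∀ {D} → 𝕄₂ → ℕ → V D → V D
iterate B zero    v = v
iterate B (suc n) v = dΓ B (iterate B n v)

-- The direction is left open: x lowers and h = -Z when the string starts at the top of the support,
-- x raises and h = Z when it starts at the bottom.
module WeightString {D : ℕ} (x y h : 𝕄₂)
  (yx : ∀ a b → (y ·² x) a b ≈ℂ (x ·² y) a b +ℂ h a b)
  (hx : ∀ a b → (h ·² x) a b ≈ℂ (x ·² h) a b +ℂ -ℂ ι 2 *ℂ x a b)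
  (λ₀ : ℂ) (v : V D) (yv≈0 : dΓ y v ≈ⱽ 0ⱽ) (hv≈λv : dΓ h v ≈ⱽ λ₀ •ⱽ v) where

  w : ℕ → V D
  w j = iterate x j v

  weight : ∀ j → dΓ h (w j) ≈ⱽ (λ₀ +ℂ -ℂ (ι 2 *ℂ ι j)) •ⱽ w j
  weight zero    z = trans (hv≈λv z) (solve 2 (λ l v → l :* v
    := (l :+ :- (con (int (+ 2)) :* con 0ℚ)) :* v) refl λ₀ (v z))
  weight (suc j) z = begin
    dΓ h (dΓ x (w j)) z
      ≈⟨ dΓ-commutator hx (w j) z ⟩
    dΓ x (dΓ h (w j)) z +ℂ dΓ (λ a b → -ℂ ι 2 *ℂ x a b) (w j) z
      ≈⟨ +-cong (trans (dΓ-cong x (weight j) z) (dΓ-• x _ (w j) z)) scaled ⟩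
    (λ₀ +ℂ -ℂ (ι 2 *ℂ ι j)) *ℂ w (suc j) z +ℂ -ℂ ι 2 *ℂ w (suc j) z
      ≈⟨ solve 3 (λ l n v → (l :+ :- (con (int (+ 2)) :* n)) :* v :+ :- con (int (+ 2)) :* v
           := (l :+ :- (con (int (+ 2)) :* (con 1ℚ :+ n))) :* v) refl λ₀ (ι j) (w (suc j) z) ⟩
    (λ₀ +ℂ -ℂ (ι 2 *ℂ (1ℂ +ℂ ι j))) *ℂ w (suc j) z
      ≈⟨ *-congʳ (+-congˡ (-‿cong (*-congˡ (ι-suc j)))) ⟨
    (λ₀ +ℂ -ℂ (ι 2 *ℂ ι (suc j))) *ℂ w (suc j) z ∎
    where
    scaled : dΓ (λ a b → -ℂ ι 2 *ℂ x a b) (w j) z ≈ℂ -ℂ ι 2 *ℂ w (suc j) z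
    scaled = begin
      dΓ (λ a b → -ℂ ι 2 *ℂ x a b) (w j) z
        ≈⟨ dΓ-congᴮ (λ a b → solve 2 (λ c x → c :* x := c :* x :+ con 0ℚ :* x) refl (-ℂ ι 2) (x a b)) (w j) z ⟩
      dΓ (λ a b → -ℂ ι 2 *ℂ x a b +ℂ 0ℂ *ℂ x a b) (w j) z
        ≈⟨ dΓ-combine (-ℂ ι 2) x 0ℂ x (w j) z ⟩
      -ℂ ι 2 *ℂ w (suc j) z +ℂ 0ℂ *ℂ w (suc j) z
        ≈⟨ solve 2 (λ c x → c :* x :+ con 0ℚ :* x := c :* x) refl (-ℂ ι 2) _ ⟩
      -ℂ ι 2 *ℂ w (suc j) z ∎

  -- Each commutation of y past x contributes a weight λ₀ - 2i, and these sum to (j + 1)(λ₀ - j)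
  -- over i from 0 to j.
  descend : ∀ j → dΓ y (w (suc j)) ≈ⱽ (ι (suc j) *ℂ (λ₀ +ℂ -ℂ ι j)) •ⱽ w j
  descend zero z = begin
    dΓ y (dΓ x v) z             ≈⟨ dΓ-commutator yx v z ⟩
    dΓ x (dΓ y v) z +ℂ dΓ h v z ≈⟨ +-cong (dΓ-0 x yv≈0 z) (hv≈λv z) ⟩
    0ℂ +ℂ λ₀ *ℂ v z
      ≈⟨ solve 2 (λ l v → con 0ℚ :+ l :* v := con 1ℚ :* (l :+ :- con 0ℚ) :* v) refl λ₀ (v z) ⟩
    1ℂ *ℂ (λ₀ +ℂ -ℂ 0ℂ) *ℂ v z ∎
  descend (suc j) z = begin
    dΓ y (dΓ x (w (suc j))) z
      ≈⟨ dΓ-commutator yx (w (suc j)) z ⟩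
    dΓ x (dΓ y (w (suc j))) z +ℂ dΓ h (w (suc j)) z
      ≈⟨ +-cong (trans (dΓ-cong x (descend j) z) (dΓ-• x _ (w j) z)) (weight (suc j) z) ⟩
    ι (suc j) *ℂ (λ₀ +ℂ -ℂ ι j) *ℂ w (suc j) z +ℂ (λ₀ +ℂ -ℂ (ι 2 *ℂ ι (suc j))) *ℂ w (suc j) z
      ≈⟨ +-cong (*-congʳ (*-congʳ (ι-suc j))) (*-congʳ (+-congˡ (-‿cong (*-congˡ (ι-suc j))))) ⟩
    (1ℂ +ℂ ι j) *ℂ (λ₀ +ℂ -ℂ ι j) *ℂ w (suc j) z +ℂ (λ₀ +ℂ -ℂ (ι 2 *ℂ (1ℂ +ℂ ι j))) *ℂ w (suc j) z
      ≈⟨ solve 3 (λ l n v → (con 1ℚ :+ n) :* (l :+ :- n) :* v :+ (l :+ :- (con (int (+ 2)) :* (con 1ℚ :+ n))) :* v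
           := (con 1ℚ :+ (con 1ℚ :+ n)) :* (l :+ :- (con 1ℚ :+ n)) :* v) refl λ₀ (ι j) (w (suc j) z) ⟩
    (1ℂ +ℂ (1ℂ +ℂ ι j)) *ℂ (λ₀ +ℂ -ℂ (1ℂ +ℂ ι j)) *ℂ w (suc j) z
      ≈⟨ *-congʳ (*-cong (trans (ι-suc (suc j)) (+-congˡ (ι-suc j))) (+-congˡ (-‿cong (ι-suc j)))) ⟨
    ι (suc (suc j)) *ℂ (λ₀ +ℂ -ℂ ι (suc j)) *ℂ w (suc j) z ∎

  -- Applying y climbs back along the string, and the scalars met on the way are positive.
  -- Positivity is stated as equality with some `ι (suc m)`, the form that can be cancelled.
  injective : ∀ n → (∀ j → j < n → ∃[ m ] λ₀ +ℂ -ℂ ι j ≈ℂ ι (suc m)) → w n ≈ⱽ 0ⱽ → v ≈ⱽ 0ⱽ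
  injective zero    positive w≈0 = w≈0
  injective (suc n) positive w≈0 = injective n (λ j j<n → positive j (ℕ.m<n⇒m<1+n j<n)) λ z →
    let m , λ-n≈m = positive n (ℕ.n<1+n n) in
    ι-cancel₀ m (ι-cancel₀ n (begin
      ι (suc n) *ℂ (ι (suc m) *ℂ w n z)         ≈⟨ *-assoc _ _ _ ⟨
      ι (suc n) *ℂ ι (suc m) *ℂ w n z           ≈⟨ *-congʳ (*-congˡ λ-n≈m) ⟨
      ι (suc n) *ℂ (λ₀ +ℂ -ℂ ι n) *ℂ w n z     ≈⟨ descend n z ⟨
      dΓ y (w (suc n)) z                         ≈⟨ dΓ-0 y w≈0 z ⟩
      0ℂ                                         ∎))

-- T-modules

Lagrange-closed : ∀ {ℓ D} {Q : Pred (V D) ℓ} → IsSubspace Q → (∀ {v} → Q v → Q (A ·ⱽ v)) →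
  ∀ i l {v} → Q v → Q (Lagrange i l ·ⱽ v)
Lagrange-closed {Q = Q} Q-sub A-closed i = go
  where
  open IsSubspace Q-sub
  go : ∀ l {v} → Q v → Q (Lagrange i l ·ⱽ v)
  go []      {v} q = respects (λ y → sym (1ᴹ-·ⱽ v y)) q
  go (j ∷ l) {v} q = respects
    (λ y → sym (trans (·ᴹ-·ⱽ (factor i j) (Lagrange i l) v y) (factor-·ⱽ i j (Lagrange i l ·ⱽ v) y)))
    (•-closed _ (+-closed (A-closed (go l q)) (•-closed _ (go l q))))

module TModule {ℓ} {D : ℕ} (W : Pred (V D) ℓ) (W-module : IsTModule W) where
  open IsTModule W-module

  Xₘ-closed : ∀ {v} → W v → W (dΓ Xₘ v)
  Xₘ-closed {v} w = respects (A-dΓ v) (T-closed A∈T w)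

  Zₘ-closed : ∀ {v} → W v → W (dΓ Zₘ v)
  Zₘ-closed {v} w = respects (A*-dΓ v) (T-closed A*∈T w)

  -- gl₂ is spanned by 1, Z, X and [X, Z].
  dΓ-closed : ∀ B {v} → W v → W (dΓ B v)
  dΓ-closed B {v} w = respects decompose
    (+-closed (+-closed (•-closed p (•-closed (ι D) w)) (•-closed q (Zₘ-closed w)))
      (+-closed (•-closed s (Xₘ-closed w)) (•-closed t (+-closed
        (Xₘ-closed (Zₘ-closed w)) (•-closed (-ℂ 1ℂ) (Zₘ-closed (Xₘ-closed w)))))))
    where
    -- Coordinates of B in the basis 1, Z, X and [X, Z]; the quarter in t compensates for the
    -- entries 2 and -2 of F = [X, Z].
    p q s t : ℂ
    p = rational ½ *ℂ (B 0F 0F +ℂ B 1F 1F)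
    q = rational ½ *ℂ (B 0F 0F +ℂ -ℂ B 1F 1F)
    s = rational ½ *ℂ (B 0F 1F +ℂ B 1F 0F)
    t = rational (½ ℚ.* ½) *ℂ (B 1F 0F +ℂ -ℂ B 0F 1F)
    I F : 𝕄₂
    I = mat₂ 1ℂ 0ℂ 0ℂ 1ℂ
    F = mat₂ 0ℂ (-ℂ ι 2) (ι 2) 0ℂ
    XZ≈ZX+F : ∀ a b → (Xₘ ·² Zₘ) a b ≈ℂ (Zₘ ·² Xₘ) a b +ℂ F a b
    XZ≈ZX+F = ≈²-entries
      (≡⇒≈ℂ (λ _ → ≡.refl) (λ _ → ≡.refl)) (≡⇒≈ℂ (λ _ → ≡.refl) (λ _ → ≡.refl))
      (≡⇒≈ℂ (λ _ → ≡.refl) (λ _ → ≡.refl)) (≡⇒≈ℂ (λ _ → ≡.refl) (λ _ → ≡.refl))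
    B≈ : (λ a b → 1ℂ *ℂ (p *ℂ I a b +ℂ q *ℂ Zₘ a b) +ℂ 1ℂ *ℂ (s *ℂ Xₘ a b +ℂ t *ℂ F a b)) ≈² B
    B≈ = ≈²-entries
      (solve 4 (λ a b c d → con 1ℚ :* (con ½ :* (a :+ d) :* con 1ℚ :+ con ½ :* (a :+ :- d) :* con 1ℚ) :+
         con 1ℚ :* (con ½ :* (b :+ c) :* con 0ℚ :+ con (½ ℚ.* ½) :* (c :+ :- b) :* con 0ℚ) := a) refl
         (B 0F 0F) (B 0F 1F) (B 1F 0F) (B 1F 1F))
      (solve 4 (λ a b c d → con 1ℚ :* (con ½ :* (a :+ d) :* con 0ℚ :+ con ½ :* (a :+ :- d) :* con 0ℚ) :+
         con 1ℚ :* (con ½ :* (b :+ c) :* con 1ℚ :+ con (½ ℚ.* ½) :* (c :+ :- b) :* (:- con (int (+ 2)))) := b) refl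
         (B 0F 0F) (B 0F 1F) (B 1F 0F) (B 1F 1F))
      (solve 4 (λ a b c d → con 1ℚ :* (con ½ :* (a :+ d) :* con 0ℚ :+ con ½ :* (a :+ :- d) :* con 0ℚ) :+
         con 1ℚ :* (con ½ :* (b :+ c) :* con 1ℚ :+ con (½ ℚ.* ½) :* (c :+ :- b) :* con (int (+ 2))) := c) refl
         (B 0F 0F) (B 0F 1F) (B 1F 0F) (B 1F 1F))
      (solve 4 (λ a b c d → con 1ℚ :* (con ½ :* (a :+ d) :* con 1ℚ :+ con ½ :* (a :+ :- d) :* (:- con 1ℚ)) :+
         con 1ℚ :* (con ½ :* (b :+ c) :* con 0ℚ :+ con (½ ℚ.* ½) :* (c :+ :- b) :* con 0ℚ) := d) refl
         (B 0F 0F) (B 0F 1F) (B 1F 0F) (B 1F 1F))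
    F-commutator : ∀ y → dΓ Xₘ (dΓ Zₘ v) y +ℂ -ℂ 1ℂ *ℂ dΓ Zₘ (dΓ Xₘ v) y ≈ℂ dΓ F v y
    F-commutator y = trans (+-congʳ (dΓ-commutator XZ≈ZX+F v y))
      (solve 2 (λ a b → a :+ b :+ :- con 1ℚ :* a := b) refl _ _)
    decompose : ∀ y → p *ℂ (ι D *ℂ v y) +ℂ q *ℂ dΓ Zₘ v y +ℂ
      (s *ℂ dΓ Xₘ v y +ℂ t *ℂ (dΓ Xₘ (dΓ Zₘ v) y +ℂ -ℂ 1ℂ *ℂ dΓ Zₘ (dΓ Xₘ v) y)) ≈ℂ dΓ B v y
    decompose y = begin
      p *ℂ (ι D *ℂ v y) +ℂ q *ℂ dΓ Zₘ v y +ℂ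
      (s *ℂ dΓ Xₘ v y +ℂ t *ℂ (dΓ Xₘ (dΓ Zₘ v) y +ℂ -ℂ 1ℂ *ℂ dΓ Zₘ (dΓ Xₘ v) y))
        ≈⟨ +-cong (+-congʳ (*-congˡ (sym (dΓ-identity v y)))) (+-congˡ (*-congˡ (F-commutator y))) ⟩
      p *ℂ dΓ I v y +ℂ q *ℂ dΓ Zₘ v y +ℂ (s *ℂ dΓ Xₘ v y +ℂ t *ℂ dΓ F v y)
        ≈⟨ +-cong (dΓ-combine p I q Zₘ v y) (dΓ-combine s Xₘ t F v y) ⟨
      dΓ (λ a b → p *ℂ I a b +ℂ q *ℂ Zₘ a b) v y +ℂ dΓ (λ a b → s *ℂ Xₘ a b +ℂ t *ℂ F a b) v y
        ≈⟨ +-cong (*-identityˡ _) (*-identityˡ _) ⟨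
      1ℂ *ℂ dΓ (λ a b → p *ℂ I a b +ℂ q *ℂ Zₘ a b) v y +ℂ
      1ℂ *ℂ dΓ (λ a b → s *ℂ Xₘ a b +ℂ t *ℂ F a b) v y
        ≈⟨ dΓ-combine 1ℂ _ 1ℂ _ v y ⟨
      dΓ (λ a b → 1ℂ *ℂ (p *ℂ I a b +ℂ q *ℂ Zₘ a b) +ℂ 1ℂ *ℂ (s *ℂ Xₘ a b +ℂ t *ℂ F a b)) v y
        ≈⟨ dΓ-congᴮ B≈ v y ⟩
      dΓ B v y ∎

  iterate-closed : ∀ B n {v} → W v → W (iterate B n v)
  iterate-closed B zero    w = w
  iterate-closed B (suc n) w = dΓ-closed B (iterate-closed B n w)

  E-closed : ∀ i {v} → W v → W (E i ·ⱽ v)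
  E-closed i = Lagrange-closed isSubspace (T-closed A∈T) i (nodes D i)

  -- PW is a T-module too, as P⁻¹AP = Aᵋ; only its closure under A is needed here.
  Eᵋ-closed : ∀ i {v} → W v → W (Eᵋ i ·ⱽ v)
  Eᵋ-closed i {v} w = respects (λ y → sym (Eᵋ-·ⱽ i v y))
    (Lagrange-closed PW-subspace PW-A-closed i (nodes D i) {P ·ⱽ v} (respects (λ y → sym (P⁻¹-P v y)) w))
    where
    PW : Pred (V D) ℓ
    PW z = W (P⁻¹ ·ⱽ z)
    PW-subspace : IsSubspace PW
    PW-subspace = record
      { respects = λ z≈z′ → respects (·ⱽ-cong P⁻¹ z≈z′)
      ; 0-closed = respects (λ y → sym (·ⱽ-0 P⁻¹ (λ _ → refl) y)) 0-closed
      ; +-closed = λ {z} {z′} p q → respects (λ y → sym (·ⱽ-+ P⁻¹ z z′ y)) (+-closed p q)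
      ; •-closed = λ c {z} p → respects (λ y → sym (·ⱽ-• P⁻¹ c z y)) (•-closed c p)
      }
    YP⁻¹≈P⁻¹X : Yₘ ·² P₁⁻¹ ≈² P₁⁻¹ ·² Xₘ
    YP⁻¹≈P⁻¹X = ≈²-entries
      (≡⇒≈ℂ (λ _ → ≡.refl) (λ _ → ≡.refl)) (≡⇒≈ℂ (λ _ → ≡.refl) (λ _ → ≡.refl))
      (≡⇒≈ℂ (λ _ → ≡.refl) (λ _ → ≡.refl)) (≡⇒≈ℂ (λ _ → ≡.refl) (λ _ → ≡.refl))
    PW-A-closed : ∀ {z} → PW z → PW (A ·ⱽ z)
    PW-A-closed {z} p = respects
      (λ y → trans (dΓ-⊗ P₁⁻¹ YP⁻¹≈P⁻¹X z y) (·ⱽ-cong P⁻¹ (λ x → sym (A-dΓ z x)) y))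
      (dΓ-closed Yₘ p)

  -- A grading Y of W that R carries to the grading by weight.
  record Grading : Set ℓ where
    field
      R        : V D → V D
      R-cong   : ∀ {v w} → v ≈ⱽ w → R v ≈ⱽ R w
      R-0      : ∀ {v} → v ≈ⱽ 0ⱽ → R v ≈ⱽ 0ⱽ
      F        : 𝕄₂
      R-lower  : ∀ v → dΓ (lower 1ℂ) (R v) ≈ⱽ R (dΓ F v)
      Y        : ℕ → V D → V D
      R-Y      : ∀ k v → R (Y k v) ≈ⱽ π k (R v)

    Vanishes : ℕ → Set ℓ
    Vanishes k = ∀ {w} → W w → Y k w ≈ⱽ 0ⱽ

    -- R u has weight r, and lowering it gives R applied to an (r-1)-st component of a vector of W,
    -- which is zero; at r = 0 nothing lies below. So N plus any multiple of the lowering operator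
    -- acts on R u as r.
    extremal : ∀ r → (∀ k → suc k ≡ r → Vanishes k) → ∀ {u w} → W w → u ≈ⱽ Y r w → Extremal* r (R u)
    extremal r lower-vanishes {u} {w} w∈W u≈Yw =
      extremal-part (-ℂ 1ℂ) (≈²-entries (solve 0 (con 1ℚ :* con 0ℚ :+ :- con 1ℚ :* con 0ℚ := con 0ℚ) refl)
        (solve 0 (con 1ℚ :* con 0ℚ :+ :- con 1ℚ :* con 1ℚ := :- con 1ℚ) refl)
        (solve 0 (con 1ℚ :* con 0ℚ :+ :- con 1ℚ :* con 0ℚ := con 0ℚ) refl)
        (solve 0 (con 1ℚ :* con 1ℚ :+ :- con 1ℚ :* con 0ℚ := con 1ℚ) refl)) ,
      extremal-part 1ℂ (≈²-entries (solve 0 (con 1ℚ :* con 0ℚ :+ con 1ℚ :* con 0ℚ := con 0ℚ) refl)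
        (solve 0 (con 1ℚ :* con 0ℚ :+ con 1ℚ :* con 1ℚ := con 1ℚ) refl)
        (solve 0 (con 1ℚ :* con 0ℚ :+ con 1ℚ :* con 0ℚ := con 0ℚ) refl)
        (solve 0 (con 1ℚ :* con 1ℚ :+ con 1ℚ :* con 0ℚ := con 1ℚ) refl))
      where
      Ru≈ : R u ≈ⱽ π r (R w)
      Ru≈ y = trans (R-cong u≈Yw y) (R-Y r w y)
      lowered : ∀ r → (∀ k → suc k ≡ r → Vanishes k) → dΓ (lower 1ℂ) (π r (R w)) ≈ⱽ 0ⱽ
      lowered zero    _ y = lower-π₀ 1ℂ (R w) y
      lowered (suc k) z y = begin
        dΓ (lower 1ℂ) (π (suc k) (R w)) y  ≈⟨ lower-π 1ℂ k (R w) y ⟨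
        π k (dΓ (lower 1ℂ) (R w)) y        ≈⟨ mask-cong (λ n → δ n k) (R-lower w) y ⟩
        π k (R (dΓ F w)) y                 ≈⟨ R-Y k (dΓ F w) y ⟨
        R (Y k (dΓ F w)) y                 ≈⟨ R-0 (z k ≡.refl (dΓ-closed F w∈W)) y ⟩
        0ℂ                                 ∎
      fRu≈0 : dΓ (lower 1ℂ) (R u) ≈ⱽ 0ⱽ
      fRu≈0 y = trans (dΓ-cong (lower 1ℂ) Ru≈ y) (lowered r lower-vanishes y)
      NRu≈ : dΓ Nₘ (R u) ≈ⱽ ι r •ⱽ R u
      NRu≈ y = trans (dΓ-cong Nₘ Ru≈ y) (trans (N-π r (R w) y) (*-congˡ (sym (Ru≈ y))))
      extremal-part : ∀ c {B} → (λ a b → 1ℂ *ℂ Nₘ a b +ℂ c *ℂ lower 1ℂ a b) ≈² B → dΓ B (R u) ≈ⱽ ι r •ⱽ R u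
      extremal-part c {B} p y = begin
        dΓ B (R u) y
          ≈⟨ dΓ-congᴮ p (R u) y ⟨
        dΓ (λ a b → 1ℂ *ℂ Nₘ a b +ℂ c *ℂ lower 1ℂ a b) (R u) y
          ≈⟨ dΓ-combine 1ℂ Nₘ c (lower 1ℂ) (R u) y ⟩
        1ℂ *ℂ dΓ Nₘ (R u) y +ℂ c *ℂ dΓ (lower 1ℂ) (R u) y
          ≈⟨ +-cong (trans (*-identityˡ _) (NRu≈ y)) (trans (*-congˡ (fRu≈0 y)) (zeroʳ c)) ⟩
        ι r *ℂ R u y +ℂ 0ℂ
          ≈⟨ +-identityʳ _ ⟩
        ι r *ℂ R u y ∎

    -- Induction on k: if the component before k vanishes on W, then Y k w is extremal of index k.
    -- Being in W with k < r, it has no E*-component of weight k, so `Strings.vanishing` makes it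
    -- zero.
    vanishing-transfer : (∀ k {v} → W v → W (Y k v)) →
      ∀ α β → (∀ k v → Extremal* k (R v) → Extremal (up α) (down β) k v) →
      ∀ r → (∀ k → k < r → ∀ {w} → W w → π k w ≈ⱽ 0ⱽ) → ∀ k → k < r → Vanishes k
    vanishing-transfer Y-closed α β pull r π-vanishes = go
      where
      go : ∀ k → k < r → Vanishes k
      from-extremal : ∀ k → k < r → (∀ j → suc j ≡ k → Vanishes j) → Vanishes k
      from-extremal k k<r z {w} w∈W = Strings.vanishing α β k (Y k w)
        (pull k (Y k w) (extremal k z w∈W λ _ → refl)) (π-vanishes k k<r (Y-closed k w∈W))
      go zero    k<r = from-extremal zero k<r λ _ ()
      go (suc k) k<r = from-extremal (suc k) k<r λ { j ≡.refl → go k (ℕ.<⇒≤ k<r) }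

  -- The matrices F are the conjugates of `lower 1ℂ` by no, one and two factors of P₁. Lying in gl₂,
  -- they preserve W.
  grading* gradingᴱ gradingᵋ : Grading
  grading* = record
    { R = λ v → v ; R-cong = λ p → p ; R-0 = λ p → p
    ; F = lower 1ℂ ; R-lower = λ v y → refl
    ; Y = π ; R-Y = λ k v y → refl }
  gradingᴱ = record
    { R = P ·ⱽ_ ; R-cong = ·ⱽ-cong P ; R-0 = ·ⱽ-0 P
    ; F = mat₂ (-ℂ h) h (-ℂ h) h ; R-lower = dΓ-⊗ P₁ (≈²-entries
        (≡⇒≈ℂ (λ _ → ≡.refl) (λ _ → ≡.refl)) (≡⇒≈ℂ (λ _ → ≡.refl) (λ _ → ≡.refl))
        (≡⇒≈ℂ (λ _ → ≡.refl) (λ _ → ≡.refl)) (≡⇒≈ℂ (λ _ → ≡.refl) (λ _ → ≡.refl)))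
    ; Y = λ k → E k ·ⱽ_ ; R-Y = P-E }
    where
    h : ℂ
    h = rational ½ *ℂ 𝐢
  gradingᵋ = record
    { R = λ v → P ·ⱽ (P ·ⱽ v) ; R-cong = ·ⱽ-cong P ∘ ·ⱽ-cong P ; R-0 = ·ⱽ-0 P ∘ ·ⱽ-0 P
    ; F = mat₂ (rational ½) (-ℂ h) (-ℂ h) (-ℂ rational ½)
    ; R-lower = λ v y → trans (Grading.R-lower gradingᴱ (P ·ⱽ v) y) (·ⱽ-cong P (dΓ-⊗ P₁ (≈²-entries
        (≡⇒≈ℂ (λ _ → ≡.refl) (λ _ → ≡.refl)) (≡⇒≈ℂ (λ _ → ≡.refl) (λ _ → ≡.refl))
        (≡⇒≈ℂ (λ _ → ≡.refl) (λ _ → ≡.refl)) (≡⇒≈ℂ (λ _ → ≡.refl) (λ _ → ≡.refl))) v) y)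
    ; Y = λ k → Eᵋ k ·ⱽ_
    ; R-Y = λ k v y → trans (·ⱽ-cong P (P-Eᵋ k v) y) (P-E k (P ·ⱽ v) y) }
    where
    h : ℂ
    h = rational ½ *ℂ 𝐢

-- The support of a T-module

iterate-lower-π : ∀ n m {D} (v : V D) →
  iterate (lower 1ℂ) n (π (n + m) v) ≈ⱽ π m (iterate (lower 1ℂ) n v)
iterate-lower-π zero    m v y = refl
iterate-lower-π (suc n) m v y = begin
  dΓ (lower 1ℂ) (iterate (lower 1ℂ) n (π (suc n + m) v)) y
    ≡⟨ cong (λ k → dΓ (lower 1ℂ) (iterate (lower 1ℂ) n (π k v)) y) (≡.sym (ℕ.+-suc n m)) ⟩
  dΓ (lower 1ℂ) (iterate (lower 1ℂ) n (π (n + suc m) v)) y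
    ≈⟨ dΓ-cong (lower 1ℂ) (iterate-lower-π n (suc m) v) y ⟩
  dΓ (lower 1ℂ) (π (suc m) (iterate (lower 1ℂ) n v)) y
    ≈⟨ lower-π 1ℂ m (iterate (lower 1ℂ) n v) y ⟨
  π m (iterate (lower 1ℂ) (suc n) v) y ∎

iterate-raise-π : ∀ n m {D} (v : V D) →
  iterate (raise 1ℂ) n (π m v) ≈ⱽ π (n + m) (iterate (raise 1ℂ) n v)
iterate-raise-π zero    m v y = refl
iterate-raise-π (suc n) m v y = trans (dΓ-cong (raise 1ℂ) (iterate-raise-π n m v) y)
  (sym (raise-π 1ℂ (n + m) (iterate (raise 1ℂ) n v) y))

Z-π : ∀ k {D} (v : V D) → dΓ Zₘ (π k v) ≈ⱽ (ι D +ℂ -ℂ (ι 2 *ℂ ι k)) •ⱽ π k v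
Z-π k {D} v y = begin
  dΓ Zₘ (π k v) y                                      ≈⟨ A*-dΓ (π k v) y ⟨
  (A* ·ⱽ π k v) y                                      ≈⟨ diagonal-·ⱽ (rational (θ D (wt y))) y (π k v) ⟩
  mask (λ m → rational (θ D m)) (π k v) y              ≈⟨ mask-π (λ m → rational (θ D m)) k v y ⟩
  rational (θ D k) *ℂ π k v y                          ≈⟨ *-congʳ (θ-ι D k) ⟩
  (ι D +ℂ -ℂ (ι 2 *ℂ ι k)) *ℂ π k v y                 ∎

ι-difference : ∀ a m {b} → a + m ≡ b → ι b +ℂ -ℂ ι a ≈ℂ ι m
ι-difference a m ≡.refl = trans (+-congʳ (ι-+ a m))
  (solve 2 (λ a m → a :+ m :+ :- a := m) refl (ι a) (ι m))

module Support {ℓ} {D : ℕ} (W : Pred (V D) ℓ) (W-module : IsTModule W) where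
  open TModule W W-module

  πVanishes : ℕ → Set ℓ
  πVanishes k = ∀ {w} → W w → π k w ≈ⱽ 0ⱽ

  -- The lowering string from weight k > D - r has to leave the support at weight
  -- r - 1, but sl₂ makes lowering injective all the way down to D - k < r.
  above : ∀ r → (∀ k → k < r → πVanishes k) → ∀ t k → D < k + t → D < k + r → πVanishes k
  -- The argument t is fuel for a descent from the top: k + t > D is maintained, and at t = 0 the
  -- weight exceeds D.
  above r low zero    k D<k+t D<k+r {w} _ = π-above k (subst (D <_) (ℕ.+-identityʳ k) D<k+t) w
  above r low (suc t) k D<k+t D<k+r {w} w∈W = by-cases r low D<k+r (k ℕ.<? r)
    where
    next : πVanishes (suc k)
    next = above r low t (suc k) (subst (D <_) (ℕ.+-suc k t) D<k+t) (ℕ.m<n⇒m<1+n D<k+r)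
    raised : dΓ (raise 1ℂ) (π k w) ≈ⱽ 0ⱽ
    raised y = trans (sym (raise-π 1ℂ k w y)) (next (dΓ-closed (raise 1ℂ) w∈W) y)
    by-cases : ∀ r → (∀ k → k < r → πVanishes k) → D < k + r → Dec (k < r) → π k w ≈ⱽ 0ⱽ
    by-cases r       low D<k+r (yes k<r) = low k k<r w∈W
    by-cases zero    low D<k+r (no _)    = π-above k (subst (D <_) (ℕ.+-identityʳ k) D<k+r) w
    -- Weight k + 1 is already empty, so raising kills `π k w`, whose weight for h = -Z is 2k - D.
    -- The n = k - q lowering steps lead to weight q = r - 1, which is empty too.
    by-cases (suc q) low D<k+r (no k≮r)  = WeightString.injective (lower 1ℂ) (raise 1ℂ) h yx hx
      (ι k +ℂ ι k +ℂ -ℂ ι D) (π k w) raised hv n positive string-ends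
      where
      n : ℕ
      n = k ℕ.∸ q
      k≡ : n + q ≡ k
      k≡ = ℕ.m∸n+n≡m (ℕ.<⇒≤ (ℕ.≮⇒≥ k≮r))
      h : 𝕄₂
      h = mat₂ (-ℂ 1ℂ) 0ℂ 0ℂ 1ℂ
      yx : ∀ a b → (raise 1ℂ ·² lower 1ℂ) a b ≈ℂ (lower 1ℂ ·² raise 1ℂ) a b +ℂ h a b
      yx = ≈²-entries
        (≡⇒≈ℂ (λ _ → ≡.refl) (λ _ → ≡.refl)) (≡⇒≈ℂ (λ _ → ≡.refl) (λ _ → ≡.refl))
        (≡⇒≈ℂ (λ _ → ≡.refl) (λ _ → ≡.refl)) (≡⇒≈ℂ (λ _ → ≡.refl) (λ _ → ≡.refl))
      hx : ∀ a b → (h ·² lower 1ℂ) a b ≈ℂ (lower 1ℂ ·² h) a b +ℂ -ℂ ι 2 *ℂ lower 1ℂ a b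
      hx = ≈²-entries
        (≡⇒≈ℂ (λ _ → ≡.refl) (λ _ → ≡.refl)) (≡⇒≈ℂ (λ _ → ≡.refl) (λ _ → ≡.refl))
        (≡⇒≈ℂ (λ _ → ≡.refl) (λ _ → ≡.refl)) (≡⇒≈ℂ (λ _ → ≡.refl) (λ _ → ≡.refl))
      -Z≈h : (λ a b → -ℂ 1ℂ *ℂ Zₘ a b +ℂ 0ℂ *ℂ Zₘ a b) ≈² h
      -Z≈h = ≈²-entries
        (≡⇒≈ℂ (λ _ → ≡.refl) (λ _ → ≡.refl)) (≡⇒≈ℂ (λ _ → ≡.refl) (λ _ → ≡.refl))
        (≡⇒≈ℂ (λ _ → ≡.refl) (λ _ → ≡.refl)) (≡⇒≈ℂ (λ _ → ≡.refl) (λ _ → ≡.refl))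
      hv : dΓ h (π k w) ≈ⱽ (ι k +ℂ ι k +ℂ -ℂ ι D) •ⱽ π k w
      hv y = begin
        dΓ h (π k w) y
          ≈⟨ dΓ-congᴮ -Z≈h (π k w) y ⟨
        dΓ (λ a b → -ℂ 1ℂ *ℂ Zₘ a b +ℂ 0ℂ *ℂ Zₘ a b) (π k w) y
          ≈⟨ dΓ-combine (-ℂ 1ℂ) Zₘ 0ℂ Zₘ (π k w) y ⟩
        -ℂ 1ℂ *ℂ dΓ Zₘ (π k w) y +ℂ 0ℂ *ℂ dΓ Zₘ (π k w) y
          ≈⟨ solve 1 (λ z → :- con 1ℚ :* z :+ con 0ℚ :* z := :- z) refl _ ⟩
        -ℂ dΓ Zₘ (π k w) y
          ≈⟨ -‿cong (Z-π k w y) ⟩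
        -ℂ ((ι D +ℂ -ℂ (ι 2 *ℂ ι k)) *ℂ π k w y)
          ≈⟨ solve 3 (λ d k v → :- ((d :+ :- (con (int (+ 2)) :* k)) :* v) := (k :+ k :+ :- d) :* v) refl
             (ι D) (ι k) (π k w y) ⟩
        (ι k +ℂ ι k +ℂ -ℂ ι D) *ℂ π k w y ∎
      -- For j < k - q, the bound D ≤ k + q gives D + j < 2k, so no coefficient vanishes before the
      -- string ends.
      positive : ∀ j → j < n → ∃[ m ] ι k +ℂ ι k +ℂ -ℂ ι D +ℂ -ℂ ι j ≈ℂ ι (suc m)
      positive j j<n = m , (begin
        ι k +ℂ ι k +ℂ -ℂ ι D +ℂ -ℂ ι j
          ≈⟨ solve 3 (λ k d j → k :+ k :+ :- d :+ :- j := k :+ k :+ :- (d :+ j)) refl (ι k) (ι D) (ι j) ⟩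
        ι k +ℂ ι k +ℂ -ℂ (ι D +ℂ ι j)
          ≈⟨ +-cong (ι-+ k k) (-‿cong (ι-+ D j)) ⟨
        ι (k + k) +ℂ -ℂ ι (D + j)
          ≈⟨ ι-difference (D + j) (suc m) (≡.trans (ℕ.+-suc (D + j) m) (ℕ.m+[n∸m]≡n D+j<k+k)) ⟩
        ι (suc m) ∎)
        where
        m : ℕ
        m = k + k ℕ.∸ suc (D + j)
        D≤k+q : D ≤ k + q
        D≤k+q = ℕ.s≤s⁻¹ (subst (D <_) (ℕ.+-suc k q) D<k+r)
        k+q+n≡k+k : k + q + n ≡ k + k
        k+q+n≡k+k = ≡.trans (ℕ.+-assoc k q n) (cong (_+_ k) (≡.trans (ℕ.+-comm q n) k≡))
        D+j<k+k : D + j < k + k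
        D+j<k+k = subst (D + j <_) k+q+n≡k+k (ℕ.+-mono-≤-< D≤k+q j<n)
      string-ends : iterate (lower 1ℂ) n (π k w) ≈ⱽ 0ⱽ
      string-ends y = begin
        iterate (lower 1ℂ) n (π k w) y
          ≡⟨ cong (λ k → iterate (lower 1ℂ) n (π k w) y) (≡.sym k≡) ⟩
        iterate (lower 1ℂ) n (π (n + q) w) y
          ≈⟨ iterate-lower-π n q w y ⟩
        π q (iterate (lower 1ℂ) n w) y
          ≈⟨ low q (ℕ.n<1+n q) (iterate-closed (lower 1ℂ) n w∈W) y ⟩
        0ℂ ∎

  -- Vectors of weight r in W are killed by lowering and have Z-eigenvalue d, so up to d raising
  -- steps are injective on them. A gap at weight n + r would thus empty weight r as well.
  interior : ∀ r d → D ≡ r + (r + d) → (∀ k → k < r → πVanishes k) →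
    ∀ n → n ≤ d → πVanishes (n + r) → πVanishes r
  interior r d D≡ low n n≤d n+r-vanishes {w} w∈W = WeightString.injective (raise 1ℂ) (lower 1ℂ) Zₘ yx hx
    (ι d) (π r w) (lowered r low) hv n positive string-ends
    where
    yx : ∀ a b → (lower 1ℂ ·² raise 1ℂ) a b ≈ℂ (raise 1ℂ ·² lower 1ℂ) a b +ℂ Zₘ a b
    yx = ≈²-entries
      (≡⇒≈ℂ (λ _ → ≡.refl) (λ _ → ≡.refl)) (≡⇒≈ℂ (λ _ → ≡.refl) (λ _ → ≡.refl))
      (≡⇒≈ℂ (λ _ → ≡.refl) (λ _ → ≡.refl)) (≡⇒≈ℂ (λ _ → ≡.refl) (λ _ → ≡.refl))
    hx : ∀ a b → (Zₘ ·² raise 1ℂ) a b ≈ℂ (raise 1ℂ ·² Zₘ) a b +ℂ -ℂ ι 2 *ℂ raise 1ℂ a b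
    hx = ≈²-entries
      (≡⇒≈ℂ (λ _ → ≡.refl) (λ _ → ≡.refl)) (≡⇒≈ℂ (λ _ → ≡.refl) (λ _ → ≡.refl))
      (≡⇒≈ℂ (λ _ → ≡.refl) (λ _ → ≡.refl)) (≡⇒≈ℂ (λ _ → ≡.refl) (λ _ → ≡.refl))
    lowered : ∀ r → (∀ k → k < r → πVanishes k) → dΓ (lower 1ℂ) (π r w) ≈ⱽ 0ⱽ
    lowered zero    _   y = lower-π₀ 1ℂ w y
    lowered (suc k) low y = trans (sym (lower-π 1ℂ k w y))
      (low k (ℕ.n<1+n k) (dΓ-closed (lower 1ℂ) w∈W) y)
    hv : dΓ Zₘ (π r w) ≈ⱽ ι d •ⱽ π r w
    hv y = trans (Z-π r w y) (*-congʳ (begin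
      ι D +ℂ -ℂ (ι 2 *ℂ ι r)
        ≈⟨ +-congʳ (trans (reflexive (cong ι D≡)) (trans (ι-+ r (r + d)) (+-congˡ (ι-+ r d)))) ⟩
      ι r +ℂ (ι r +ℂ ι d) +ℂ -ℂ (ι 2 *ℂ ι r)
        ≈⟨ solve 2 (λ r d → r :+ (r :+ d) :+ :- (con (int (+ 2)) :* r) := d) refl (ι r) (ι d) ⟩
      ι d ∎))
    positive : ∀ j → j < n → ∃[ m ] ι d +ℂ -ℂ ι j ≈ℂ ι (suc m)
    positive j j<n = d ℕ.∸ suc j ,
      ι-difference j _ (≡.trans (ℕ.+-suc j _) (ℕ.m+[n∸m]≡n (ℕ.≤-trans j<n n≤d)))
    string-ends : iterate (raise 1ℂ) n (π r w) ≈ⱽ 0ⱽ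
    string-ends y = trans (iterate-raise-π n r w y)
      (n+r-vanishes (iterate-closed (raise 1ℂ) n w∈W) y)

-- Each position consumed shifts both ends of the interval down by one; bits that contradict the two
-- membership conditions are refuted.
interval-size : ∀ {n} (S : Subset n) a b → a ≤ b → b ≤ n →
  (∀ i → i ∈ˢ S → a ≤ toℕ i × toℕ i < b) → (∀ i → a ≤ toℕ i → toℕ i < b → i ∈ˢ S) → a + ∣ S ∣ ≡ b
interval-size []          zero    zero    _         _         _    _    = ≡.refl
interval-size (true ∷ S)  (suc a) _       _         _         from _    with from zero Vec.here
... | () , _
interval-size (true ∷ S)  zero    zero    _         _         from _    with from zero Vec.here
... | _ , ()
interval-size (true ∷ S)  zero    (suc b) _         (s≤s b≤n) from to   = cong suc
  (interval-size S 0 b z≤n b≤n (λ i i∈S → z≤n , ℕ.s≤s⁻¹ (proj₂ (from (suc i) (Vec.there i∈S))))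
    (λ i _ i<b → drop-there (to (suc i) z≤n (s≤s i<b))))
interval-size (false ∷ S) zero    zero    _         _         from to   =
  interval-size S 0 0 z≤n z≤n (λ i i∈S → contradiction (proj₂ (from (suc i) (Vec.there i∈S))) λ ()) (λ _ _ ())
interval-size (false ∷ S) zero    (suc b) _         _         from to   with to zero z≤n (s≤s z≤n)
... | ()
interval-size (false ∷ S) (suc a) (suc b) (s≤s a≤b) (s≤s b≤n) from to   = cong suc
  (interval-size S a b a≤b b≤n
    (λ i i∈S → let p , q = from (suc i) (Vec.there i∈S) in ℕ.s≤s⁻¹ p , ℕ.s≤s⁻¹ q)
    (λ i p q → drop-there (to (suc i) (s≤s p) (s≤s q))))

-- Consequences of the endpoint: diameter and extremality

module Endpoint {ℓ} {D : ℕ} (W : Pred (V D) ℓ) (W-module : IsTModule W)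
  (r : ℕ) (endpoint : IsEndpoint W r) where
  open IsTModule W-module
  open TModule W W-module
  open Support W W-module

  r≤D : r ≤ D
  r≤D = proj₁ (proj₁ endpoint)

  isZero : ∀ k → πVanishes k → IsZero (E* k ⟪ W ⟫)
  isZero k z v (w , w∈W , v≈) y = trans (v≈ y) (trans (E*-π k w y) (z w∈W y))

  r-nonzero : ¬ πVanishes r
  r-nonzero z = proj₂ (proj₁ endpoint) (isZero r z)

  below-r : ∀ k → k < r → πVanishes k
  below-r k k<r {w} w∈W = ≈ⱽ-stable λ ¬zero → ℕ.<⇒≱ k<r (proj₂ endpoint k
    (ℕ.≤-trans (ℕ.<⇒≤ k<r) r≤D ,
     λ isZ → ¬zero λ y → trans (sym (E*-π k w y)) (isZ (E* k ·ⱽ w) (w , w∈W , λ _ → refl) y)))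

  -- Otherwise weight r would lie beyond D - r, where `above` leaves nothing. The fuel `suc D`
  -- suffices for every starting weight.
  r+r≤D : r + r ≤ D
  r+r≤D = ℕ.≮⇒≥ λ D<r+r → r-nonzero (above r below-r (suc D) r (ℕ.m≤n+m (suc D) r) D<r+r)

  diameter : ∀ d → IsDiameter W d → D ≡ r + (r + d)
  diameter d (S , S⇔ , ∣S∣≡) = ≡.trans D≡ (cong (λ d → r + (r + d)) d₀≡d)
    where
    d₀ : ℕ
    d₀ = D ℕ.∸ (r + r)
    D≡ : D ≡ r + (r + d₀)
    D≡ = ≡.trans (≡.sym (ℕ.m+[n∸m]≡n r+r≤D)) (ℕ.+-assoc r r d₀)
    from : ∀ i → i ∈ˢ S → r ≤ toℕ i × toℕ i < suc (r + d₀)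
    from i i∈S = r≤i , s≤s (ℕ.≮⇒≥ λ r+d₀<i → proj₂ supp (isZero (toℕ i) (above r below-r (suc D) (toℕ i)
      (ℕ.m≤n+m (suc D) (toℕ i)) (beyond r+d₀<i))))
      where
      supp : InSupport W (toℕ i)
      supp = Equivalence.to (S⇔ i) i∈S
      r≤i : r ≤ toℕ i
      r≤i = proj₂ endpoint (toℕ i) supp
      beyond : r + d₀ < toℕ i → D < toℕ i + r
      beyond p = subst₂ _<_ (≡.sym D≡) (ℕ.+-comm r (toℕ i)) (ℕ.+-monoʳ-< r p)
    to : ∀ i → r ≤ toℕ i → toℕ i < suc (r + d₀) → i ∈ˢ S
    -- If weight i were empty, `interior` would carry the vanishing back to weight r, contradicting
    -- the choice of r.
    to i r≤i (s≤s i≤) = Equivalence.from (S⇔ i) (ℕ.s≤s⁻¹ (Fin.toℕ<n i) , λ isZ →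
      r-nonzero (interior r d₀ D≡ below-r (toℕ i ℕ.∸ r) i∸r≤d₀
        λ {w} w∈W y → trans (reflexive (cong (λ k → π k w y) (ℕ.m∸n+n≡m r≤i)))
          (trans (sym (E*-π (toℕ i) w y)) (isZ (E* (toℕ i) ·ⱽ w) (w , w∈W , λ _ → refl) y))))
      where
      i∸r≤d₀ : toℕ i ℕ.∸ r ≤ d₀
      i∸r≤d₀ = ℕ.m≤n+o⇒m∸n≤o (toℕ i) r i≤
    d₀≡d : d₀ ≡ d
    d₀≡d = ℕ.suc-injective (≡.trans (≡.sym size) ∣S∣≡)
      where
      size : ∣ S ∣ ≡ suc d₀
      size = ℕ.+-cancelˡ-≡ r _ _ (≡.trans (interval-size S r (suc (r + d₀)) (ℕ.m≤n⇒m≤1+n (ℕ.m≤m+n r d₀))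
        (s≤s (subst (r + d₀ ≤_) (≡.sym D≡) (ℕ.m≤n+m (r + d₀) r))) from to) (≡.sym (ℕ.+-suc r d₀)))

  below-r-E : ∀ k → suc k ≡ r → Grading.Vanishes gradingᴱ k
  below-r-E k ≡.refl = Grading.vanishing-transfer gradingᴱ (λ k → E-closed k) 1ℂ 1ℂ
    (λ k v → pull*₀ k v) r below-r k (ℕ.n<1+n k)

  below-r-Eᵋ : ∀ k → suc k ≡ r → Grading.Vanishes gradingᵋ k
  below-r-Eᵋ k ≡.refl = Grading.vanishing-transfer gradingᵋ (λ k → Eᵋ-closed k) (-ℂ 𝐢) 𝐢
    (λ k v ext → pull₀ᵋ k v (pull*₀ k (P ·ⱽ v) ext)) r below-r k (ℕ.n<1+n k)

  extremal* : ∀ u → u ∈ E* r ⟪ W ⟫ → Extremal* r u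
  extremal* u (w , w∈W , u≈) = Grading.extremal grading* r
    (λ { k ≡.refl → below-r k (ℕ.n<1+n k) }) w∈W λ y → trans (u≈ y) (E*-π r w y)

  extremalᴱ : ∀ u → u ∈ E r ⟪ W ⟫ → Extremal* r (P ·ⱽ u)
  extremalᴱ u (w , w∈W , u≈) = Grading.extremal gradingᴱ r below-r-E w∈W u≈

  extremalᵋ : ∀ u → u ∈ Eᵋ r ⟪ W ⟫ → Extremal* r (P ·ⱽ (P ·ⱽ u))
  extremalᵋ u (w , w∈W , u≈) = Grading.extremal gradingᵋ r below-r-Eᵋ w∈W u≈

theorem11p1 : ∀ {ℓ} (D : ℕ) .{{_ : NonZero D}} (W : Pred (V D) ℓ) → IsIrreducible W →
    (r d : ℕ) → IsEndpoint W r → IsDiameter W d →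
    (i j : ℕ) → i ≤ d → j ≤ d →
    ((u : V D) → ¬ (u ≈ⱽ 0ⱽ) → u ∈ E r ⟪ W ⟫ →
    (⟨ E* (r + i) ·ⱽ u , E* (r + j) ·ⱽ u ⟩ ≈ℂ δ i j *ℂ binomial·2⁻ d i *ℂ ‖ u ‖²) ×
    (⟨ Eᵋ (r + i) ·ⱽ u , Eᵋ (r + j) ·ⱽ u ⟩ ≈ℂ δ i j *ℂ binomial·2⁻ d i *ℂ ‖ u ‖²)) ×
    ((u* : V D) → ¬ (u* ≈ⱽ 0ⱽ) → u* ∈ E* r ⟪ W ⟫ →
    (⟨ Eᵋ (r + i) ·ⱽ u* , Eᵋ (r + j) ·ⱽ u* ⟩ ≈ℂ δ i j *ℂ binomial·2⁻ d i *ℂ ‖ u* ‖²) ×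
    (⟨ E (r + i) ·ⱽ u* , E (r + j) ·ⱽ u* ⟩ ≈ℂ δ i j *ℂ binomial·2⁻ d i *ℂ ‖ u* ‖²)) ×
    ((uᵋ : V D) → ¬ (uᵋ ≈ⱽ 0ⱽ) → uᵋ ∈ Eᵋ r ⟪ W ⟫ →
    (⟨ E (r + i) ·ⱽ uᵋ , E (r + j) ·ⱽ uᵋ ⟩ ≈ℂ δ i j *ℂ binomial·2⁻ d i *ℂ ‖ uᵋ ‖²) ×
    (⟨ E* (r + i) ·ⱽ uᵋ , E* (r + j) ·ⱽ uᵋ ⟩ ≈ℂ δ i j *ℂ binomial·2⁻ d i *ℂ ‖ uᵋ ‖²))
theorem11p1 D W irreducible r d endpoint dia i j _ _ =
  -- P u is extremal for A*, hence u for A and P (P u) for Aᵋ. The two norms are read off the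
  -- E*-components of u and of P (P u).
  (λ u _ u∈ → let ext = extremalᴱ u u∈ in
    E*-norms₀ r d D≡ u (pull*₀ r u ext) i j ,
    Eᵋ-norms r d u (E*-normsᵋ r d D≡ (P ·ⱽ (P ·ⱽ u)) (push*ᵋ r (P ·ⱽ u) ext)) i j) ,
  -- Here u is extremal for A*, so both norms come from its rotations: P u is extremal for Aᵋ and P
  -- (P u) for A.
  (λ u _ u∈ → let ext = push*ᵋ r u (extremal* u u∈) in
    Eᵋ-norms r d u (E*-norms₀ r d D≡ (P ·ⱽ (P ·ⱽ u)) (pushᵋ₀ r (P ·ⱽ u) ext)) i j ,
    E-norms r d u (E*-normsᵋ r d D≡ (P ·ⱽ u) ext) i j) ,
  -- P (P u) is extremal for A*, hence P u for A and u for Aᵋ.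
  (λ u _ u∈ → let ext = pull*₀ r (P ·ⱽ u) (extremalᵋ u u∈) in
    E-norms r d u (E*-norms₀ r d D≡ (P ·ⱽ u) ext) i j ,
    E*-normsᵋ r d D≡ u (pull₀ᵋ r u ext) i j)
  where
  open Endpoint W (IsIrreducible.isTModule irreducible) r endpoint
  D≡ : D ≡ r + (r + d)
  D≡ = diameter d dia
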